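{- For every integer $q\ge 2$ and every $\xi>0$ there exists $n_0\in\mathbb{N}$ such that the following holds whenever $n\ge n_0$ and $q\mid n$. Let $G$ be a $q$-graph on $n$ vertices such that (i) for some $d\ge\xi$, we have $(d-0.01\xi)n^{q-1}\le |G(v)|\le (d+0.01\xi)n^{q-1}$ for all $v\in V(G)$; (ii) every vertex is contained in at least $\xi n^{q}$ copies of $K^{(q)}_{q+1}$ in $G$; (iii) $|G(v)\cap G(w)|\ge \xi n^{q-1}$ for all $v,w\in V(G)$. Then $G$ contains $0.01\xi n^{q-1}$ pairwise edge-disjoint perfect matchings.
   Context: A $q$-graph is a hypergraph all of whose edges have size $q$, identified with its edge set. For a vertex $v$, $G(v)$ is the $(q-1)$-graph on $V(G)\setminus\{v\}$ whose edges are all sets $f$ with $f\cup\{v\}\in G$; $G(v)\cap G(w)$ is the set of common such $(q-1)$-sets. $K^{(q)}_{q+1}$ denotes the complete $q$-graph on $q+1$ vertices; a copy of it in $G$ is a $(q+1)$-set all of whose $q$-subsets are edges of $G$.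
   Formalization: The parameter ξ > 0 and the density d are taken to be rational numbers instead of real numbers; everything else is as stated. -}

module Defs where

open import Data.Nat using (ℕ; zero; suc; _^_; _∸_; _≡ᵇ_)
open import Data.Bool using (Bool; true; false; _∧_; _∨_; not)
open import Data.Fin using (Fin)
open import Data.Fin.Subset using (Subset; _∈_; _∪_; _∩_; ⁅_⁆; ∣_∣; Empty)
open import Data.Vec using (Vec; []; _∷_; lookup)
open import Data.List using (List; []; _∷_; map; _++_; length; filterᵇ)
open import Data.Bool.ListAction using (and)
open import Data.Integer using (+_)
open import Data.Rational using (ℚ; _/_; _*_)
open import Data.Product using (Σ; ∃; _×_)
open import Relation.Binary.PropositionalEquality using (_≡_; _≢_)

toℚ : ℕ → ℚ
toℚ m = + m / 1

c₀ : ℚ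
c₀ = + 1 / 100

-- a q-graph on vertex set Fin n: a (decidable) set of q-subsets, given
-- by its characteristic function on subsets of Fin n
Hypergraph : ℕ → Set
Hypergraph n = Subset n → Bool

IsQGraph : ∀ {n} → ℕ → Hypergraph n → Set
IsQGraph q G = ∀ e → G e ≡ true → ∣ e ∣ ≡ q

allSubsets : ∀ n → List (Subset n)
allSubsets zero = [] ∷ []
allSubsets (suc n) = map (true ∷_) (allSubsets n) ++ map (false ∷_) (allSubsets n)

count : ∀ {n} → (Subset n → Bool) → ℕ
count {n} P = length (filterᵇ P (allSubsets n))

_⊆ᵇ_ : ∀ {n} → Subset n → Subset n → Bool
[] ⊆ᵇ [] = true
(x ∷ s) ⊆ᵇ (y ∷ t) = (not x ∨ y) ∧ (s ⊆ᵇ t)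

link : ∀ {n} → Hypergraph n → Fin n → Subset n → Bool
link G v f = not (lookup f v) ∧ G (f ∪ ⁅ v ⁆)

deg : ∀ {n} → Hypergraph n → Fin n → ℕ
deg G v = count (link G v)

codeg : ∀ {n} → Hypergraph n → Fin n → Fin n → ℕ
codeg G v w = count (λ f → link G v f ∧ link G w f)

isClique : ∀ {n} → ℕ → Hypergraph n → Subset n → Bool
isClique {n} q G S =
  (∣ S ∣ ≡ᵇ suc q) ∧
  and (map (λ T → not ((T ⊆ᵇ S) ∧ (∣ T ∣ ≡ᵇ q)) ∨ G T) (allSubsets n))

cliqueDeg : ∀ {n} → ℕ → Hypergraph n → Fin n → ℕ
cliqueDeg q G v = count (λ S → lookup S v ∧ isClique q G S)

IsPerfectMatching : ∀ {n} → Hypergraph n → (Subset n → Bool) → Set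
IsPerfectMatching {n} G M =
  (∀ e → M e ≡ true → G e ≡ true) ×
  (∀ e e′ → M e ≡ true → M e′ ≡ true → e ≢ e′ → Empty (e ∩ e′)) ×
  (∀ (v : Fin n) → ∃ λ e → M e ≡ true × v ∈ e)

EdgeDisjoint : ∀ {n k} → (Fin k → Subset n → Bool) → Set
EdgeDisjoint {n} {k} M = ∀ (i j : Fin k) → i ≢ j → ∀ e → M i e ≡ true → M j e ≡ true → Data.Empty.⊥
  where import Data.Empty

{-# OPTIONS --safe #-}
-- Perfect matchings are removed one at a time: after k removals every degree has dropped by exactly
-- k, and codegrees and clique degrees by at most 2k and 2kn, so it is enough to find a single
-- perfect matching under slightly weaker constants.
--
-- For this, first set aside an absorber, that is, a small matching consisting of tokens f ∪ w
-- (|f| = q − 1). By the codegree condition, for every vertex v and every f* that lies in many edges,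
-- a positive proportion of all tokens f ∪ w satisfy f ∪ v ∈ G and f* ∪ w ∈ G; choosing the tokens by
-- the method of conditional expectations, linearly many of those in the absorber do so.
-- Hence v can enter the absorber in exchange for any prescribed vertex w*, if w* is covered by
-- f* ∪ w*. Doing this for q vertices v and for the vertices w* of an edge of G absorbs the v's.
--
-- On the remaining vertices a fractional perfect matching with nearly uniform weights exists:
-- start from constant weights and correct the deficit of each vertex along the copies of
-- K_{q+1} containing it. Greedily choosing disjoint edges such that the sum of the squared
-- deviations of the degrees inside the uncovered set grows as slowly as on average (a derandomised
-- nibble) then covers all but a tiny proportion of the vertices, and the absorber takes the rest.
module Submission where

open import Defs
open import Data.Bool using (Bool; true; false; not; _∧_; _∨_)
open import Data.Fin using (Fin)
open import Data.Fin.Subset using (Subset)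
open import Data.List using (List; []; _∷_)
open import Data.Product using (Σ; ∃; ∃₂; _×_; _,_; proj₁; proj₂)
open import Relation.Nullary using (yes; no; contradiction)

-- Chance is replaced by averaging over finite lists, and every estimate is an integer inequality
-- with denominators cleared. The potential is a sum of squares because it corrects itself: a vertex
-- of too large degree has more edges to lose, so up to small errors the mean first-order change of
-- its square is not positive, and the potential, raised by a fixed noise floor, grows by a factor 1
-- + O(1/m) per step. It has to start at 0, which is why the fractional matching is made exactly
-- regular on the uncovered vertices. Such an argument leaves a small constant proportion uncovered,
-- so the absorber must swallow linearly many vertices and still be small. The constants are
-- therefore fixed in this order: the density of helpers determines the ratio of the size of the
-- absorber to its capacity `ℓ`; then `Γ`, with `ℓ` about n / Γ, makes its size negligible; last,
-- `E` makes the nibble leave at most `ℓ` vertices. Linear `ℓ` also lets 2^ℓ exceed the at most n^q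
-- requirements that the helpers must meet, so that one potential handles all of them.

module FiniteSums where
  open import Algebra.Bundles using (CommutativeSemiring)
  open import Data.List using (map; _++_)
  open import Level using (0ℓ)

  module Sum (R : CommutativeSemiring 0ℓ 0ℓ) where
    open CommutativeSemiring R
    open import Relation.Binary.Reasoning.Setoid setoid

    private variable
      A B : Set

    ∑ : List A → (A → Carrier) → Carrier
    ∑ []       f = 0#
    ∑ (x ∷ xs) f = f x + ∑ xs f

    ∑-cong : ∀ (xs : List A) {f g : A → Carrier} → (∀ x → f x ≈ g x) → ∑ xs f ≈ ∑ xs g
    ∑-cong []       f≈g = refl
    ∑-cong (x ∷ xs) f≈g = +-cong (f≈g x) (∑-cong xs f≈g)

    ∑-zero : ∀ (xs : List A) → ∑ xs (λ _ → 0#) ≈ 0#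
    ∑-zero []       = refl
    ∑-zero (x ∷ xs) = trans (+-identityˡ _) (∑-zero xs)

    interchange : ∀ a b c d → (a + b) + (c + d) ≈ (a + c) + (b + d)
    interchange a b c d = begin
      (a + b) + (c + d) ≈⟨ +-assoc a b (c + d) ⟩
      a + (b + (c + d)) ≈⟨ +-congˡ (trans (sym (+-assoc b c d)) (trans (+-congʳ (+-comm b c)) (+-assoc c b d))) ⟩
      a + (c + (b + d)) ≈⟨ sym (+-assoc a c (b + d)) ⟩
      (a + c) + (b + d) ∎

    ∑-+ : ∀ (xs : List A) (f g : A → Carrier) → ∑ xs (λ x → f x + g x) ≈ ∑ xs f + ∑ xs g
    ∑-+ []       f g = sym (+-identityˡ 0#)
    ∑-+ (x ∷ xs) f g = trans (+-congˡ (∑-+ xs f g)) (interchange (f x) (g x) (∑ xs f) (∑ xs g))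

    ∑-*ˡ : ∀ (xs : List A) (c : Carrier) (f : A → Carrier) → ∑ xs (λ x → c * f x) ≈ c * ∑ xs f
    ∑-*ˡ []       c f = sym (zeroʳ c)
    ∑-*ˡ (x ∷ xs) c f = trans (+-congˡ (∑-*ˡ xs c f)) (sym (distribˡ c (f x) (∑ xs f)))

    ∑-*ʳ : ∀ (xs : List A) (c : Carrier) (f : A → Carrier) → ∑ xs (λ x → f x * c) ≈ ∑ xs f * c
    ∑-*ʳ xs c f = trans (∑-cong xs (λ x → *-comm (f x) c)) (trans (∑-*ˡ xs c f) (*-comm c _))

    ∑-swap : ∀ (xs : List A) (ys : List B) (f : A → B → Carrier) →
             ∑ xs (λ x → ∑ ys (λ y → f x y)) ≈ ∑ ys (λ y → ∑ xs (λ x → f x y))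
    ∑-swap []       ys f = sym (∑-zero ys)
    ∑-swap (x ∷ xs) ys f = trans (+-congˡ (∑-swap xs ys f)) (sym (∑-+ ys (f x) _))

    ∑-++ : ∀ (xs ys : List A) (f : A → Carrier) → ∑ (xs ++ ys) f ≈ ∑ xs f + ∑ ys f
    ∑-++ []       ys f = sym (+-identityˡ _)
    ∑-++ (x ∷ xs) ys f = trans (+-congˡ (∑-++ xs ys f)) (sym (+-assoc (f x) _ _))

    ∑-map : ∀ (h : A → B) (xs : List A) (f : B → Carrier) → ∑ (map h xs) f ≈ ∑ xs (λ x → f (h x))
    ∑-map h []       f = refl
    ∑-map h (x ∷ xs) f = +-congˡ (∑-map h xs f)

  open import Data.Nat
  open import Data.Nat.Properties
  open import Data.Integer using (ℤ; +_) renaming (_+_ to _+ᶻ_; _*_ to _*ᶻ_; _≤_ to _≤ᶻ_; -_ to -ᶻ_; _-_ to _-ᶻ_)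
  open import Data.Integer.Tactic.RingSolver using (solve-∀)
  open import Data.Sum using (_⊎_; inj₁; inj₂)
  import Data.Integer.Properties as ℤ
  open import Data.List using (length)
  open import Relation.Binary.PropositionalEquality

  open Sum +-*-commutativeSemiring public
  open Sum ℤ.+-*-commutativeSemiring public using () renaming
    (∑ to ∑ᶻ; ∑-cong to ∑ᶻ-cong; ∑-+ to ∑ᶻ-+; ∑-*ˡ to ∑ᶻ-*ˡ; ∑-swap to ∑ᶻ-swap)

  private variable
    A B : Set

  ∑-mono : ∀ (xs : List A) {f g : A → ℕ} → (∀ x → f x ≤ g x) → ∑ xs f ≤ ∑ xs g
  ∑-mono []       f≤g = ≤-refl
  ∑-mono (x ∷ xs) f≤g = +-mono-≤ (f≤g x) (∑-mono xs f≤g)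

  ∑-const : ∀ (xs : List A) c → ∑ xs (λ _ → c) ≡ length xs * c
  ∑-const []       c = refl
  ∑-const (x ∷ xs) c = cong (_+_ c) (∑-const xs c)

  ∑-≡0 : ∀ (xs : List A) {f : A → ℕ} → (∀ x → f x ≡ 0) → ∑ xs f ≡ 0
  ∑-≡0 xs f≡0 = trans (∑-cong xs f≡0) (∑-zero xs)

  ∑ᶻ-mono : ∀ (xs : List A) {f g : A → ℤ} → (∀ x → f x ≤ᶻ g x) → ∑ᶻ xs f ≤ᶻ ∑ᶻ xs g
  ∑ᶻ-mono []       f≤g = ℤ.≤-refl
  ∑ᶻ-mono (x ∷ xs) f≤g = ℤ.+-mono-≤ (f≤g x) (∑ᶻ-mono xs f≤g)

  ∑ᶻ-pos : ∀ (xs : List A) (f : A → ℕ) → ∑ᶻ xs (λ x → + f x) ≡ + ∑ xs f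
  ∑ᶻ-pos []       f = refl
  ∑ᶻ-pos (x ∷ xs) f = cong (+ f x +ᶻ_) (∑ᶻ-pos xs f)

  ∑ᶻ-neg : ∀ (xs : List A) (f : A → ℤ) → ∑ᶻ xs (λ x → -ᶻ f x) ≡ -ᶻ ∑ᶻ xs f
  ∑ᶻ-neg []       f = refl
  ∑ᶻ-neg (x ∷ xs) f = trans (cong (-ᶻ f x +ᶻ_) (∑ᶻ-neg xs f)) (sym (ℤ.neg-distrib-+ (f x) (∑ᶻ xs f)))

  ∑-pos⇒∃ : ∀ (xs : List A) (f : A → ℕ) → 0 < ∑ xs f → ∃ λ x → 0 < f x
  ∑-pos⇒∃ (x ∷ xs) f 0<s with f x in eq
  ... | suc j = x , subst (0 <_) (sym eq) z<s
  ... | zero  = ∑-pos⇒∃ xs f 0<s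

  ∑<⇒∃< : ∀ (xs : List A) (f g : A → ℕ) → ∑ xs f < ∑ xs g → ∃ λ x → f x < g x
  ∑<⇒∃< (x ∷ xs) f g lt with f x <? g x
  ... | yes p = x , p
  ... | no ¬p = ∑<⇒∃< xs f g (+-cancelˡ-< (g x) _ _ (≤-<-trans (+-monoˡ-≤ _ (≮⇒≥ ¬p)) lt))

  module _ (w : A → ℕ) (h : A → ℤ) where
    -- Integrality: if `h` is positive wherever `w` is, it is at least 1 there, so the weighted sum
    -- reaches the total weight.
    nonpos-or-large : ∀ xs → (∃ λ x → 0 < w x × h x ≤ᶻ + 0) ⊎ (+ ∑ xs w ≤ᶻ ∑ᶻ xs (λ x → + w x *ᶻ h x))
    nonpos-or-large []       = inj₂ ℤ.≤-refl
    nonpos-or-large (x ∷ xs) with nonpos-or-large xs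
    ... | inj₁ found = inj₁ found
    ... | inj₂ large with w x in eq | h x ℤ.≤? + 0
    ...   | zero  | _       = inj₂ (ℤ.≤-trans large (ℤ.≤-reflexive (sym (trans (cong (_+ᶻ rest) (ℤ.*-zeroˡ (h x))) (ℤ.+-identityˡ rest)))))
      where rest = ∑ᶻ xs (λ x → + w x *ᶻ h x)
    ...   | suc j | yes h≤0 = inj₁ (x , subst (0 <_) (sym eq) z<s , h≤0)
    ...   | suc j | no  h≰0 = inj₂ (ℤ.+-mono-≤ (ℤ.≤-trans (ℤ.≤-reflexive (sym (ℤ.*-identityʳ (+ suc j))))
                                       (ℤ.*-monoˡ-≤-nonNeg (+ suc j) (ℤ.i<j⇒suc[i]≤j (ℤ.≰⇒> h≰0)))) large)

  -- The substitute for choosing an outcome no worse than the expectation. With denominators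
  -- cleared, `h = W f - T` has weighted sum zero, which rules out the second alternative of
  -- `nonpos-or-large`.
  average : ∀ (xs : List A) (w : A → ℕ) (f : A → ℤ) → 0 < ∑ xs w →
            ∃ λ x → 0 < w x × (+ ∑ xs w *ᶻ f x ≤ᶻ ∑ᶻ xs (λ y → + w y *ᶻ f y))
  average {A = A} xs w f 0<W = conclude (nonpos-or-large w h xs)
    where
    W = + ∑ xs w
    T = ∑ᶻ xs (λ y → + w y *ᶻ f y)
    h : A → ℤ
    h x = W *ᶻ f x -ᶻ T
    rearrange : ∀ a b c d → a *ᶻ (b *ᶻ c -ᶻ d) ≡ b *ᶻ (a *ᶻ c) +ᶻ (-ᶻ d) *ᶻ a
    rearrange = solve-∀
    cancel : ∀ a b → a *ᶻ b +ᶻ (-ᶻ b) *ᶻ a ≡ + 0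
    cancel = solve-∀
    mean-zero : ∑ᶻ xs (λ x → + w x *ᶻ h x) ≡ + 0
    mean-zero = begin
      ∑ᶻ xs (λ x → + w x *ᶻ h x)                                   ≡⟨ ∑ᶻ-cong xs (λ x → rearrange (+ w x) W (f x) T) ⟩
      ∑ᶻ xs (λ x → W *ᶻ (+ w x *ᶻ f x) +ᶻ (-ᶻ T) *ᶻ + w x)          ≡⟨ ∑ᶻ-+ xs _ _ ⟩
      ∑ᶻ xs (λ x → W *ᶻ (+ w x *ᶻ f x)) +ᶻ ∑ᶻ xs (λ x → (-ᶻ T) *ᶻ + w x)
        ≡⟨ cong₂ _+ᶻ_ (∑ᶻ-*ˡ xs W _) (trans (∑ᶻ-*ˡ xs (-ᶻ T) _) (cong ((-ᶻ T) *ᶻ_) (∑ᶻ-pos xs w))) ⟩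
      W *ᶻ T +ᶻ (-ᶻ T) *ᶻ W                                         ≡⟨ cancel W T ⟩
      + 0                                                           ∎
      where open ≡-Reasoning
    conclude : (∃ λ x → 0 < w x × h x ≤ᶻ + 0) ⊎ (W ≤ᶻ ∑ᶻ xs (λ x → + w x *ᶻ h x)) →
               ∃ λ x → 0 < w x × (W *ᶻ f x ≤ᶻ T)
    conclude (inj₁ (x , 0<w , h≤0)) = x , 0<w , ℤ.i-j≤0⇒i≤j h≤0
    conclude (inj₂ W≤) = contradiction (ℤ.drop‿+≤+ (subst (W ≤ᶻ_) mean-zero W≤)) (<⇒≱ 0<W)

-- Indicator functions and sums over vertices and subsets.

module Indicators where
  open FiniteSums
  open import Data.Fin using (zero; suc)
  open import Data.Fin.Subset using (∣_∣; ⁅_⁆; _∪_; ⊥)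
  open import Data.Fin.Subset.Properties using (∪-identityʳ; ∣⊥∣≡0)
  open import Data.List using (map; length; filterᵇ)
  open import Data.Nat
  open import Data.Nat.Properties
  open import Data.Vec using ([]; _∷_; lookup)
  open import Function using (_∘_)
  open import Relation.Binary.PropositionalEquality

  private variable
    n : ℕ

  𝟙 : Bool → ℕ
  𝟙 true  = 1
  𝟙 false = 0

  𝟙≤1 : ∀ b → 𝟙 b ≤ 1
  𝟙≤1 true  = ≤-refl
  𝟙≤1 false = z≤n

  𝟙-∧ : ∀ a b → 𝟙 (a ∧ b) ≡ 𝟙 a * 𝟙 b
  𝟙-∧ true  b = sym (+-identityʳ (𝟙 b))
  𝟙-∧ false b = refl

  𝟙-true : ∀ {b} → 0 < 𝟙 b → b ≡ true
  𝟙-true {true} _ = refl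

  𝟙+𝟙-not : ∀ b → 𝟙 b + 𝟙 (not b) ≡ 1
  𝟙+𝟙-not true  = refl
  𝟙+𝟙-not false = refl

  iszero : ℕ → ℕ
  iszero zero    = 1
  iszero (suc _) = 0

  iszero≤1 : ∀ a → iszero a ≤ 1
  iszero≤1 zero    = ≤-refl
  iszero≤1 (suc _) = z≤n

  iszero-+ : ∀ a b → iszero (a + b) ≡ iszero a * iszero b
  iszero-+ zero    b = sym (+-identityʳ (iszero b))
  iszero-+ (suc a) b = refl

  iszero-pos : ∀ {a} → 0 < iszero a → a ≡ 0
  iszero-pos {zero} _ = refl

  1≤a+iszero : ∀ a → 1 ≤ a + iszero a
  1≤a+iszero zero    = ≤-refl
  1≤a+iszero (suc a) = s≤s z≤n

  ≤1-cases : ∀ {P : Set} a → a ≤ 1 → (a ≡ 0 → P) → (a ≡ 1 → P) → P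
  ≤1-cases zero          _         f g = f refl
  ≤1-cases (suc zero)    _         f g = g refl
  ≤1-cases (suc (suc _)) (s≤s ()) f g

  +iszero≡1 : ∀ {a} → a ≤ 1 → a + iszero a ≡ 1
  +iszero≡1 {zero}        _        = refl
  +iszero≡1 {suc zero}    _        = refl
  +iszero≡1 {suc (suc _)} (s≤s ())

  verts : ∀ n → List (Fin n)
  verts zero    = []
  verts (suc n) = zero ∷ map suc (verts n)

  length-verts : ∀ n → length (verts n) ≡ n
  length-verts zero    = refl
  length-verts (suc n) = cong suc (trans (length-map suc (verts n)) (length-verts n))
    where open import Data.List.Properties using (length-map)

  Σᵥ : (Fin n → ℕ) → ℕ
  Σᵥ {n} = ∑ (verts n)

  Σₛ : (Subset n → ℕ) → ℕ
  Σₛ {n} = ∑ (allSubsets n)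

  Σᵥ-suc : (f : Fin (suc n) → ℕ) → Σᵥ f ≡ f zero + Σᵥ (f ∘ suc)
  Σᵥ-suc {n} f = cong (_+_ (f zero)) (∑-map suc (verts n) f)

  Σₛ-suc : (F : Subset (suc n) → ℕ) → Σₛ F ≡ Σₛ (F ∘ (true ∷_)) + Σₛ (F ∘ (false ∷_))
  Σₛ-suc {n} F = trans (∑-++ (map (true ∷_) (allSubsets n)) _ F)
                       (cong₂ _+_ (∑-map (true ∷_) (allSubsets n) F) (∑-map (false ∷_) (allSubsets n) F))

  Σᵥ-const : ∀ c → Σᵥ {n} (λ _ → c) ≡ n * c
  Σᵥ-const {n} c = trans (∑-const (verts n) c) (cong (_* c) (length-verts n))

  count≡Σₛ : (P : Subset n → Bool) → count P ≡ Σₛ (𝟙 ∘ P)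
  count≡Σₛ {n} P = go (allSubsets n)
    where
    go : ∀ xs → length (filterᵇ P xs) ≡ ∑ xs (𝟙 ∘ P)
    go [] = refl
    go (x ∷ xs) with P x
    ... | true  = cong suc (go xs)
    ... | false = go xs

  Σᵥ-1 : Σᵥ {n} (λ _ → 1) ≡ n
  Σᵥ-1 {n} = trans (Σᵥ-const {n} 1) (*-identityʳ n)

  δ : Fin n → Fin n → ℕ
  δ zero    zero    = 1
  δ zero    (suc _) = 0
  δ (suc _) zero    = 0
  δ (suc v) (suc u) = δ v u

  ν : Fin n → Fin n → ℕ
  ν v u = iszero (δ v u)

  δ≤1 : ∀ (v u : Fin n) → δ v u ≤ 1
  δ≤1 zero    zero    = ≤-refl
  δ≤1 zero    (suc _) = z≤n
  δ≤1 (suc _) zero    = z≤n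
  δ≤1 (suc v) (suc u) = δ≤1 v u

  δ-refl : ∀ (v : Fin n) → δ v v ≡ 1
  δ-refl zero    = refl
  δ-refl (suc v) = δ-refl v

  δ-sym : ∀ (v u : Fin n) → δ v u ≡ δ u v
  δ-sym zero    zero    = refl
  δ-sym zero    (suc _) = refl
  δ-sym (suc _) zero    = refl
  δ-sym (suc v) (suc u) = δ-sym v u

  δ-≡ : ∀ (v u : Fin n) → 0 < δ v u → v ≡ u
  δ-≡ zero    zero    _ = refl
  δ-≡ (suc v) (suc u) p = cong suc (δ-≡ v u p)

  δ+ν : ∀ (v u : Fin n) → δ v u + ν v u ≡ 1
  δ+ν v u with δ v u | δ≤1 v u
  ... | zero        | _ = refl
  ... | suc zero    | _ = refl
  ... | suc (suc _) | s≤s ()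

  ν-sym : ∀ (v u : Fin n) → ν v u ≡ ν u v
  ν-sym v u = cong iszero (δ-sym v u)

  Σᵥ-δ : ∀ (v : Fin n) (f : Fin n → ℕ) → Σᵥ (λ u → δ v u * f u) ≡ f v
  Σᵥ-δ {suc n} zero f = begin
    Σᵥ (λ u → δ zero u * f u)             ≡⟨ Σᵥ-suc (λ u → δ zero u * f u) ⟩
    1 * f zero + Σᵥ {n} (λ _ → 0)         ≡⟨ cong₂ _+_ (+-identityʳ (f zero)) (∑-zero (verts n)) ⟩
    f zero + 0                            ≡⟨ +-identityʳ (f zero) ⟩
    f zero                                ∎
    where open ≡-Reasoning
  Σᵥ-δ {suc n} (suc v) f = trans (Σᵥ-suc (λ u → δ (suc v) u * f u)) (Σᵥ-δ v (f ∘ suc))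

  Σᵥ-lookup : ∀ (f : Fin n → ℕ) (v : Fin n) → f v ≤ Σᵥ f
  Σᵥ-lookup {n} f v = subst (_≤ Σᵥ f) (Σᵥ-δ v f)
    (∑-mono (verts n) (λ u → ≤-trans (*-monoˡ-≤ (f u) (δ≤1 v u)) (≤-reflexive (+-identityʳ (f u)))))

  ι : Subset n → Fin n → ℕ
  ι e v = 𝟙 (lookup e v)

  co : Subset n → Fin n → ℕ
  co e v = 𝟙 (not (lookup e v))

  ι≤1 : ∀ (e : Subset n) v → ι e v ≤ 1
  ι≤1 e v = 𝟙≤1 (lookup e v)

  ι+co : ∀ (e : Subset n) v → ι e v + co e v ≡ 1
  ι+co e v = 𝟙+𝟙-not (lookup e v)

  ι-idem : ∀ (e : Subset n) v → ι e v * ι e v ≡ ι e v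
  ι-idem e v with lookup e v
  ... | true  = refl
  ... | false = refl

  ι*co : ∀ (e : Subset n) v → ι e v * co e v ≡ 0
  ι*co e v with lookup e v
  ... | true  = refl
  ... | false = refl

  iszero-ι : ∀ (e : Subset n) v → iszero (ι e v) ≡ co e v
  iszero-ι e v with lookup e v
  ... | true  = refl
  ... | false = refl

  Σᵥ-ι : ∀ (e : Subset n) → Σᵥ (ι e) ≡ ∣ e ∣
  Σᵥ-ι []          = refl
  Σᵥ-ι (true  ∷ e) = trans (Σᵥ-suc (ι (true ∷ e))) (cong suc (Σᵥ-ι e))
  Σᵥ-ι (false ∷ e) = trans (Σᵥ-suc (ι (false ∷ e))) (Σᵥ-ι e)

  -- The factor `co e v` replaces the hypothesis that `v` is outside `e`, so the identity can be
  -- applied termwise under a sum over all sets.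
  ι-insert : ∀ (e : Subset n) v u → co e v * ι (e ∪ ⁅ v ⁆) u ≡ co e v * (ι e u + δ v u)
  ι-insert (true  ∷ e) zero    u       = refl
  ι-insert (false ∷ e) zero    zero    = refl
  ι-insert (false ∷ e) zero    (suc u) rewrite ∪-identityʳ e = cong (_+ 0) (sym (+-identityʳ (ι e u)))
  ι-insert (true  ∷ e) (suc v) zero    = refl
  ι-insert (false ∷ e) (suc v) zero    = refl
  ι-insert (x ∷ e)     (suc v) (suc u) = ι-insert e v u

  ∉⇒ι-insert : ∀ (e : Subset n) v u → ι e v ≡ 0 → ι (e ∪ ⁅ v ⁆) u ≡ ι e u + δ v u
  ∉⇒ι-insert e v u ιev≡0 = begin
    ι (e ∪ ⁅ v ⁆) u          ≡⟨ +-identityʳ _ ⟨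
    1 * ι (e ∪ ⁅ v ⁆) u      ≡⟨ cong (_* ι (e ∪ ⁅ v ⁆) u) co≡1 ⟨
    co e v * ι (e ∪ ⁅ v ⁆) u ≡⟨ ι-insert e v u ⟩
    co e v * (ι e u + δ v u) ≡⟨ cong (_* (ι e u + δ v u)) co≡1 ⟩
    1 * (ι e u + δ v u)      ≡⟨ +-identityʳ _ ⟩
    ι e u + δ v u            ∎
    where
    open ≡-Reasoning
    co≡1 : co e v ≡ 1
    co≡1 = trans (cong (_+ co e v) (sym ιev≡0)) (ι+co e v)

  ∣insert∣ : ∀ (e : Subset n) v → ι e v ≡ 0 → ∣ e ∪ ⁅ v ⁆ ∣ ≡ suc ∣ e ∣
  ∣insert∣ {n} e v ιev≡0 = begin
    ∣ e ∪ ⁅ v ⁆ ∣                   ≡⟨ Σᵥ-ι (e ∪ ⁅ v ⁆) ⟨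
    Σᵥ (ι (e ∪ ⁅ v ⁆))              ≡⟨ ∑-cong (verts n) (λ u → ∉⇒ι-insert e v u ιev≡0) ⟩
    Σᵥ (λ u → ι e u + δ v u)        ≡⟨ ∑-+ (verts n) (ι e) (δ v) ⟩
    Σᵥ (ι e) + Σᵥ (δ v)             ≡⟨ cong₂ _+_ (Σᵥ-ι e) (trans (∑-cong (verts n) (λ u → sym (*-identityʳ (δ v u)))) (Σᵥ-δ v (λ _ → 1))) ⟩
    ∣ e ∣ + 1                       ≡⟨ +-comm ∣ e ∣ 1 ⟩
    suc ∣ e ∣                       ∎
    where open ≡-Reasoning

  -- Inserting `v` is a bijection from the sets missing `v` onto the sets containing it. This turns
  -- sums over a link into sums over the edges through a vertex.
  Σₛ-insert : ∀ (v : Fin n) (F : Subset n → ℕ) →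
              Σₛ (λ f → co f v * F (f ∪ ⁅ v ⁆)) ≡ Σₛ (λ e → ι e v * F e)
  Σₛ-insert {suc n} zero F = begin
    Σₛ (λ f → co f zero * F (f ∪ ⁅ zero ⁆))              ≡⟨ Σₛ-suc (λ f → co f zero * F (f ∪ ⁅ zero ⁆)) ⟩
    Σₛ {n} (λ _ → 0) + Σₛ (λ f → 1 * F (true ∷ (f ∪ ⊥)))
      ≡⟨ cong₂ _+_ (∑-zero (allSubsets n)) (∑-cong (allSubsets n) (λ f → cong (λ g → 1 * F (true ∷ g)) (∪-identityʳ f))) ⟩
    Σₛ (λ f → 1 * F (true ∷ f))                          ≡⟨ +-identityʳ _ ⟨
    Σₛ (λ f → 1 * F (true ∷ f)) + 0                      ≡⟨ cong (_+_ _) (∑-zero (allSubsets n)) ⟨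
    Σₛ (λ f → 1 * F (true ∷ f)) + Σₛ {n} (λ _ → 0)       ≡⟨ Σₛ-suc (λ e → ι e zero * F e) ⟨
    Σₛ (λ e → ι e zero * F e)                            ∎
    where open ≡-Reasoning
  Σₛ-insert {suc n} (suc v) F = begin
    Σₛ (λ f → co f (suc v) * F (f ∪ ⁅ suc v ⁆))          ≡⟨ Σₛ-suc (λ f → co f (suc v) * F (f ∪ ⁅ suc v ⁆)) ⟩
    Σₛ (λ f → co f v * F (true ∷ (f ∪ ⁅ v ⁆))) + Σₛ (λ f → co f v * F (false ∷ (f ∪ ⁅ v ⁆)))
      ≡⟨ cong₂ _+_ (Σₛ-insert v (F ∘ (true ∷_))) (Σₛ-insert v (F ∘ (false ∷_))) ⟩
    Σₛ (λ e → ι e v * F (true ∷ e)) + Σₛ (λ e → ι e v * F (false ∷ e)) ≡⟨ Σₛ-suc (λ e → ι e (suc v) * F e) ⟨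
    Σₛ (λ e → ι e (suc v) * F e)                         ∎
    where open ≡-Reasoning

  ⊆ᵇ⇒∣∣≤ : ∀ (s e : Subset n) → s ⊆ᵇ e ≡ true → ∣ s ∣ ≤ ∣ e ∣
  ⊆ᵇ⇒∣∣≤ []          []          _ = z≤n
  ⊆ᵇ⇒∣∣≤ (true  ∷ s) (true  ∷ e) p = s≤s (⊆ᵇ⇒∣∣≤ s e p)
  ⊆ᵇ⇒∣∣≤ (false ∷ s) (true  ∷ e) p = m≤n⇒m≤1+n (⊆ᵇ⇒∣∣≤ s e p)
  ⊆ᵇ⇒∣∣≤ (false ∷ s) (false ∷ e) p = ⊆ᵇ⇒∣∣≤ s e p

  ⊆ᵇ-insert : ∀ (s e : Subset n) v → 𝟙 ((s ∪ ⁅ v ⁆) ⊆ᵇ e) ≡ 𝟙 (s ⊆ᵇ e) * ι e v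
  ⊆ᵇ-insert (true  ∷ s) (true  ∷ e) zero rewrite ∪-identityʳ s = sym (*-identityʳ _)
  ⊆ᵇ-insert (true  ∷ s) (false ∷ e) zero = refl
  ⊆ᵇ-insert (false ∷ s) (true  ∷ e) zero rewrite ∪-identityʳ s = sym (*-identityʳ _)
  ⊆ᵇ-insert (false ∷ s) (false ∷ e) zero = sym (*-zeroʳ (𝟙 (s ⊆ᵇ e)))
  ⊆ᵇ-insert (true  ∷ s) (true  ∷ e) (suc v) = ⊆ᵇ-insert s e v
  ⊆ᵇ-insert (true  ∷ s) (false ∷ e) (suc v) = refl
  ⊆ᵇ-insert (false ∷ s) (true  ∷ e) (suc v) = ⊆ᵇ-insert s e v
  ⊆ᵇ-insert (false ∷ s) (false ∷ e) (suc v) = ⊆ᵇ-insert s e v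

  ⊥⊆ᵇ : ∀ (e : Subset n) → ⊥ ⊆ᵇ e ≡ true
  ⊥⊆ᵇ []      = refl
  ⊥⊆ᵇ (x ∷ e) = ⊥⊆ᵇ e

  n^-mono : ∀ j → n ^ j ≤ suc n ^ j
  n^-mono {n} j = ^-monoˡ-≤ j (n≤1+n n)

  -- Induction on coordinates. At a coordinate outside `s` a superset either uses it, which lowers
  -- `j` by one, or does not; the two bounds `suc n ^ j` and `n * suc n ^ j` add up to
  -- `suc n ^ suc j`. This cruder power replaces a binomial coefficient.
  supersets≤ : ∀ (s : Subset n) j → Σₛ (λ e → 𝟙 (s ⊆ᵇ e) * 𝟙 (∣ e ∣ ≡ᵇ ∣ s ∣ + j)) ≤ n ^ j
  supersets≤ [] zero    = ≤-refl
  supersets≤ [] (suc j) = z≤n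
  supersets≤ {suc n} (true ∷ s) j = begin
    Σₛ (λ e → 𝟙 ((true ∷ s) ⊆ᵇ e) * 𝟙 (∣ e ∣ ≡ᵇ suc (∣ s ∣ + j)))                 ≡⟨ Σₛ-suc (λ e → 𝟙 ((true ∷ s) ⊆ᵇ e) * 𝟙 (∣ e ∣ ≡ᵇ suc (∣ s ∣ + j))) ⟩
    Σₛ (λ e → 𝟙 (s ⊆ᵇ e) * 𝟙 (∣ e ∣ ≡ᵇ ∣ s ∣ + j)) + Σₛ {n} (λ _ → 0)             ≡⟨ cong (_+_ _) (∑-zero (allSubsets n)) ⟩
    Σₛ (λ e → 𝟙 (s ⊆ᵇ e) * 𝟙 (∣ e ∣ ≡ᵇ ∣ s ∣ + j)) + 0                            ≡⟨ +-identityʳ _ ⟩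
    Σₛ (λ e → 𝟙 (s ⊆ᵇ e) * 𝟙 (∣ e ∣ ≡ᵇ ∣ s ∣ + j))                                ≤⟨ supersets≤ s j ⟩
    n ^ j                                                                          ≤⟨ n^-mono j ⟩
    suc n ^ j                                                                      ∎
    where open ≤-Reasoning
  supersets≤ {suc n} (false ∷ s) zero = begin
    Σₛ (λ e → 𝟙 ((false ∷ s) ⊆ᵇ e) * 𝟙 (∣ e ∣ ≡ᵇ ∣ s ∣ + 0))                      ≡⟨ Σₛ-suc (λ e → 𝟙 ((false ∷ s) ⊆ᵇ e) * 𝟙 (∣ e ∣ ≡ᵇ ∣ s ∣ + 0)) ⟩
    Σₛ (λ e → 𝟙 (s ⊆ᵇ e) * 𝟙 (suc ∣ e ∣ ≡ᵇ ∣ s ∣ + 0)) + Σₛ (λ e → 𝟙 (s ⊆ᵇ e) * 𝟙 (∣ e ∣ ≡ᵇ ∣ s ∣ + 0))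
      ≤⟨ +-mono-≤ (≤-reflexive (∑-≡0 (allSubsets n) too-big)) (supersets≤ s zero) ⟩
    1                                                                              ∎
    where
    open ≤-Reasoning
    too-big : ∀ e → 𝟙 (s ⊆ᵇ e) * 𝟙 (suc ∣ e ∣ ≡ᵇ ∣ s ∣ + 0) ≡ 0
    too-big e with s ⊆ᵇ e in sub | suc ∣ e ∣ ≡ᵇ ∣ s ∣ + 0 in size
    ... | false | _     = refl
    ... | true  | false = refl
    ... | true  | true  = contradiction
      (subst (_≤ ∣ e ∣) (trans (sym (+-identityʳ ∣ s ∣)) (sym (≡ᵇ⇒≡ (suc ∣ e ∣) _ (subst Data.Bool.T (sym size) _)))) (⊆ᵇ⇒∣∣≤ s e sub))
      (n≮n ∣ e ∣)
  supersets≤ {suc n} (false ∷ s) (suc j) = begin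
    Σₛ (λ e → 𝟙 ((false ∷ s) ⊆ᵇ e) * 𝟙 (∣ e ∣ ≡ᵇ ∣ s ∣ + suc j))                  ≡⟨ Σₛ-suc (λ e → 𝟙 ((false ∷ s) ⊆ᵇ e) * 𝟙 (∣ e ∣ ≡ᵇ ∣ s ∣ + suc j)) ⟩
    Σₛ (λ e → 𝟙 (s ⊆ᵇ e) * 𝟙 (suc ∣ e ∣ ≡ᵇ ∣ s ∣ + suc j)) + Σₛ (λ e → 𝟙 (s ⊆ᵇ e) * 𝟙 (∣ e ∣ ≡ᵇ ∣ s ∣ + suc j))
      ≡⟨ cong (_+ Σₛ (λ e → 𝟙 (s ⊆ᵇ e) * 𝟙 (∣ e ∣ ≡ᵇ ∣ s ∣ + suc j))) (∑-cong (allSubsets n) (λ e → cong (λ k → 𝟙 (s ⊆ᵇ e) * 𝟙 (suc ∣ e ∣ ≡ᵇ k)) (+-suc ∣ s ∣ j))) ⟩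
    Σₛ (λ e → 𝟙 (s ⊆ᵇ e) * 𝟙 (∣ e ∣ ≡ᵇ ∣ s ∣ + j)) + Σₛ (λ e → 𝟙 (s ⊆ᵇ e) * 𝟙 (∣ e ∣ ≡ᵇ ∣ s ∣ + suc j))
      ≤⟨ +-mono-≤ (≤-trans (supersets≤ s j) (n^-mono j)) (≤-trans (supersets≤ s (suc j)) (*-monoʳ-≤ n (n^-mono j))) ⟩
    suc n ^ suc j                                                                  ∎
    where open ≤-Reasoning

  private
    restrict : ∀ (s : Subset n) {k} (F : Subset n → ℕ) j → k ≡ ∣ s ∣ + j → (∀ e → F e ≤ 𝟙 (s ⊆ᵇ e)) →
               Σₛ (λ e → 𝟙 (∣ e ∣ ≡ᵇ k) * F e) ≤ n ^ j
    restrict {n} s F j refl F≤ = ≤-trans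
      (∑-mono (allSubsets n) (λ e → ≤-trans (≤-reflexive (*-comm (𝟙 (∣ e ∣ ≡ᵇ ∣ s ∣ + j)) (F e))) (*-monoˡ-≤ (𝟙 (∣ e ∣ ≡ᵇ ∣ s ∣ + j)) (F≤ e))))
      (supersets≤ s j)

    ν⇒δ≡0 : ∀ (v u : Fin n) → 0 < ν v u → δ v u ≡ 0
    ν⇒δ≡0 v u p = iszero-pos p

    ι-⊥ : ∀ (v : Fin n) → ι ⊥ v ≡ 0
    ι-⊥ zero    = refl
    ι-⊥ (suc v) = ι-⊥ v

    -- Spelled as an insertion into the empty set, so that sizes and containments of small sets all
    -- come from the insertion lemmas.
    sing : Fin n → Subset n
    sing v = ⊥ ∪ ⁅ v ⁆

    ι-sing : ∀ (v u : Fin n) → ι (sing v) u ≡ δ v u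
    ι-sing v u = trans (∉⇒ι-insert ⊥ v u (ι-⊥ v)) (cong (_+ δ v u) (ι-⊥ u))

    ∣sing∣ : ∀ (v : Fin n) → ∣ sing v ∣ ≡ 1
    ∣sing∣ {n} v = trans (∣insert∣ ⊥ v (ι-⊥ v)) (cong suc (∣⊥∣≡0 n))

    sing-⊆ᵇ : ∀ (e : Subset n) v → 𝟙 (sing v ⊆ᵇ e) ≡ ι e v
    sing-⊆ᵇ e v = trans (⊆ᵇ-insert ⊥ e v) (trans (cong (λ b → 𝟙 b * ι e v) (⊥⊆ᵇ e)) (+-identityʳ _))

  sets≤ : ∀ j → Σₛ {n} (λ e → 𝟙 (∣ e ∣ ≡ᵇ j)) ≤ n ^ j
  sets≤ {n} j = ≤-trans (≤-reflexive (∑-cong (allSubsets n) (λ e → sym (*-identityʳ _))))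
    (restrict ⊥ (λ _ → 1) j (cong (_+ j) (sym (∣⊥∣≡0 n))) (λ e → ≤-reflexive (sym (cong 𝟙 (⊥⊆ᵇ e)))))

  sets∋≤ : ∀ j (v : Fin n) → Σₛ {n} (λ e → 𝟙 (∣ e ∣ ≡ᵇ 1 + j) * ι e v) ≤ n ^ j
  sets∋≤ j v = restrict (sing v) (λ e → ι e v) j (cong (_+ j) (sym (∣sing∣ v))) (λ e → ≤-reflexive (sym (sing-⊆ᵇ e v)))

  sets∋∋≤ : ∀ j (v u : Fin n) → 0 < ν v u → Σₛ {n} (λ e → 𝟙 (∣ e ∣ ≡ᵇ 2 + j) * (ι e v * ι e u)) ≤ n ^ j
  sets∋∋≤ j v u v≢u = restrict (sing v ∪ ⁅ u ⁆) (λ e → ι e v * ι e u) j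
    (cong (_+ j) (sym (trans (∣insert∣ (sing v) u (trans (ι-sing v u) (ν⇒δ≡0 v u v≢u))) (cong suc (∣sing∣ v)))))
    (λ e → ≤-reflexive (sym (trans (⊆ᵇ-insert (sing v) e u) (cong (_* ι e u) (sing-⊆ᵇ e v)))))

  private
    module Triple {n} (v u x : Fin n) (v≢u : 0 < ν v u) (v≢x : 0 < ν v x) (u≢x : 0 < ν u x) where
      pair triple : Subset n
      pair = sing v ∪ ⁅ u ⁆
      triple = pair ∪ ⁅ x ⁆
      u∉sing : ι (sing v) u ≡ 0
      u∉sing = trans (ι-sing v u) (ν⇒δ≡0 v u v≢u)
      x∉pair : ι pair x ≡ 0
      x∉pair = trans (∉⇒ι-insert (sing v) u x u∉sing) (cong₂ _+_ (trans (ι-sing v x) (ν⇒δ≡0 v x v≢x)) (ν⇒δ≡0 u x u≢x))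
      ∣triple∣ : ∣ triple ∣ ≡ 3
      ∣triple∣ = trans (∣insert∣ pair x x∉pair) (cong suc (trans (∣insert∣ (sing v) u u∉sing) (cong suc (∣sing∣ v))))
      triple-⊆ᵇ : ∀ e → 𝟙 (triple ⊆ᵇ e) ≡ ι e v * ι e u * ι e x
      triple-⊆ᵇ e = trans (⊆ᵇ-insert pair e x) (cong (_* ι e x)
        (trans (⊆ᵇ-insert (sing v) e u) (cong (_* ι e u) (sing-⊆ᵇ e v))))

  sets∋∋∋≤ : ∀ j (v u x : Fin n) → 0 < ν v u → 0 < ν v x → 0 < ν u x →
             Σₛ {n} (λ e → 𝟙 (∣ e ∣ ≡ᵇ 3 + j) * (ι e v * ι e u * ι e x)) ≤ n ^ j
  sets∋∋∋≤ j v u x v≢u v≢x u≢x = restrict triple (λ e → ι e v * ι e u * ι e x) j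
    (cong (_+ j) (sym ∣triple∣)) (λ e → ≤-reflexive (sym (triple-⊆ᵇ e)))
    where open Triple v u x v≢u v≢x u≢x

  -- Covers q = 2, where the exponent q - 3 of the general bound would be negative: three distinct
  -- vertices do not fit into a pair.
  pairs∌triple : ∀ (v u x : Fin n) → 0 < ν v u → 0 < ν v x → 0 < ν u x → ∀ e →
                 𝟙 (∣ e ∣ ≡ᵇ 2) * (ι e v * ι e u * ι e x) ≡ 0
  pairs∌triple v u x v≢u v≢x u≢x e = trans (cong (𝟙 (∣ e ∣ ≡ᵇ 2) *_) (sym (triple-⊆ᵇ e))) too-small
    where
    open Triple v u x v≢u v≢x u≢x
    too-small : 𝟙 (∣ e ∣ ≡ᵇ 2) * 𝟙 (triple ⊆ᵇ e) ≡ 0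
    too-small with ∣ e ∣ ≡ᵇ 2 in size | triple ⊆ᵇ e in sub
    ... | false | _     = refl
    ... | true  | false = refl
    ... | true  | true  = contradiction (subst₂ _≤_ ∣triple∣ (≡ᵇ⇒≡ ∣ e ∣ 2 (subst Data.Bool.T (sym size) _)) (⊆ᵇ⇒∣∣≤ triple e sub)) λ { (s≤s (s≤s ())) }

  -- The Kronecker delta of subsets, as `δ` is that of vertices; values in ℕ let it serve as a
  -- factor in sums.
  same : ∀ {n} → Subset n → Subset n → ℕ
  same []          []          = 1
  same (true  ∷ s) (true  ∷ e) = same s e
  same (false ∷ s) (false ∷ e) = same s e
  same (true  ∷ s) (false ∷ e) = 0
  same (false ∷ s) (true  ∷ e) = 0

  same≤1 : ∀ {n} (s e : Subset n) → same s e ≤ 1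
  same≤1 []          []          = ≤-refl
  same≤1 (true  ∷ s) (true  ∷ e) = same≤1 s e
  same≤1 (false ∷ s) (false ∷ e) = same≤1 s e
  same≤1 (true  ∷ s) (false ∷ e) = z≤n
  same≤1 (false ∷ s) (true  ∷ e) = z≤n

  same⇒≡ : ∀ {n} (s e : Subset n) → 0 < same s e → s ≡ e
  same⇒≡ []          []          _ = refl
  same⇒≡ (true  ∷ s) (true  ∷ e) p = cong (true ∷_) (same⇒≡ s e p)
  same⇒≡ (false ∷ s) (false ∷ e) p = cong (false ∷_) (same⇒≡ s e p)

  Σₛ-same : ∀ {n} (s : Subset n) (F : Subset n → ℕ) → Σₛ (λ e → same s e * F e) ≡ F s
  Σₛ-same []          F = trans (+-identityʳ _) (+-identityʳ (F []))
  Σₛ-same {suc n} (true  ∷ s) F = trans (Σₛ-suc (λ e → same (true ∷ s) e * F e))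
    (trans (cong₂ _+_ (Σₛ-same s (F ∘ (true ∷_))) (∑-zero (allSubsets n))) (+-identityʳ _))
  Σₛ-same {suc n} (false ∷ s) F = trans (Σₛ-suc (λ e → same (false ∷ s) e * F e))
    (cong₂ _+_ (∑-zero (allSubsets n)) (Σₛ-same s (F ∘ (false ∷_))))

  Σₛ-lookup : ∀ {n} (F : Subset n → ℕ) s → F s ≤ Σₛ F
  Σₛ-lookup {n} F s = subst (_≤ Σₛ F) (Σₛ-same s F)
    (∑-mono (allSubsets n) (λ e → ≤-trans (*-monoˡ-≤ (F e) (same≤1 s e)) (≤-reflexive (*-identityˡ (F e)))))

  Σₛ-lookup₂ : ∀ {n} (F : Subset n → ℕ) s s′ → s ≢ s′ → F s + F s′ ≤ Σₛ F
  Σₛ-lookup₂ {n} F s s′ s≢s′ = begin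
    F s + F s′                                            ≡⟨ cong₂ _+_ (Σₛ-same s F) (Σₛ-same s′ F) ⟨
    Σₛ (λ e → same s e * F e) + Σₛ (λ e → same s′ e * F e) ≡⟨ ∑-+ (allSubsets n) _ _ ⟨
    Σₛ (λ e → same s e * F e + same s′ e * F e)           ≤⟨ ∑-mono (allSubsets n) pointwise ⟩
    Σₛ F                                                  ∎
    where
    open ≤-Reasoning
    pointwise : ∀ e → same s e * F e + same s′ e * F e ≤ F e
    pointwise e with same s e in eq | same s′ e in eq′ | same≤1 s e | same≤1 s′ e
    ... | zero        | x           | _ | x≤1 = ≤-trans (*-monoˡ-≤ (F e) x≤1) (≤-reflexive (*-identityˡ (F e)))
    ... | suc zero    | zero        | _ | _ = ≤-reflexive (trans (+-identityʳ _) (*-identityˡ (F e)))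
    ... | suc zero    | suc _       | _ | _ = contradiction (trans (same⇒≡ s e (subst (0 <_) (sym eq) z<s)) (sym (same⇒≡ s′ e (subst (0 <_) (sym eq′) z<s)))) s≢s′
    ... | suc (suc _) | _           | s≤s () | _

-- Inequalities for one step of the nibble and for its whole run.

module NibbleArithmetic where
  open import Data.Integer using (ℤ; +_; ∣_∣; -[1+_]) renaming (_+_ to _+ᶻ_; _*_ to _*ᶻ_; _≤_ to _≤ᶻ_; -_ to -ᶻ_; _-_ to _-ᶻ_)
  import Data.Integer as ℤB
  import Data.Integer.Properties as ℤ
  open import Data.Integer.Tactic.RingSolver using () renaming (solve-∀ to ringᶻ)
  open import Data.Nat
  open import Data.Nat.Properties
  open import Data.Nat.Tactic.RingSolver using () renaming (solve-∀ to ring)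
  open import Relation.Binary.PropositionalEquality

  ≤-by : ∀ {x y} N → y ≡ x +ᶻ N → + 0 ≤ᶻ N → x ≤ᶻ y
  ≤-by {x} N refl 0≤N = subst (_≤ᶻ x +ᶻ N) (ℤ.+-identityʳ x) (ℤ.+-monoʳ-≤ x 0≤N)

  sq : ℤ → ℕ
  sq y = ∣ y ∣ * ∣ y ∣

  +sq : ∀ y → + sq y ≡ y *ᶻ y
  +sq (+ y)      = ℤ.pos-* y y
  +sq -[1+ y ]   = refl

  0≤y*y : ∀ y → + 0 ≤ᶻ y *ᶻ y
  0≤y*y y = subst (+ 0 ≤ᶻ_) (+sq y) (ℤB.+≤+ z≤n)

  i≤∣i∣ : ∀ i → i ≤ᶻ + ∣ i ∣
  i≤∣i∣ (+ y)    = ℤ.≤-refl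
  i≤∣i∣ -[1+ y ] = ℤB.-≤+

  2ab≤a²+b² : ∀ a b → 2 * (a * b) ≤ a * a + b * b
  2ab≤a²+b² a b = ℤ.drop‿+≤+ (subst₂ _≤ᶻ_ (sym lhs) (sym rhs)
    (≤-by ((+ a -ᶻ + b) *ᶻ (+ a -ᶻ + b)) (lem (+ a) (+ b)) (0≤y*y (+ a -ᶻ + b))))
    where
    lhs : + (2 * (a * b)) ≡ + 2 *ᶻ (+ a *ᶻ + b)
    lhs = trans (ℤ.pos-* 2 (a * b)) (cong (+ 2 *ᶻ_) (ℤ.pos-* a b))
    rhs : + (a * a + b * b) ≡ + a *ᶻ + a +ᶻ + b *ᶻ + b
    rhs = cong₂ _+ᶻ_ (ℤ.pos-* a a) (ℤ.pos-* b b)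
    lem : ∀ x y → x *ᶻ x +ᶻ y *ᶻ y ≡ + 2 *ᶻ (x *ᶻ y) +ᶻ (x -ᶻ y) *ᶻ (x -ᶻ y)
    lem = ringᶻ

  -- The effect on m·y² of replacing y by y − z + ε, where ε is of lower order than z.
  square-update : ∀ m s q ε y z → 1 ≤ m → m * ε ≤ q * q * s → ∣ z ∣ ≤ q * s → 1 ≤ q →
    + m *ᶻ ((y -ᶻ z +ᶻ + ε) *ᶻ (y -ᶻ z +ᶻ + ε)) ≤ᶻ
    (+ (m + 2 * (q * q)) *ᶻ (y *ᶻ y) +ᶻ + m *ᶻ (-ᶻ (+ 2 *ᶻ (y *ᶻ z)))) +ᶻ + (m * (5 * (q * q * (q * q)) * (s * s)))
  square-update m s q ε y z 1≤m mε≤ ∣z∣≤ 1≤q = begin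
    + m *ᶻ ((a +ᶻ + ε) *ᶻ (a +ᶻ + ε))                            ≡⟨ expand (+ m) a (+ ε) ⟩
    + m *ᶻ (a *ᶻ a) +ᶻ (+ 2 *ᶻ (a *ᶻ (+ m *ᶻ + ε)) +ᶻ (+ m *ᶻ + ε) *ᶻ + ε)
      ≡⟨ cong (λ η → + m *ᶻ (a *ᶻ a) +ᶻ (+ 2 *ᶻ (a *ᶻ η) +ᶻ η *ᶻ + ε)) (sym (ℤ.pos-* m ε)) ⟩
    + m *ᶻ (a *ᶻ a) +ᶻ (+ 2 *ᶻ (a *ᶻ + (m * ε)) +ᶻ + (m * ε) *ᶻ + ε)
      ≤⟨ ℤ.+-monoʳ-≤ (+ m *ᶻ (a *ᶻ a)) (ℤ.+-mono-≤ linear (ℤ.≤-trans (ℤ.≤-reflexive (sym (ℤ.pos-* (m * ε) ε))) (ℤB.+≤+ quadratic))) ⟩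
    + m *ᶻ (a *ᶻ a) +ᶻ (+ (q * q * (sq y + sq y + (q * q * (s * s) + q * q * (s * s)) + s * s)) +ᶻ + (q * q * (q * q) * (s * s)))
      ≤⟨ ℤ.+-monoˡ-≤ (+ (q * q * (sq y + sq y + (q * q * (s * s) + q * q * (s * s)) + s * s)) +ᶻ + (q * q * (q * q) * (s * s))) (≤-by {+ m *ᶻ (a *ᶻ a)} (+ m *ᶻ (+ (q * q * (s * s)) -ᶻ z *ᶻ z)) (expand₂ (+ m) y z (+ (q * q * (s * s))))
           (ℤ.≤-trans (ℤ.≤-reflexive (sym (ℤ.*-zeroʳ (+ m)))) (ℤ.*-monoˡ-≤-nonNeg (+ m) (ℤ.i≤j⇒0≤j-i zz≤)))) ⟩
    (+ m *ᶻ (y *ᶻ y) +ᶻ + m *ᶻ (-ᶻ (+ 2 *ᶻ (y *ᶻ z))) +ᶻ + m *ᶻ + (q * q * (s * s))) +ᶻ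
    (+ (q * q * (sq y + sq y + (q * q * (s * s) + q * q * (s * s)) + s * s)) +ᶻ + (q * q * (q * q) * (s * s)))
      ≤⟨ ≤-by (+ slack) final (ℤB.+≤+ z≤n) ⟩
    (+ (m + 2 * (q * q)) *ᶻ (y *ᶻ y) +ᶻ + m *ᶻ (-ᶻ (+ 2 *ᶻ (y *ᶻ z)))) +ᶻ + (m * (5 * (q * q * (q * q)) * (s * s))) ∎
    where
    open ℤ.≤-Reasoning
    a = y -ᶻ z
    expand : ∀ m a ε → m *ᶻ ((a +ᶻ ε) *ᶻ (a +ᶻ ε)) ≡ m *ᶻ (a *ᶻ a) +ᶻ (+ 2 *ᶻ (a *ᶻ (m *ᶻ ε)) +ᶻ (m *ᶻ ε) *ᶻ ε)
    expand = ringᶻ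
    expand₂ : ∀ m y z w → m *ᶻ (y *ᶻ y) +ᶻ m *ᶻ (-ᶻ (+ 2 *ᶻ (y *ᶻ z))) +ᶻ m *ᶻ w ≡ m *ᶻ ((y -ᶻ z) *ᶻ (y -ᶻ z)) +ᶻ m *ᶻ (w -ᶻ z *ᶻ z)
    expand₂ = ringᶻ
    swap4 : ∀ q s → q * s * (q * s) ≡ q * q * (s * s)
    swap4 = ring
    sqz≤ : sq z ≤ q * q * (s * s)
    sqz≤ = ≤-trans (*-mono-≤ ∣z∣≤ ∣z∣≤) (≤-reflexive (swap4 q s))
    zz≤ : z *ᶻ z ≤ᶻ + (q * q * (s * s))
    zz≤ = subst (_≤ᶻ + (q * q * (s * s))) (+sq z) (ℤB.+≤+ sqz≤)
    sqa≤ : sq a ≤ sq y + sq y + (q * q * (s * s) + q * q * (s * s))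
    sqa≤ = ≤-trans (ℤ.drop‿+≤+ (subst₂ _≤ᶻ_ (sym (+sq a)) (sym (cong₂ _+ᶻ_ (cong₂ _+ᶻ_ (+sq y) (+sq y)) (cong₂ _+ᶻ_ (+sq z) (+sq z))))
        (≤-by ((y +ᶻ z) *ᶻ (y +ᶻ z)) (par y z) (0≤y*y (y +ᶻ z)))))
      (+-monoʳ-≤ (sq y + sq y) (+-mono-≤ sqz≤ sqz≤))
      where
      par : ∀ y z → y *ᶻ y +ᶻ y *ᶻ y +ᶻ (z *ᶻ z +ᶻ z *ᶻ z) ≡ (y -ᶻ z) *ᶻ (y -ᶻ z) +ᶻ (y +ᶻ z) *ᶻ (y +ᶻ z)
      par = ringᶻ
    reorder : ∀ a q s → 2 * (a * (q * q * s)) ≡ q * q * (2 * (a * s))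
    reorder = ring
    -- The extra `2 * (q * q)` in front of the square of `y` arises here: `m * ε` is at most
    -- `q * q * s`, and twice the product of `s` with the absolute value of `a` is split into
    -- squares.
    linear : + 2 *ᶻ (a *ᶻ + (m * ε)) ≤ᶻ + (q * q * (sq y + sq y + (q * q * (s * s) + q * q * (s * s)) + s * s))
    linear = ℤ.≤-trans (ℤ.*-monoˡ-≤-nonNeg (+ 2) (ℤ.*-monoʳ-≤-nonNeg (+ (m * ε)) (i≤∣i∣ a)))
      (ℤ.≤-trans (ℤ.≤-reflexive (trans (cong (+ 2 *ᶻ_) (sym (ℤ.pos-* ∣ a ∣ (m * ε)))) (sym (ℤ.pos-* 2 (∣ a ∣ * (m * ε))))))
      (ℤB.+≤+ (≤-trans (*-monoʳ-≤ 2 (*-monoʳ-≤ ∣ a ∣ mε≤)) (≤-trans (≤-reflexive (reorder ∣ a ∣ q s))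
        (*-monoʳ-≤ (q * q) (≤-trans (2ab≤a²+b² ∣ a ∣ s) (+-monoˡ-≤ (s * s) sqa≤)))))))
    quadratic : m * ε * ε ≤ q * q * (q * q) * (s * s)
    quadratic = ≤-trans (*-mono-≤ mε≤ (≤-trans (≤-trans (≤-reflexive (sym (*-identityˡ ε))) (*-monoˡ-≤ ε 1≤m)) mε≤)) (≤-reflexive (lem q s))
      where
      lem : ∀ q s → q * q * s * (q * q * s) ≡ q * q * (q * q) * (s * s)
      lem = ring
    Q = q * q
    1≤Q : 1 ≤ Q
    1≤Q = *-mono-≤ 1≤q 1≤q
    small : m * (Q * (s * s)) + (Q * (Q * (s * s) + Q * (s * s) + s * s) + Q * Q * (s * s)) ≤ m * (5 * (Q * Q) * (s * s))
    small = ≤-trans (+-monoʳ-≤ (m * (Q * (s * s))) (≤-trans (≤-reflexive (sym (*-identityˡ _))) (*-monoˡ-≤ _ 1≤m)))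
      (≤-trans (≤-reflexive (sym (*-distribˡ-+ m (Q * (s * s)) _))) (*-monoʳ-≤ m
      (≤-trans (≤-reflexive (lem Q s)) (≤-trans (*-monoˡ-≤ (s * s) (+-monoˡ-≤ (3 * (Q * Q)) (*-monoʳ-≤ 2 (≤-trans (≤-reflexive (sym (*-identityʳ Q))) (*-monoʳ-≤ Q 1≤Q)))))
        (≤-reflexive (lem₂ (Q * Q) (s * s)))))))
      where
      lem : ∀ Q s → Q * (s * s) + (Q * (Q * (s * s) + Q * (s * s) + s * s) + Q * Q * (s * s)) ≡ (2 * Q + 3 * (Q * Q)) * (s * s)
      lem = ring
      lem₂ : ∀ x y → (2 * x + 3 * x) * y ≡ 5 * x * y
      lem₂ = ring
    slack : ℕ
    slack = m * (5 * (Q * Q) * (s * s)) ∸ (m * (Q * (s * s)) + (Q * (Q * (s * s) + Q * (s * s) + s * s) + Q * Q * (s * s)))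
    final : (+ (m + 2 * (q * q)) *ᶻ (y *ᶻ y) +ᶻ + m *ᶻ (-ᶻ (+ 2 *ᶻ (y *ᶻ z)))) +ᶻ + (m * (5 * (q * q * (q * q)) * (s * s))) ≡
      (+ m *ᶻ (y *ᶻ y) +ᶻ + m *ᶻ (-ᶻ (+ 2 *ᶻ (y *ᶻ z))) +ᶻ + m *ᶻ + (q * q * (s * s))) +ᶻ
      (+ (q * q * (sq y + sq y + (q * q * (s * s) + q * q * (s * s)) + s * s)) +ᶻ + (q * q * (q * q) * (s * s))) +ᶻ + slack
    final = trans
      (cong (λ x → (+ (m + 2 * Q) *ᶻ (y *ᶻ y) +ᶻ + m *ᶻ (-ᶻ (+ 2 *ᶻ (y *ᶻ z)))) +ᶻ + x) (sym (m+[n∸m]≡n small)))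
      (trans (poly (+ m) (y *ᶻ y) (+ m *ᶻ (-ᶻ (+ 2 *ᶻ (y *ᶻ z)))) (+ (m * (Q * (s * s)))) (+ rest) (+ (Q * Q * (s * s))) (+ slack) (+ (2 * Q)))
      (cong₂ (λ u v → (+ m *ᶻ (y *ᶻ y) +ᶻ + m *ᶻ (-ᶻ (+ 2 *ᶻ (y *ᶻ z))) +ᶻ u) +ᶻ (v +ᶻ + (Q * Q * (s * s))) +ᶻ + slack)
         (ℤ.pos-* m (Q * (s * s)))
         (trans (cong (_+ᶻ + rest) (trans (cong (+ (2 * Q) *ᶻ_) (sym (+sq y))) (sym (ℤ.pos-* (2 * Q) (sq y))))) (cong +_ (sym (split Q (sq y) s))))))
      where
      rest = Q * (Q * (s * s) + Q * (s * s) + s * s)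
      split : ∀ Q y s → Q * (y + y + (Q * (s * s) + Q * (s * s)) + s * s) ≡ 2 * Q * y + Q * (Q * (s * s) + Q * (s * s) + s * s)
      split = ring
      poly : ∀ m y2 g a b c d Q2 → (m +ᶻ Q2) *ᶻ y2 +ᶻ g +ᶻ (a +ᶻ (b +ᶻ c) +ᶻ d) ≡ (m *ᶻ y2 +ᶻ g +ᶻ a) +ᶻ ((Q2 *ᶻ y2 +ᶻ b) +ᶻ c) +ᶻ d
      poly = ringᶻ

  *-cancel-sq-≤ : ∀ x y → x * x ≤ y * y → x ≤ y
  *-cancel-sq-≤ x y xx≤yy with x ≤? y
  ... | yes x≤y = x≤y
  ... | no  x≰y = contradiction xx≤yy (<⇒≱ (*-mono-< (≰⇒> x≰y) (≰⇒> x≰y)))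

  -- The second-order error of the power function between r and r + q.
  σ : (q r k : ℕ) → ℕ
  σ q r zero    = 0
  σ q r (suc k) = r * σ q r k + k * (q * q) * (r + q) ^ k

  -- With t = r + q, `σ q r k` is t times the amount by which r^k exceeds the value at r of the
  -- tangent to the k-th power at t. The factor t avoids the exponent k - 1.
  σ-identity : ∀ q r k → (r + q) * (r + q) ^ k + σ q r k ≡ k * q * (r + q) ^ k + (r + q) * r ^ k
  σ-identity q r zero    = lem (r + q)
    where
    lem : ∀ t → t * 1 + 0 ≡ t * 1
    lem = ring
  σ-identity q r (suc k) = begin
    (r + q) * ((r + q) * T) + (r * σ q r k + k * (q * q) * T)     ≡⟨ lem₁ r q T (σ q r k) (k * (q * q)) ⟩
    r * ((r + q) * T + σ q r k) + q * ((r + q) * T) + k * (q * q) * T ≡⟨ cong (λ x → r * x + q * ((r + q) * T) + k * (q * q) * T) (σ-identity q r k) ⟩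
    r * (k * q * T + (r + q) * r ^ k) + q * ((r + q) * T) + k * (q * q) * T ≡⟨ lem₂ r q k T (r ^ k) ⟩
    suc k * q * ((r + q) * T) + (r + q) * (r * r ^ k)             ∎
    where
    open ≡-Reasoning
    T = (r + q) ^ k
    lem₁ : ∀ r q T σ c → (r + q) * ((r + q) * T) + (r * σ + c * T) ≡ r * ((r + q) * T + σ) + q * ((r + q) * T) + c * T
    lem₁ = ring
    lem₂ : ∀ r q k T R → r * (k * q * T + (r + q) * R) + q * ((r + q) * T) + k * (q * q) * T ≡ (1 + k) * q * ((r + q) * T) + (r + q) * (r * R)
    lem₂ = ring

  -- In terms of the tangent error σ / t this is the bound k² q² t^(k - 2), of second order in q /
  -- t.
  σ≤ : ∀ q r k → (r + q) * σ q r k ≤ k * k * (q * q) * (r + q) ^ k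
  σ≤ q r zero    = ≤-reflexive (*-zeroʳ (r + q))
  σ≤ q r (suc k) = begin
    (r + q) * (r * σ q r k + k * (q * q) * T)          ≡⟨ lem₁ (r + q) r (σ q r k) (k * (q * q) * T) ⟩
    r * ((r + q) * σ q r k) + (r + q) * (k * (q * q) * T) ≤⟨ +-monoˡ-≤ _ (*-mono-≤ (m≤m+n r q) (σ≤ q r k)) ⟩
    (r + q) * (k * k * (q * q) * T) + (r + q) * (k * (q * q) * T) ≤⟨ m≤m+n _ ((k + 1) * (q * q) * ((r + q) * T)) ⟩
    (r + q) * (k * k * (q * q) * T) + (r + q) * (k * (q * q) * T) + (k + 1) * (q * q) * ((r + q) * T) ≡⟨ lem₂ (r + q) k (q * q) T ⟩
    suc k * suc k * (q * q) * ((r + q) * T)            ∎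
    where
    open ≤-Reasoning
    T = (r + q) ^ k
    lem₁ : ∀ t r σ x → t * (r * σ + x) ≡ r * (t * σ) + t * x
    lem₁ = ring
    lem₂ : ∀ t k Q T → t * (k * k * Q * T) + t * (k * Q * T) + (k + 1) * Q * (t * T) ≡ (1 + k) * (1 + k) * Q * (t * T)
    lem₂ = ring

  ρ : (q r k : ℕ) → ℕ
  ρ q r k = (r + q) ^ k ∸ r ^ k

  r^k+ρ : ∀ q r k → r ^ k + ρ q r k ≡ (r + q) ^ k
  r^k+ρ q r k = m+[n∸m]≡n (^-monoˡ-≤ k (m≤m+n r q))

  ρ-identity : ∀ q r k → (r + q) * ρ q r k + σ q r k ≡ k * q * (r + q) ^ k
  ρ-identity q r k = +-cancelʳ-≡ ((r + q) * r ^ k) _ _ (begin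
    t * ρ q r k + σ q r k + t * r ^ k     ≡⟨ lem t (ρ q r k) (σ q r k) (r ^ k) ⟩
    t * (r ^ k + ρ q r k) + σ q r k       ≡⟨ cong (λ x → t * x + σ q r k) (r^k+ρ q r k) ⟩
    t * t ^ k + σ q r k                   ≡⟨ σ-identity q r k ⟩
    k * q * t ^ k + t * r ^ k             ∎)
    where
    open ≡-Reasoning
    t = r + q
    lem : ∀ t ρ σ R → t * ρ + σ + t * R ≡ t * (R + ρ) + σ
    lem = ring

  module _ (q r k′ m D B : ℕ) (t≤m : r + q ≤ m) (0<t : 0 < r + q) (kD≤mB : suc k′ * D ≤ m * B) where
    private
      t = r + q
      k = suc k′
      s = m ^ k * B

    -- One step lowers the predicted degree by at most the order of a single loss: the tangent
    -- bounds `ρ` by k q t^(k - 1), and `kD≤mB` trades `D` for `B`.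
    Dρ≤ : D * ρ q r k ≤ q * s
    Dρ≤ = begin
      D * ρ q r k             ≤⟨ *-monoʳ-≤ D ρ≤ ⟩
      D * (k * q * t ^ k′)    ≡⟨ lem₁ D k q (t ^ k′) ⟩
      k * D * q * t ^ k′      ≤⟨ *-mono-≤ (*-monoˡ-≤ q kD≤mB) (^-monoˡ-≤ k′ t≤m) ⟩
      m * B * q * m ^ k′      ≡⟨ lem₂ m B q (m ^ k′) ⟩
      q * s                   ∎
      where
      open ≤-Reasoning
      lem₁ : ∀ D k q T → D * (k * q * T) ≡ k * D * q * T
      lem₁ = ring
      lem₂ : ∀ m B q M → m * B * q * M ≡ q * (m * M * B)
      lem₂ = ring
      lem₃ : ∀ k q t T → k * q * (t * T) ≡ t * (k * q * T)
      lem₃ = ring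
      ρ≤ : ρ q r k ≤ k * q * t ^ k′
      ρ≤ = *-cancelˡ-≤ t {{>-nonZero 0<t}} (≤-trans (m≤m+n _ (σ q r k)) (≤-reflexive (trans (ρ-identity q r k) (lem₃ k q t (t ^ k′)))))

    D²σ≤ : D * D * σ q r k * t ^ k ≤ q * q * m * (s * s)
    D²σ≤ = begin
      D * D * σ q r k * t ^ k                     ≡⟨ lem₁ D (σ q r k) t (t ^ k′) ⟩
      D * D * (t * σ q r k) * t ^ k′              ≤⟨ *-mono-≤ (*-monoʳ-≤ (D * D) (σ≤ q r k)) (^-monoˡ-≤ k′ t≤m) ⟩
      D * D * (k * k * (q * q) * t ^ k) * m ^ k′  ≤⟨ *-monoˡ-≤ (m ^ k′) (*-monoʳ-≤ (D * D) (*-monoʳ-≤ (k * k * (q * q)) (^-monoˡ-≤ k t≤m))) ⟩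
      D * D * (k * k * (q * q) * m ^ k) * m ^ k′  ≡⟨ lem₂ D k q m (m ^ k′) ⟩
      (k * D) * (k * D) * (q * q * m ^ k * m ^ k′) ≤⟨ *-monoˡ-≤ (q * q * m ^ k * m ^ k′) (*-mono-≤ kD≤mB kD≤mB) ⟩
      (m * B) * (m * B) * (q * q * m ^ k * m ^ k′) ≡⟨ lem₃ m B q (m ^ k′) ⟩
      q * q * m * (s * s)                         ∎
      where
      open ≤-Reasoning
      lem₁ : ∀ D σ t T → D * D * σ * (t * T) ≡ D * D * (t * σ) * T
      lem₁ = ring
      lem₂ : ∀ D k q m M → D * D * (k * k * (q * q) * (m * M)) * M ≡ (k * D) * (k * D) * (q * q * (m * M) * M)
      lem₂ = ring
      lem₃ : ∀ m B q M → (m * B) * (m * B) * (q * q * (m * M) * M) ≡ q * q * m * (m * M * B * (m * M * B))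
      lem₃ = ring

  -- The term α·y pulls y towards 0, so only b contributes.
  drift : ∀ (κ α β : ℕ) (y b T : ℤ) → + κ *ᶻ T ≡ + α *ᶻ y +ᶻ b → ∣ b ∣ ≤ β →
          + κ *ᶻ (-ᶻ (+ 2 *ᶻ (y *ᶻ T))) ≤ᶻ + (2 * (∣ y ∣ * β))
  drift κ α β y b T κT≡ ∣b∣≤ = begin
    + κ *ᶻ (-ᶻ (+ 2 *ᶻ (y *ᶻ T)))                      ≡⟨ lem₁ (+ κ) y T ⟩
    -ᶻ (+ 2 *ᶻ (y *ᶻ (+ κ *ᶻ T)))                      ≡⟨ cong (λ x → -ᶻ (+ 2 *ᶻ (y *ᶻ x))) κT≡ ⟩
    -ᶻ (+ 2 *ᶻ (y *ᶻ (+ α *ᶻ y +ᶻ b)))                 ≤⟨ ≤-by {X} (+ 2 *ᶻ (+ α *ᶻ (y *ᶻ y))) (lem₂ (+ α) y b) 0≤ ⟩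
    + 2 *ᶻ (-ᶻ (y *ᶻ b))                               ≤⟨ ℤ.*-monoˡ-≤-nonNeg (+ 2) (ℤ.≤-trans (i≤∣i∣ (-ᶻ (y *ᶻ b))) (ℤB.+≤+ abs≤)) ⟩
    + 2 *ᶻ + (∣ y ∣ * β)                               ≡⟨ ℤ.pos-* 2 (∣ y ∣ * β) ⟨
    + (2 * (∣ y ∣ * β))                                ∎
    where
    open ℤ.≤-Reasoning
    X = -ᶻ (+ 2 *ᶻ (y *ᶻ (+ α *ᶻ y +ᶻ b)))
    lem₁ : ∀ κ y T → κ *ᶻ (-ᶻ (+ 2 *ᶻ (y *ᶻ T))) ≡ -ᶻ (+ 2 *ᶻ (y *ᶻ (κ *ᶻ T)))
    lem₁ = ringᶻ
    lem₂ : ∀ α y b → + 2 *ᶻ (-ᶻ (y *ᶻ b)) ≡ -ᶻ (+ 2 *ᶻ (y *ᶻ (α *ᶻ y +ᶻ b))) +ᶻ + 2 *ᶻ (α *ᶻ (y *ᶻ y))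
    lem₂ = ringᶻ
    0≤ : + 0 ≤ᶻ + 2 *ᶻ (+ α *ᶻ (y *ᶻ y))
    0≤ = subst (+ 0 ≤ᶻ_) (trans (ℤ.pos-* 2 (α * sq y)) (cong (+ 2 *ᶻ_) (trans (ℤ.pos-* α (sq y)) (cong (+ α *ᶻ_) (+sq y))))) (ℤB.+≤+ z≤n)
    abs≤ : ∣ -ᶻ (y *ᶻ b) ∣ ≤ ∣ y ∣ * β
    abs≤ = ≤-trans (≤-reflexive (trans (ℤ.∣-i∣≡∣i∣ (y *ᶻ b)) (ℤ.∣i*j∣≡∣i∣*∣j∣ y b))) (*-monoʳ-≤ ∣ y ∣ ∣b∣≤)

  -- Relative growth of the potential in one step, times `m`. The summands come from the cross term
  -- of `square-update`, from the drift divided by the total weight, and from the second-order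
  -- terms.
  stepConst : (q C₂ : ℕ) → ℕ
  stepConst q C₂ = 2 * (q * q) + 5 * (q * q) * C₂ + 5 * (q * q * (q * q))

  -- As long as m / E vertices are free, the ideal total weight is at least m² s / L. The power of 4
  -- bounds the growth of the potential over a whole run. From this size of `m` on, the deviations
  -- stay below half of the ideal total.
  nibbleThreshold : (k′ C E : ℕ) → ℕ
  nibbleThreshold k′ C E = 4 * (L * L) * 4 ^ stepConst (suc (suc k′)) (2 * L)
    where L = C * E ^ suc (suc k′)

  -- `H` and `q * P` multiply the average and the drift bound only to avoid division; the lower
  -- bound on `P * q * H` removes them again. A negative `g` is bounded trivially, so factors are
  -- cancelled only in the other case.
  combine : ∀ m s q C₂ Φ Φ′ P H (g Γ : ℤ) → 1 ≤ m → 1 ≤ s →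
    + (m * Φ′) ≤ᶻ + ((m + 2 * (q * q)) * Φ) +ᶻ + m *ᶻ g +ᶻ + (m * (m * (5 * (q * q * (q * q)) * (s * s)))) →
    + H *ᶻ g ≤ᶻ Γ →
    + (q * P) *ᶻ Γ ≤ᶻ + (5 * (q * q) * s * (m * Φ + m * m * (s * s))) →
    m * m * s ≤ C₂ * (P * q * H) →
    m * (Φ′ + m * m * (s * s)) ≤ (m + stepConst q C₂) * (Φ + m * m * (s * s))
  combine m s q C₂ Φ Φ′ P H g Γ 1≤m 1≤s update Hg≤Γ Γ≤ H≥ = begin
    m * (Φ′ + m * m * (s * s))                       ≡⟨ *-distribˡ-+ m Φ′ _ ⟩
    m * Φ′ + m * (m * m * (s * s))                   ≤⟨ +-monoˡ-≤ _ mΦ′≤ ⟩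
    (m + 2 * (q * q)) * Φ + c₁ * (Φ + m * (s * s)) + m * (m * (5 * (q * q * (q * q)) * (s * s))) + m * (m * m * (s * s))
      ≤⟨ +-monoˡ-≤ _ (+-monoˡ-≤ _ (+-monoʳ-≤ ((m + 2 * (q * q)) * Φ) (*-monoʳ-≤ c₁ (+-monoʳ-≤ Φ (≤-trans (≤-reflexive (sym (*-identityˡ _))) (≤-trans (*-monoˡ-≤ (m * (s * s)) 1≤m) (≤-reflexive (sym (*-assoc m m (s * s)))))))))) ⟩
    (m + 2 * (q * q)) * Φ + c₁ * (Φ + m * m * (s * s)) + m * (m * (5 * (q * q * (q * q)) * (s * s))) + m * (m * m * (s * s))
      ≤⟨ m≤m+n _ (2 * (q * q) * (m * m * (s * s)) + 5 * (q * q * (q * q)) * Φ) ⟩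
    (m + 2 * (q * q)) * Φ + c₁ * (Φ + m * m * (s * s)) + m * (m * (5 * (q * q * (q * q)) * (s * s))) + m * (m * m * (s * s)) + (2 * (q * q) * (m * m * (s * s)) + 5 * (q * q * (q * q)) * Φ)
      ≡⟨ lem m (q * q) Φ c₁ (s * s) ⟩
    (m + stepConst q C₂) * (Φ + m * m * (s * s))     ∎
    where
    open ≤-Reasoning
    c₁ = 5 * (q * q) * C₂
    lem : ∀ m Q Φ c s → (m + 2 * Q) * Φ + c * (Φ + m * m * s) + m * (m * (5 * (Q * Q) * s)) + m * (m * m * s) + (2 * Q * (m * m * s) + 5 * (Q * Q) * Φ)
          ≡ (m + (2 * Q + c + 5 * (Q * Q))) * (Φ + m * m * s)
    lem = ring
    mg≤ : ∀ g → + H *ᶻ g ≤ᶻ Γ → + m *ᶻ g ≤ᶻ + (c₁ * (Φ + m * (s * s)))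
    mg≤ -[1+ γ ] _ = ℤ.≤-trans (ℤ.≤-trans (ℤ.*-monoˡ-≤-nonNeg (+ m) { -[1+ γ ] } {+ 0} ℤB.-≤+) (ℤ.≤-reflexive (ℤ.*-zeroʳ (+ m)))) (ℤB.+≤+ z≤n)
    mg≤ (+ γ) Hγ≤ = ℤ.≤-trans (ℤ.≤-reflexive (sym (ℤ.pos-* m γ))) (ℤB.+≤+ (*-cancelˡ-≤ (m * s) {{>-nonZero (*-mono-≤ 1≤m 1≤s)}} (begin
      m * s * (m * γ)                            ≡⟨ lem₁ m s γ ⟩
      m * m * s * γ                              ≤⟨ *-monoˡ-≤ γ H≥ ⟩
      C₂ * (P * q * H) * γ                       ≡⟨ lem₂ C₂ P q H γ ⟩
      C₂ * (q * P * (H * γ))                     ≤⟨ *-monoʳ-≤ C₂ qPHγ≤ ⟩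
      C₂ * (5 * (q * q) * s * (m * Φ + m * m * (s * s))) ≡⟨ lem₃ C₂ q s m Φ ⟩
      m * s * (c₁ * (Φ + m * (s * s)))           ∎)))
      where
      lem₁ : ∀ m s γ → m * s * (m * γ) ≡ m * m * s * γ
      lem₁ = ring
      lem₂ : ∀ C P q H γ → C * (P * q * H) * γ ≡ C * (q * P * (H * γ))
      lem₂ = ring
      lem₃ : ∀ C q s m Φ → C * (5 * (q * q) * s * (m * Φ + m * m * (s * s))) ≡ m * s * (5 * (q * q) * C * (Φ + m * (s * s)))
      lem₃ = ring
      qPHγ≤ : q * P * (H * γ) ≤ 5 * (q * q) * s * (m * Φ + m * m * (s * s))
      qPHγ≤ = ℤ.drop‿+≤+ (ℤ.≤-trans (ℤ.≤-reflexive (trans (ℤ.pos-* (q * P) (H * γ)) (cong (+ (q * P) *ᶻ_) (ℤ.pos-* H γ))))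
        (ℤ.≤-trans (ℤ.*-monoˡ-≤-nonNeg (+ (q * P)) Hγ≤) Γ≤))
    mΦ′≤ : m * Φ′ ≤ (m + 2 * (q * q)) * Φ + c₁ * (Φ + m * (s * s)) + m * (m * (5 * (q * q * (q * q)) * (s * s)))
    mΦ′≤ = ℤ.drop‿+≤+ (ℤ.≤-trans update (ℤ.+-monoˡ-≤ _ (ℤ.+-monoʳ-≤ (+ ((m + 2 * (q * q)) * Φ)) (mg≤ g Hg≤Γ))))

  *-^ : ∀ a b k → (a * b) ^ k ≡ a ^ k * b ^ k
  *-^ a b zero    = refl
  *-^ a b (suc k) = trans (cong (a * b *_) (*-^ a b k)) (lem a b (a ^ k) (b ^ k))
    where
    lem : ∀ a b c d → a * b * (c * d) ≡ a * c * (b * d)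
    lem = ring

  -- By the density of the weight the ideal total is a fixed fraction of m² s. The actual total
  -- misses it by at most `S`, which the potential bound, in the form `S * S ≤ m * Φ`, makes at most
  -- half of that fraction when `m` is large.
  H-large : ∀ m k t D B C E S Φ K PqH → let s = m ^ k * B; L = C * E ^ suc k in
    m ≤ t * E → m * B ≤ C * D → t * (D * t ^ k) ≤ PqH + S → S * S ≤ m * Φ →
    Φ + m * m * (s * s) ≤ K * (m * m * (s * s)) → 4 * (L * L) * K ≤ m →
    m * m * s ≤ 2 * L * PqH
  H-large m k t D B C E S Φ K PqH m≤tE mB≤CD low SS≤ Φ≤ m-large = +-cancelʳ-≤ (m * m * s) _ _ (begin
    m * m * s + m * m * s                     ≤⟨ +-mono-≤ main main ⟩
    L * (t * (D * t ^ k)) + L * (t * (D * t ^ k)) ≡⟨ lem₁ L (t * (D * t ^ k)) ⟩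
    2 * L * (t * (D * t ^ k))                 ≤⟨ *-monoʳ-≤ (2 * L) low ⟩
    2 * L * (PqH + S)                         ≡⟨ *-distribˡ-+ (2 * L) PqH S ⟩
    2 * L * PqH + 2 * L * S                   ≤⟨ +-monoʳ-≤ (2 * L * PqH) S-small ⟩
    2 * L * PqH + m * m * s                   ∎)
    where
    open ≤-Reasoning
    s = m ^ k * B
    L = C * E ^ suc k
    lem₁ : ∀ L x → L * x + L * x ≡ 2 * L * x
    lem₁ = ring
    main : m * m * s ≤ L * (t * (D * t ^ k))
    main = begin
      m * m * (m ^ k * B)                     ≡⟨ lem m (m ^ k) B ⟩
      m * B * m ^ suc k                       ≤⟨ *-mono-≤ mB≤CD (^-monoˡ-≤ (suc k) m≤tE) ⟩
      C * D * (t * E) ^ suc k                 ≡⟨ cong (C * D *_) (*-^ t E (suc k)) ⟩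
      C * D * (t ^ suc k * E ^ suc k)         ≡⟨ lem₂ C D t (t ^ k) (E ^ suc k) ⟩
      L * (t * (D * t ^ k))                   ∎
      where
      lem : ∀ m M B → m * m * (M * B) ≡ m * B * (m * M)
      lem = ring
      lem₂ : ∀ C D t T E → C * D * (t * T * E) ≡ C * E * (t * (D * T))
      lem₂ = ring
    S-small : 2 * L * S ≤ m * m * s
    S-small = *-cancel-sq-≤ (2 * L * S) (m * m * s) (begin
      2 * L * S * (2 * L * S)                 ≡⟨ lem L S ⟩
      4 * (L * L) * (S * S)                   ≤⟨ *-monoʳ-≤ (4 * (L * L)) (≤-trans SS≤ (*-monoʳ-≤ m (≤-trans (m≤m+n Φ _) Φ≤))) ⟩
      4 * (L * L) * (m * (K * (m * m * (s * s)))) ≡⟨ lem₂ (L * L) m K (m * m * (s * s)) ⟩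
      4 * (L * L) * K * (m * (m * m * (s * s))) ≤⟨ *-monoˡ-≤ (m * (m * m * (s * s))) m-large ⟩
      m * (m * (m * m * (s * s)))             ≡⟨ lem₃ m s ⟩
      m * m * s * (m * m * s)                 ∎)
      where
      lem : ∀ L S → 2 * L * S * (2 * L * S) ≡ 4 * (L * L) * (S * S)
      lem = ring
      lem₂ : ∀ L m K x → 4 * L * (m * (K * x)) ≡ 4 * L * K * (m * x)
      lem₂ = ring
      lem₃ : ∀ m s → m * (m * (m * m * (s * s))) ≡ m * m * s * (m * m * s)
      lem₃ = ring

  Γ-arith : ∀ q s m S Φ → 1 ≤ q → S * S ≤ m * Φ →
            2 * (S * (2 * (q * s * S) + q * q * m * (s * s))) ≤ 5 * (q * q) * s * (m * Φ + m * m * (s * s))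
  Γ-arith q s m S Φ 1≤q SS≤ = begin
    2 * (S * (2 * (q * s * S) + q * q * m * (s * s)))             ≡⟨ lem₁ q s m S ⟩
    4 * (q * s) * (S * S) + q * q * s * (2 * (S * (m * s)))       ≤⟨ +-mono-≤ (*-monoˡ-≤ (S * S) (*-monoʳ-≤ 4 (*-monoˡ-≤ s q≤qq))) (*-monoʳ-≤ (q * q * s) (2ab≤a²+b² S (m * s))) ⟩
    4 * (q * q * s) * (S * S) + q * q * s * (S * S + m * s * (m * s)) ≤⟨ +-mono-≤ (*-monoʳ-≤ (4 * (q * q * s)) SS≤) (*-monoʳ-≤ (q * q * s) (+-monoˡ-≤ _ SS≤)) ⟩
    4 * (q * q * s) * (m * Φ) + q * q * s * (m * Φ + m * s * (m * s)) ≤⟨ m≤m+n _ (4 * (q * q * s) * (m * m * (s * s))) ⟩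
    4 * (q * q * s) * (m * Φ) + q * q * s * (m * Φ + m * s * (m * s)) + 4 * (q * q * s) * (m * m * (s * s)) ≡⟨ lem₂ (q * q) s m Φ ⟩
    5 * (q * q) * s * (m * Φ + m * m * (s * s))                   ∎
    where
    open ≤-Reasoning
    q≤qq : q ≤ q * q
    q≤qq = ≤-trans (≤-reflexive (sym (*-identityʳ q))) (*-monoʳ-≤ q 1≤q)
    lem₁ : ∀ q s m S → 2 * (S * (2 * (q * s * S) + q * q * m * (s * s))) ≡ 4 * (q * s) * (S * S) + q * q * s * (2 * (S * (m * s)))
    lem₁ = ring
    lem₂ : ∀ Q s m Φ → 4 * (Q * s) * (m * Φ) + Q * s * (m * Φ + m * s * (m * s)) + 4 * (Q * s) * (m * m * (s * s)) ≡ 5 * Q * s * (m * Φ + m * m * (s * s))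
    lem₂ = ring

  -- Bernoulli's inequality for the base 1 - 1 / (m + 1), denominators cleared.
  bernoulli : ∀ m j → j ≤ suc m → suc m ^ j * (suc m ∸ j) ≤ suc m * m ^ j
  bernoulli m zero    _ = ≤-reflexive (trans (*-identityˡ (suc m)) (sym (*-identityʳ (suc m))))
  bernoulli m (suc j) (s≤s j≤m) = begin
    suc m * suc m ^ j * (m ∸ j)    ≡⟨ lem₁ (suc m) (suc m ^ j) (m ∸ j) ⟩
    suc m ^ j * (suc m * (m ∸ j))  ≤⟨ *-monoʳ-≤ (suc m ^ j) core ⟩
    suc m ^ j * (m * suc (m ∸ j))  ≡⟨ cong (λ x → suc m ^ j * (m * x)) (sym (+-∸-assoc 1 j≤m)) ⟩
    suc m ^ j * (m * (suc m ∸ j))  ≡⟨ lem₂ (suc m ^ j) m (suc m ∸ j) ⟩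
    m * (suc m ^ j * (suc m ∸ j))  ≤⟨ *-monoʳ-≤ m (bernoulli m j (m≤n⇒m≤1+n j≤m)) ⟩
    m * (suc m * m ^ j)            ≡⟨ lem₂ m (suc m) (m ^ j) ⟩
    suc m * (m * m ^ j)            ∎
    where
    open ≤-Reasoning
    lem₁ : ∀ a b c → a * b * c ≡ b * (a * c)
    lem₁ = ring
    lem₂ : ∀ a b c → a * (b * c) ≡ b * (a * c)
    lem₂ = ring
    core : suc m * (m ∸ j) ≤ m * suc (m ∸ j)
    core = ≤-trans (+-monoˡ-≤ (m * (m ∸ j)) (m∸n≤m m j)) (≤-reflexive (sym (*-suc m (m ∸ j))))

  growth-half : ∀ m j → j + j ≤ suc m → suc m ^ j ≤ 2 * m ^ j
  growth-half m j 2j≤ = *-cancelˡ-≤ (suc m) (begin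
    suc m * suc m ^ j                ≤⟨ *-monoˡ-≤ (suc m ^ j) half ⟩
    2 * (suc m ∸ j) * suc m ^ j      ≡⟨ lem (suc m ∸ j) (suc m ^ j) ⟩
    2 * (suc m ^ j * (suc m ∸ j))    ≤⟨ *-monoʳ-≤ 2 (bernoulli m j (≤-trans (m≤m+n j j) 2j≤)) ⟩
    2 * (suc m * m ^ j)              ≡⟨ lem₂ (suc m) (m ^ j) ⟩
    suc m * (2 * m ^ j)              ∎)
    where
    open ≤-Reasoning
    lem : ∀ a b → 2 * a * b ≡ 2 * (b * a)
    lem = ring
    lem₂ : ∀ a b → 2 * (a * b) ≡ a * (2 * b)
    lem₂ = ring
    half : suc m ≤ 2 * (suc m ∸ j)
    half = ≤-trans (≤-reflexive (sym (m+[n∸m]≡n (≤-trans (m≤m+n j j) 2j≤)))) (≤-trans (+-monoˡ-≤ (suc m ∸ j) (≤-trans (≤-reflexive (sym (m+n∸n≡m j j))) (∸-monoˡ-≤ j 2j≤)))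
      (≤-reflexive (cong (λ x → suc m ∸ j + x) (sym (+-identityʳ _)))))

  -- Bernoulli's bound is too weak for exponents near `m`, so the exponent is halved and each half
  -- costs a factor 2.
  growth-one : ∀ m i → i ≤ m → suc m ^ i ≤ 4 * m ^ i
  growth-one m i i≤m = begin
    suc m ^ i                                ≡⟨ cong (suc m ^_) (sym split) ⟩
    suc m ^ (⌊ i /2⌋ + ⌈ i /2⌉)              ≡⟨ ^-distribˡ-+-* (suc m) ⌊ i /2⌋ ⌈ i /2⌉ ⟩
    suc m ^ ⌊ i /2⌋ * suc m ^ ⌈ i /2⌉        ≤⟨ *-mono-≤ (growth-half m ⌊ i /2⌋ fl) (growth-half m ⌈ i /2⌉ ce) ⟩
    2 * m ^ ⌊ i /2⌋ * (2 * m ^ ⌈ i /2⌉)      ≡⟨ lem (m ^ ⌊ i /2⌋) (m ^ ⌈ i /2⌉) ⟩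
    4 * (m ^ ⌊ i /2⌋ * m ^ ⌈ i /2⌉)          ≡⟨ cong (4 *_) (^-distribˡ-+-* m ⌊ i /2⌋ ⌈ i /2⌉) ⟨
    4 * m ^ (⌊ i /2⌋ + ⌈ i /2⌉)              ≡⟨ cong (λ x → 4 * m ^ x) split ⟩
    4 * m ^ i                                ∎
    where
    open ≤-Reasoning
    split : ⌊ i /2⌋ + ⌈ i /2⌉ ≡ i
    split = ⌊n/2⌋+⌈n/2⌉≡n i
    lem : ∀ a b → 2 * a * (2 * b) ≡ 4 * (a * b)
    lem = ring
    ce : ⌈ i /2⌉ + ⌈ i /2⌉ ≤ suc m
    ce = ≤-trans (+-monoʳ-≤ ⌊ suc i /2⌋ (⌊n/2⌋≤⌈n/2⌉ (suc i))) (≤-trans (≤-reflexive (⌊n/2⌋+⌈n/2⌉≡n (suc i))) (s≤s i≤m))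
    fl : ⌊ i /2⌋ + ⌊ i /2⌋ ≤ suc m
    fl = ≤-trans (+-monoʳ-≤ ⌊ i /2⌋ (⌊n/2⌋≤⌈n/2⌉ i)) (≤-trans (≤-reflexive split) (m≤n⇒m≤1+n i≤m))

  -- Here 4^C plays the role of e^C. Raising `C` by one replaces the base `m` by a larger one, which
  -- only relaxes the condition on the exponent.
  growth : ∀ C m i → i ≤ m → (m + C) ^ i ≤ 4 ^ C * m ^ i
  growth zero    m i i≤m = ≤-reflexive (trans (cong (_^ i) (+-identityʳ m)) (sym (*-identityˡ (m ^ i))))
  growth (suc C) m i i≤m = begin
    (m + suc C) ^ i         ≡⟨ cong (_^ i) (+-suc m C) ⟩
    suc (m + C) ^ i         ≤⟨ growth-one (m + C) i (≤-trans i≤m (m≤m+n m C)) ⟩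
    4 * (m + C) ^ i         ≤⟨ *-monoʳ-≤ 4 (growth C m i i≤m) ⟩
    4 * (4 ^ C * m ^ i)     ≡⟨ *-assoc 4 (4 ^ C) (m ^ i) ⟨
    4 * 4 ^ C * m ^ i       ∎
    where open ≤-Reasoning

-- Coverage counts of edge families.

module Covers where
  open FiniteSums
  open Indicators
  open import Data.Fin.Subset using (∣_∣)
  open import Data.Nat
  open import Data.Nat.Properties
  open import Data.Nat.Tactic.RingSolver using () renaming (solve-∀ to ring)
  open import Relation.Binary.PropositionalEquality

  private variable
    n : ℕ

  -- Counted with multiplicity: a list is a matching when this is at most 1 and perfect when it
  -- equals 1, and both can be read off from identities between sums.
  cover : List (Subset n) → Fin n → ℕ
  cover N v = ∑ N (λ e → ι e v)

  free : (Fin n → ℕ) → ℕ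
  free c = Σᵥ (λ v → iszero (c v))

  meet : Subset n → (Fin n → ℕ) → ℕ
  meet e c = Σᵥ (λ v → ι e v * c v)

  avoid : Subset n → (Fin n → ℕ) → ℕ
  avoid e c = iszero (meet e c)

  infixl 6 _⊕_
  _⊕_ : (Fin n → ℕ) → Subset n → Fin n → ℕ
  (c ⊕ e) v = c v + ι e v

  meet-+ : ∀ (e : Subset n) c c′ → meet e (λ v → c v + c′ v) ≡ meet e c + meet e c′
  meet-+ {n} e c c′ = trans (∑-cong (verts n) (λ v → *-distribˡ-+ (ι e v) (c v) (c′ v))) (∑-+ (verts n) _ _)

  avoid-⊕ : ∀ (g : Subset n) c e → avoid g (c ⊕ e) ≡ avoid g c * iszero (meet g (ι e))
  avoid-⊕ g c e = trans (cong iszero (meet-+ g c (ι e))) (iszero-+ (meet g c) (meet g (ι e)))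

  *-pos⁻¹ : ∀ a b → 0 < a * b → 0 < a × 0 < b
  *-pos⁻¹ (suc a) (suc b) _ = z<s , z<s
  *-pos⁻¹ (suc a) zero    p = contradiction (subst (0 <_) (*-zeroʳ a) p) (n≮n 0)

  avoid⇒c≡0 : ∀ (e : Subset n) c v → 0 < avoid e c → 0 < ι e v → c v ≡ 0
  avoid⇒c≡0 e c v av ∈e = n≤0⇒n≡0 (begin
    c v              ≡⟨ *-identityˡ (c v) ⟨
    1 * c v          ≤⟨ *-monoˡ-≤ (c v) ∈e ⟩
    ι e v * c v      ≤⟨ Σᵥ-lookup (λ u → ι e u * c u) v ⟩
    meet e c         ≡⟨ iszero-pos av ⟩
    0                ∎)
    where open ≤-Reasoning

  avoid-free : ∀ (e : Subset n) c v → avoid e c * ι e v * iszero (c v) ≡ avoid e c * ι e v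
  avoid-free e c v with avoid e c * ι e v in eq
  ... | zero  = refl
  ... | suc j with *-pos⁻¹ (avoid e c) (ι e v) (subst (0 <_) (sym eq) z<s)
  ...   | av , ∈e rewrite avoid⇒c≡0 e c v av ∈e = *-identityʳ (suc j)

  free-⊕ : ∀ (c : Fin n → ℕ) e → 0 < avoid e c → free c ≡ free (c ⊕ e) + ∣ e ∣
  free-⊕ {n} c e av = begin
    free c                                              ≡⟨ ∑-cong (verts n) pointwise ⟩
    Σᵥ (λ v → iszero (c v + ι e v) + ι e v)             ≡⟨ ∑-+ (verts n) _ _ ⟩
    free (c ⊕ e) + Σᵥ (ι e)                             ≡⟨ cong (free (c ⊕ e) +_) (Σᵥ-ι e) ⟩
    free (c ⊕ e) + ∣ e ∣                                ∎
    where
    open ≡-Reasoning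
    pointwise : ∀ v → iszero (c v) ≡ iszero (c v + ι e v) + ι e v
    pointwise v with ι e v in eq | ι≤1 e v
    ... | zero        | _ = trans (cong iszero (sym (+-identityʳ (c v)))) (sym (+-identityʳ _))
    ... | suc zero    | _ rewrite avoid⇒c≡0 e c v av (subst (0 <_) (sym eq) z<s) = refl
    ... | suc (suc _) | s≤s ()

  n≤Σ+free : ∀ (c : Fin n → ℕ) → n ≤ Σᵥ c + free c
  n≤Σ+free {n} c = begin
    n                             ≡⟨ Σᵥ-1 {n} ⟨
    Σᵥ {n} (λ _ → 1)              ≤⟨ ∑-mono (verts n) (λ v → 1≤a+iszero (c v)) ⟩
    Σᵥ (λ v → c v + iszero (c v)) ≡⟨ ∑-+ (verts n) _ _ ⟩
    Σᵥ c + free c                 ∎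
    where open ≤-Reasoning

  Σ<n⇒0<free : ∀ (c : Fin n → ℕ) → Σᵥ c < n → 0 < free c
  Σ<n⇒0<free {n} c Σc<n = n≢0⇒n>0 λ ≡0 → contradiction
    (≤-trans (n≤Σ+free c) (≤-reflexive (trans (cong (Σᵥ c +_) ≡0) (+-identityʳ (Σᵥ c))))) (<⇒≱ Σc<n)

  Σ+free≡n : ∀ (c : Fin n → ℕ) → (∀ v → c v ≤ 1) → Σᵥ c + free c ≡ n
  Σ+free≡n {n} c c≤1 = trans (sym (∑-+ (verts n) _ _)) (trans (∑-cong (verts n) (λ v → +iszero≡1 (c≤1 v))) (Σᵥ-1 {n}))

  -- Cauchy-Schwarz for the weights `f`: twice the square is a double sum, to which the inequality
  -- of the means is applied pair by pair.
  cauchy : ∀ {A : Set} (xs : List A) (f a : A → ℕ) →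
           ∑ xs (λ x → f x * a x) * ∑ xs (λ x → f x * a x) ≤ ∑ xs f * ∑ xs (λ x → f x * (a x * a x))
  cauchy xs f a = *-cancelˡ-≤ 2 (begin
    2 * (S * S)                                                        ≡⟨ cong (2 *_) (∑-*ˡ xs S _) ⟨
    2 * ∑ xs (λ x → S * (f x * a x))                                   ≡⟨ ∑-*ˡ xs 2 _ ⟨
    ∑ xs (λ x → 2 * (S * (f x * a x)))                                 ≡⟨ ∑-cong xs (λ x → trans (lem₁ S (f x * a x)) (sym (∑-*ˡ xs (2 * (f x * a x)) _))) ⟩
    ∑ xs (λ x → ∑ xs (λ y → 2 * (f x * a x) * (f y * a y)))            ≤⟨ ∑-mono xs (λ x → ∑-mono xs (λ y → pointwise x y)) ⟩
    ∑ xs (λ x → ∑ xs (λ y → f x * (a x * a x) * f y + f x * (f y * (a y * a y))))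
      ≡⟨ ∑-cong xs (λ x → trans (∑-+ xs _ _) (cong₂ _+_ (∑-*ˡ xs (f x * (a x * a x)) f) (∑-*ˡ xs (f x) _))) ⟩
    ∑ xs (λ x → f x * (a x * a x) * F + f x * Q)                       ≡⟨ trans (∑-+ xs _ _) (cong₂ _+_ (∑-*ʳ xs F _) (∑-*ʳ xs Q f)) ⟩
    Q * F + F * Q                                                      ≡⟨ lem₂ F Q ⟩
    2 * (F * Q)                                                        ∎)
    where
    open ≤-Reasoning
    open NibbleArithmetic using (2ab≤a²+b²)
    F = ∑ xs f
    S = ∑ xs (λ x → f x * a x)
    Q = ∑ xs (λ x → f x * (a x * a x))
    lem₁ : ∀ s x → 2 * (s * x) ≡ 2 * x * s
    lem₁ = ring
    lem₂ : ∀ f q → q * f + f * q ≡ 2 * (f * q)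
    lem₂ = ring
    lem₃ : ∀ f g a b → 2 * (f * a) * (g * b) ≡ f * g * (2 * (a * b))
    lem₃ = ring
    lem₄ : ∀ f g a b → f * g * (a * a + b * b) ≡ f * (a * a) * g + f * (g * (b * b))
    lem₄ = ring
    pointwise : ∀ x y → 2 * (f x * a x) * (f y * a y) ≤ f x * (a x * a x) * f y + f x * (f y * (a y * a y))
    pointwise x y = ≤-trans (≤-reflexive (lem₃ (f x) (f y) (a x) (a y)))
      (≤-trans (*-monoʳ-≤ (f x * f y) (2ab≤a²+b² (a x) (a y))) (≤-reflexive (lem₄ (f x) (f y) (a x) (a y))))

-- Nearly uniform weights and the state of the nibble.

module SpreadWeights where
  open FiniteSums
  open Indicators
  open Covers
  open NibbleArithmetic
  open import Data.Fin.Subset using () renaming (∣_∣ to ∥_∥)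
  open import Data.Integer using (ℤ; +_; ∣_∣) renaming (_+_ to _+ᶻ_; _*_ to _*ᶻ_; _≤_ to _≤ᶻ_; -_ to -ᶻ_; _-_ to _-ᶻ_)
  import Data.Integer as ℤB
  import Data.Integer.Properties as ℤ
  open import Data.Integer.Tactic.RingSolver using () renaming (solve-∀ to ringᶻ)
  open import Data.Nat
  open import Data.Nat.Properties
  open import Data.Nat.Tactic.RingSolver using () renaming (solve-∀ to ring)
  open import Relation.Binary.PropositionalEquality

  -- Here and below q = k′ + 2. A set of vertices is given by a function c₀ : Fin n → ℕ that is
  -- positive on the blocked vertices and 0 on the free ones.
  record SpreadWeight {n} (k′ m B C D : ℕ) (c₀ : Fin n → ℕ) (w : Subset n → ℕ) : Set where
    field
      free-size : free c₀ ≡ m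
      size      : ∀ e → 0 < w e → ∥ e ∥ ≡ suc (suc k′)
      avoids    : ∀ e → 0 < w e → 0 < avoid e c₀
      regular   : ∀ v → c₀ v ≡ 0 → Σₛ (λ e → w e * ι e v) ≡ D
      pairs     : ∀ v u → 0 < ν v u → Σₛ (λ e → w e * (ι e v * ι e u)) ≤ B
      triples   : ∀ v u x → 0 < ν v u → 0 < ν v x → 0 < ν u x →
                  m * Σₛ (λ e → w e * (ι e v * ι e u * ι e x)) ≤ B
      dense     : m * B ≤ C * D
      0<B       : 0 < B
      0<m       : 0 < m

  ∣∑ᶻ∣≤ : ∀ {A : Set} (xs : List A) (f : A → ℤ) → ∣ ∑ᶻ xs f ∣ ≤ ∑ xs (λ x → ∣ f x ∣)
  ∣∑ᶻ∣≤ []       f = z≤n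
  ∣∑ᶻ∣≤ (x ∷ xs) f = ≤-trans (ℤ.∣i+j∣≤∣i∣+∣j∣ (f x) (∑ᶻ xs f)) (+-monoʳ-≤ ∣ f x ∣ (∣∑ᶻ∣≤ xs f))

  ∣a-b∣≤ : ∀ a b N → a ≤ N → b ≤ N → ∣ + a -ᶻ + b ∣ ≤ N
  ∣a-b∣≤ a b N a≤ b≤ = ≤-trans (≤-reflexive (cong ∣_∣ (ℤ.m-n≡m⊖n a b))) (≤-trans (ℤ.∣m⊝n∣≤m⊔n a b) (⊔-lub a≤ b≤))

  -- X v is the weight of the edges through v inside the t free vertices, which should be about
  -- D (t / m) ^ k; y v is the deviation from this, scaled by m ^ k, and Φ is the potential.
  module State {n} (k′ m B D : ℕ) (w : Subset n → ℕ) (c : Fin n → ℕ) where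
    k q P s t H Φ S : ℕ
    k = suc k′
    q = suc k
    P = m ^ k
    s = P * B
    f : Fin n → ℕ
    f v = iszero (c v)
    t = Σᵥ f
    wU : Subset n → ℕ
    wU e = w e * avoid e c
    X : Fin n → ℕ
    X v = Σₛ (λ e → wU e * ι e v)
    H = Σₛ wU
    y : Fin n → ℤ
    y v = + (P * X v) -ᶻ + (D * t ^ k)
    d : Fin n → Fin n → ℕ
    d v u = ν v u * Σₛ (λ e → wU e * (ι e v * ι e u))
    Φ = Σᵥ (λ v → f v * sq (y v))
    S = Σᵥ (λ v → f v * ∣ y v ∣)
    wU≤w : ∀ e → wU e ≤ w e
    wU≤w e = ≤-trans (*-monoʳ-≤ (w e) (iszero≤1 (meet e c))) (≤-reflexive (*-identityʳ (w e)))

  module Facts {n} {k′ m B C D : ℕ} {c₀ : Fin n → ℕ} {w : Subset n → ℕ} (W : SpreadWeight k′ m B C D c₀ w)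
               (c : Fin n → ℕ) where
    open SpreadWeight W
    open State k′ m B D w c

    scaled-size : ∀ e → w e * ∥ e ∥ ≡ w e * q
    scaled-size e with w e in eq
    ... | zero  = refl
    ... | suc j = cong (suc j *_) (size e (subst (0 <_) (sym eq) z<s))

    wU-size : ∀ e → wU e * ∥ e ∥ ≡ wU e * q
    wU-size e = begin
      w e * avoid e c * ∥ e ∥     ≡⟨ lem (w e) (avoid e c) ∥ e ∥ ⟩
      w e * ∥ e ∥ * avoid e c     ≡⟨ cong (_* avoid e c) (scaled-size e) ⟩
      w e * q * avoid e c         ≡⟨ lem (w e) q (avoid e c) ⟩
      w e * avoid e c * q         ∎
      where
      open ≡-Reasoning
      lem : ∀ a b c → a * b * c ≡ a * c * b
      lem = ring

    ΣX : Σᵥ X ≡ q * H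
    ΣX = begin
      Σᵥ (λ v → Σₛ (λ e → wU e * ι e v))     ≡⟨ ∑-swap (verts n) (allSubsets n) _ ⟩
      Σₛ (λ e → Σᵥ (λ v → wU e * ι e v))     ≡⟨ ∑-cong (allSubsets n) (λ e → trans (∑-*ˡ (verts n) (wU e) (ι e)) (trans (cong (wU e *_) (Σᵥ-ι e)) (trans (wU-size e) (*-comm (wU e) q)))) ⟩
      Σₛ (λ e → q * wU e)                    ≡⟨ ∑-*ˡ (allSubsets n) q wU ⟩
      q * H                                  ∎
      where open ≡-Reasoning

    X-free : ∀ v → f v * X v ≡ X v
    X-free v = trans (sym (∑-*ˡ (allSubsets n) (f v) _)) (∑-cong (allSubsets n) (λ e →
      trans (lem₁ (f v) (w e) (avoid e c) (ι e v)) (trans (cong (w e *_) (avoid-free e c v)) (sym (*-assoc (w e) (avoid e c) (ι e v))))))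
      where
      lem₁ : ∀ f w a i → f * (w * a * i) ≡ w * (a * i * f)
      lem₁ = ring

    Σν-ι : ∀ e v → ι e v * Σᵥ (λ u → ν v u * ι e u) + ι e v ≡ ι e v * ∥ e ∥
    Σν-ι e v = begin
      ι e v * Σᵥ (λ u → ν v u * ι e u) + ι e v             ≡⟨ cong (λ x → ι e v * Σᵥ (λ u → ν v u * ι e u) + x) (ι-idem e v) ⟨
      ι e v * Σᵥ (λ u → ν v u * ι e u) + ι e v * ι e v     ≡⟨ *-distribˡ-+ (ι e v) _ _ ⟨
      ι e v * (Σᵥ (λ u → ν v u * ι e u) + ι e v)           ≡⟨ cong (λ x → ι e v * (Σᵥ (λ u → ν v u * ι e u) + x)) (Σᵥ-δ v (ι e)) ⟨
      ι e v * (Σᵥ (λ u → ν v u * ι e u) + Σᵥ (λ u → δ v u * ι e u)) ≡⟨ cong (ι e v *_) (sym (∑-+ (verts n) _ _)) ⟩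
      ι e v * Σᵥ (λ u → ν v u * ι e u + δ v u * ι e u)     ≡⟨ cong (ι e v *_) (trans (∑-cong (verts n) (λ u → trans (sym (*-distribʳ-+ (ι e u) (ν v u) (δ v u))) (trans (cong (_* ι e u) (trans (+-comm (ν v u) (δ v u)) (δ+ν v u))) (*-identityˡ (ι e u))))) (Σᵥ-ι e)) ⟩
      ι e v * ∥ e ∥                                        ∎
      where open ≡-Reasoning

    -- Each edge through `v` has `k` further vertices and is counted once for each of them.
    Σd : ∀ v → Σᵥ (d v) ≡ k * X v
    Σd v = +-cancelʳ-≡ (X v) _ _ (begin
      Σᵥ (λ u → ν v u * Σₛ (λ e → wU e * (ι e v * ι e u))) + X v
        ≡⟨ cong (_+ X v) (trans (∑-cong (verts n) (λ u → sym (∑-*ˡ (allSubsets n) (ν v u) _))) (∑-swap (verts n) (allSubsets n) _)) ⟩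
      Σₛ (λ e → Σᵥ (λ u → ν v u * (wU e * (ι e v * ι e u)))) + X v     ≡⟨ sym (∑-+ (allSubsets n) _ _) ⟩
      Σₛ (λ e → Σᵥ (λ u → ν v u * (wU e * (ι e v * ι e u))) + wU e * ι e v) ≡⟨ ∑-cong (allSubsets n) row ⟩
      Σₛ (λ e → q * (wU e * ι e v))                                    ≡⟨ ∑-*ˡ (allSubsets n) q _ ⟩
      X v + k * X v                                                    ≡⟨ +-comm (X v) (k * X v) ⟩
      k * X v + X v                                                    ∎)
      where
      open ≡-Reasoning
      lem₁ : ∀ a b c d → a * (b * (c * d)) ≡ b * c * (a * d)
      lem₁ = ring
      lem₂ : ∀ a b c → a * b * c + a * b ≡ a * (b * c + b)
      lem₂ = ring
      lem₃ : ∀ a b c → a * (b * c) ≡ a * c * b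
      lem₃ = ring
      lem₄ : ∀ a q b → a * q * b ≡ q * (a * b)
      lem₄ = ring
      row : ∀ e → Σᵥ (λ u → ν v u * (wU e * (ι e v * ι e u))) + wU e * ι e v ≡ q * (wU e * ι e v)
      row e = begin
        Σᵥ (λ u → ν v u * (wU e * (ι e v * ι e u))) + wU e * ι e v
          ≡⟨ cong (_+ wU e * ι e v) (trans (∑-cong (verts n) (λ u → lem₁ (ν v u) (wU e) (ι e v) (ι e u))) (∑-*ˡ (verts n) (wU e * ι e v) _)) ⟩
        wU e * ι e v * Σᵥ (λ u → ν v u * ι e u) + wU e * ι e v   ≡⟨ lem₂ (wU e) (ι e v) _ ⟩
        wU e * (ι e v * Σᵥ (λ u → ν v u * ι e u) + ι e v)        ≡⟨ cong (wU e *_) (Σν-ι e v) ⟩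
        wU e * (ι e v * ∥ e ∥)                                   ≡⟨ lem₃ (wU e) (ι e v) ∥ e ∥ ⟩
        wU e * ∥ e ∥ * ι e v                                     ≡⟨ cong (_* ι e v) (wU-size e) ⟩
        wU e * q * ι e v                                         ≡⟨ lem₄ (wU e) q (ι e v) ⟩
        q * (wU e * ι e v)                                       ∎

    d≤B : ∀ v u → d v u ≤ B
    d≤B v u with ν v u in eq | iszero≤1 (δ v u)
    ... | zero        | _ = z≤n
    ... | suc zero    | _ = ≤-trans (≤-reflexive (+-identityʳ _))
          (≤-trans (∑-mono (allSubsets n) (λ e → *-monoˡ-≤ (ι e v * ι e u) (wU≤w e))) (pairs v u (subst (0 <_) (sym eq) z<s)))
    ... | suc (suc _) | s≤s ()

    d-free : ∀ v u → f u * d v u ≡ d v u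
    d-free v u = trans (lem (f u) (ν v u) _) (cong (ν v u *_) (trans (sym (∑-*ˡ (allSubsets n) (f u) _)) (∑-cong (allSubsets n) (λ e →
      trans (lem₁ (f u) (w e) (avoid e c) (ι e v) (ι e u)) (trans (cong (λ x → w e * (ι e v * x)) (avoid-free e c u)) (lem₂ (w e) (avoid e c) (ι e v) (ι e u)))))))
      where
      lem : ∀ a b c → a * (b * c) ≡ b * (a * c)
      lem = ring
      lem₁ : ∀ f w a i j → f * (w * a * (i * j)) ≡ w * (i * (a * j * f))
      lem₁ = ring
      lem₂ : ∀ w a i j → w * (i * (a * j)) ≡ w * a * (i * j)
      lem₂ = ring

    d≤ : ∀ v u → d v u ≤ B * f u
    d≤ v u = subst (_≤ B * f u) (d-free v u) (≤-trans (≤-reflexive (*-comm (f u) (d v u))) (*-monoˡ-≤ (f u) (d≤B v u)))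

    -- For `v` outside `e`, the first-order loss of weight at `v` when `e` is taken: an edge meeting
    -- `e` in several vertices is counted once for each, which keeps the expression linear in `e`.
    loss : Subset n → Fin n → ℕ
    loss e v = Σᵥ (λ u → ι e u * d v u)

    mean-loss : ∀ v → Σₛ (λ e → wU e * loss e v) ≡ Σᵥ (λ u → d v u * X u)
    mean-loss v = begin
      Σₛ (λ e → wU e * loss e v)                          ≡⟨ ∑-cong (allSubsets n) (λ e → sym (∑-*ˡ (verts n) (wU e) _)) ⟩
      Σₛ (λ e → Σᵥ (λ u → wU e * (ι e u * d v u)))        ≡⟨ ∑-swap (allSubsets n) (verts n) _ ⟩
      Σᵥ (λ u → Σₛ (λ e → wU e * (ι e u * d v u)))        ≡⟨ ∑-cong (verts n) (λ u → trans (∑-cong (allSubsets n) (λ e → lem (wU e) (ι e u) (d v u))) (∑-*ˡ (allSubsets n) (d v u) _)) ⟩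
      Σᵥ (λ u → d v u * X u)                              ∎
      where
      open ≡-Reasoning
      lem : ∀ a b c → a * (b * c) ≡ c * (a * b)
      lem = ring

    loss≤ : ∀ e → 0 < wU e → ∀ v → loss e v ≤ q * B
    loss≤ e pos v = begin
      Σᵥ (λ u → ι e u * d v u)     ≤⟨ ∑-mono (verts n) (λ u → *-monoʳ-≤ (ι e u) (d≤B v u)) ⟩
      Σᵥ (λ u → ι e u * B)         ≡⟨ ∑-*ʳ (verts n) B (ι e) ⟩
      Σᵥ (ι e) * B                 ≡⟨ cong (_* B) (trans (Σᵥ-ι e) (size e (proj₁ (*-pos⁻¹ (w e) _ pos)))) ⟩
      q * B                        ∎
      where open ≤-Reasoning

    SS≤ : t ≤ m → S * S ≤ m * Φ
    SS≤ t≤m = ≤-trans (cauchy (verts n) f (λ v → ∣ y v ∣)) (*-monoˡ-≤ Φ t≤m)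

    -- The degrees of the free vertices sum to q times the total weight, and each scaled degree
    -- falls short of its prediction by at most its deviation.
    PqH≤ : t * (D * t ^ k) ≤ P * q * H + S
    PqH≤ = begin
      t * (D * t ^ k)                                   ≡⟨ ∑-*ʳ (verts n) (D * t ^ k) f ⟨
      Σᵥ (λ v → f v * (D * t ^ k))                      ≤⟨ ∑-mono (verts n) (λ v → ≤-trans (*-monoʳ-≤ (f v) (below v)) (≤-reflexive (*-distribˡ-+ (f v) _ _))) ⟩
      Σᵥ (λ v → f v * (P * X v) + f v * ∣ y v ∣)        ≡⟨ ∑-+ (verts n) _ _ ⟩
      Σᵥ (λ v → f v * (P * X v)) + S                    ≡⟨ cong (_+ S) ΣPX ⟩
      P * q * H + S                                     ∎
      where
      open ≤-Reasoning
      lem : ∀ a b c → a * (b * c) ≡ b * (a * c)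
      lem = ring
      ΣPX : Σᵥ (λ v → f v * (P * X v)) ≡ P * q * H
      ΣPX = trans (∑-cong (verts n) (λ v → trans (lem (f v) P (X v)) (cong (P *_) (X-free v))))
        (trans (∑-*ˡ (verts n) P X) (trans (cong (P *_) ΣX) (sym (*-assoc P q H))))
      below : ∀ v → D * t ^ k ≤ P * X v + ∣ y v ∣
      below v = ℤ.drop‿+≤+ (≤-by {+ (D * t ^ k)} (y v +ᶻ + ∣ y v ∣) (lemᶻ (+ (P * X v)) (+ (D * t ^ k)) (+ ∣ y v ∣)) (0≤i+∣i∣ (y v)))
        where
        lemᶻ : ∀ a b c → a +ᶻ c ≡ b +ᶻ ((a -ᶻ b) +ᶻ c)
        lemᶻ = ringᶻ
        0≤i+∣i∣ : ∀ i → + 0 ≤ᶻ i +ᶻ + ∣ i ∣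
        0≤i+∣i∣ (+ j) = ℤB.+≤+ z≤n
        0≤i+∣i∣ (ℤB.-[1+ j ]) = ℤ.≤-reflexive (sym (ℤ.n⊖n≡0 (suc j)))

-- Mean first-order change of the potential.

module ExpectedChange where
  open FiniteSums
  open Indicators
  open NibbleArithmetic
  open SpreadWeights
  open import Data.Fin.Subset using () renaming (∣_∣ to ∥_∥)
  open import Data.Integer using (ℤ; +_; ∣_∣) renaming (_+_ to _+ᶻ_; _*_ to _*ᶻ_; _≤_ to _≤ᶻ_; -_ to -ᶻ_; _-_ to _-ᶻ_)
  import Data.Integer as ℤB
  import Data.Integer.Properties as ℤ
  open import Data.Integer.Tactic.RingSolver using () renaming (solve-∀ to ringᶻ)
  open import Data.Nat
  open import Data.Nat.Properties
  open import Data.Nat.Tactic.RingSolver using () renaming (solve-∀ to ring)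
  open import Relation.Binary.PropositionalEquality

  module Drift {n} {k′ m B C D : ℕ} {c₀ : Fin n → ℕ} {w : Subset n → ℕ} (W : SpreadWeight k′ m B C D c₀ w)
               (c : Fin n → ℕ) (r : ℕ) where
    open SpreadWeight W
    open State k′ m B D w c
    open Facts W c

    τ R : ℕ
    τ = t ^ k
    R = D * ρ q r k

    -- To first order `y` changes by minus this when `e` is taken: the loss of weight at `v` against
    -- the fall `R` of its prediction.
    z : Subset n → Fin n → ℤ
    z e v = + (P * loss e v) -ᶻ + R

    T : Fin n → ℤ
    T v = ∑ᶻ (allSubsets n) (λ e → + wU e *ᶻ z e v)

    A : Fin n → ℤ
    A v = ∑ᶻ (verts n) (λ u → + d v u *ᶻ y u)

    Y : ℤ
    Y = ∑ᶻ (verts n) (λ u → + f u *ᶻ y u)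

    T-value : ∀ v → T v ≡ + (P * Σᵥ (λ u → d v u * X u)) -ᶻ + (R * H)
    T-value v = begin
      ∑ᶻ (allSubsets n) (λ e → + wU e *ᶻ z e v)
        ≡⟨ ∑ᶻ-cong (allSubsets n) pointwise ⟩
      ∑ᶻ (allSubsets n) (λ e → + (P * (wU e * loss e v)) +ᶻ (-ᶻ + (R * wU e)))
        ≡⟨ ∑ᶻ-+ (allSubsets n) _ _ ⟩
      ∑ᶻ (allSubsets n) (λ e → + (P * (wU e * loss e v))) +ᶻ ∑ᶻ (allSubsets n) (λ e → -ᶻ + (R * wU e))
        ≡⟨ cong₂ _+ᶻ_ (∑ᶻ-pos (allSubsets n) _) (trans (∑ᶻ-neg (allSubsets n) _) (cong -ᶻ_ (∑ᶻ-pos (allSubsets n) _))) ⟩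
      + Σₛ (λ e → P * (wU e * loss e v)) -ᶻ + Σₛ (λ e → R * wU e)
        ≡⟨ cong₂ (λ a b → + a -ᶻ + b) (trans (∑-*ˡ (allSubsets n) P _) (cong (P *_) (mean-loss v))) (∑-*ˡ (allSubsets n) R wU) ⟩
      + (P * Σᵥ (λ u → d v u * X u)) -ᶻ + (R * H) ∎
      where
      open ≡-Reasoning
      lem : ∀ a p l r → a *ᶻ (p *ᶻ l -ᶻ r) ≡ p *ᶻ (a *ᶻ l) +ᶻ (-ᶻ (r *ᶻ a))
      lem = ringᶻ
      pointwise : ∀ e → + wU e *ᶻ z e v ≡ + (P * (wU e * loss e v)) +ᶻ (-ᶻ + (R * wU e))
      pointwise e = trans (cong (λ x → + wU e *ᶻ (x -ᶻ + R)) (ℤ.pos-* P (loss e v)))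
        (trans (lem (+ wU e) (+ P) (+ loss e v) (+ R))
        (cong₂ (λ x y → x +ᶻ (-ᶻ y)) (trans (cong (+ P *ᶻ_) (sym (ℤ.pos-* (wU e) (loss e v)))) (sym (ℤ.pos-* P _))) (sym (ℤ.pos-* R (wU e)))))

    PX≡ : ∀ u → + (P * X u) ≡ y u +ᶻ + (D * τ)
    PX≡ u = lem (+ (P * X u)) (+ (D * τ))
      where
      lem : ∀ a b → a ≡ (a -ᶻ b) +ᶻ b
      lem = ringᶻ

    weighted-PX : ∀ (g : Fin n → ℕ) → + (P * Σᵥ (λ u → g u * X u)) ≡ ∑ᶻ (verts n) (λ u → + g u *ᶻ y u) +ᶻ + (D * τ * Σᵥ g)
    weighted-PX g = begin
      + (P * Σᵥ (λ u → g u * X u))                              ≡⟨ cong +_ (sym (∑-*ˡ (verts n) P _)) ⟩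
      + Σᵥ (λ u → P * (g u * X u))                              ≡⟨ ∑ᶻ-pos (verts n) _ ⟨
      ∑ᶻ (verts n) (λ u → + (P * (g u * X u)))                  ≡⟨ ∑ᶻ-cong (verts n) pointwise ⟩
      ∑ᶻ (verts n) (λ u → + g u *ᶻ y u +ᶻ + (D * τ * g u))      ≡⟨ ∑ᶻ-+ (verts n) _ _ ⟩
      ∑ᶻ (verts n) (λ u → + g u *ᶻ y u) +ᶻ ∑ᶻ (verts n) (λ u → + (D * τ * g u))
        ≡⟨ cong (∑ᶻ (verts n) (λ u → + g u *ᶻ y u) +ᶻ_) (trans (∑ᶻ-pos (verts n) _) (cong +_ (∑-*ˡ (verts n) (D * τ) g))) ⟩
      ∑ᶻ (verts n) (λ u → + g u *ᶻ y u) +ᶻ + (D * τ * Σᵥ g)     ∎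
      where
      open ≡-Reasoning
      lem : ∀ a b c → a * (b * c) ≡ b * (a * c)
      lem = ring
      pointwise : ∀ u → + (P * (g u * X u)) ≡ + g u *ᶻ y u +ᶻ + (D * τ * g u)
      pointwise u = begin
        + (P * (g u * X u))                       ≡⟨ cong +_ (lem P (g u) (X u)) ⟩
        + (g u * (P * X u))                       ≡⟨ ℤ.pos-* (g u) (P * X u) ⟩
        + g u *ᶻ + (P * X u)                      ≡⟨ cong (+ g u *ᶻ_) (PX≡ u) ⟩
        + g u *ᶻ (y u +ᶻ + (D * τ))               ≡⟨ ℤ.*-distribˡ-+ (+ g u) (y u) (+ (D * τ)) ⟩
        + g u *ᶻ y u +ᶻ + g u *ᶻ + (D * τ)        ≡⟨ cong (+ g u *ᶻ y u +ᶻ_) (trans (ℤ.*-comm (+ g u) (+ (D * τ))) (sym (ℤ.pos-* (D * τ) (g u)))) ⟩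
        + g u *ᶻ y u +ᶻ + (D * τ * g u)           ∎

    ΣfX : Σᵥ (λ u → f u * X u) ≡ q * H
    ΣfX = trans (∑-cong (verts n) X-free) ΣX

    module _ (t≡ : t ≡ r + q) where
      -- What does not pull `y v` towards zero: the deviations of the vertices sharing edges with
      -- `v`, the Taylor error, and the sum of all deviations.
      b : Fin n → ℤ
      b v = + (q * P) *ᶻ A v +ᶻ + (D * D * σ q r k * τ) -ᶻ + R *ᶻ Y

      -- A vertex of too large degree has more edges to lose, so the mean loss contains a
      -- nonnegative multiple of `y v`. The ideal parts cancel, and only deviations and second-order
      -- errors remain.
      T-identity : ∀ v → + (q * P) *ᶻ T v ≡ + (q * k * (D * τ)) *ᶻ y v +ᶻ b v
      T-identity v = begin
        + (q * P) *ᶻ T v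
          ≡⟨ cong (+ (q * P) *ᶻ_) (T-value v) ⟩
        + (q * P) *ᶻ (+ (P * Σᵥ (λ u → d v u * X u)) -ᶻ + (R * H))
          ≡⟨ cong₂ (λ a b → a *ᶻ (+ (P * Σᵥ (λ u → d v u * X u)) -ᶻ b)) (ℤ.pos-* q P) (ℤ.pos-* R H) ⟩
        + q *ᶻ + P *ᶻ (+ (P * Σᵥ (λ u → d v u * X u)) -ᶻ + R *ᶻ + H)
          ≡⟨ lem₁ (+ q) (+ P) (+ (P * Σᵥ (λ u → d v u * X u))) (+ R) (+ H) ⟩
        + q *ᶻ + P *ᶻ + (P * Σᵥ (λ u → d v u * X u)) -ᶻ + R *ᶻ (+ P *ᶻ (+ q *ᶻ + H))
          ≡⟨ cong₂ (λ a b → + q *ᶻ + P *ᶻ a -ᶻ + R *ᶻ b) E₁ E₂ ⟩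
        + q *ᶻ + P *ᶻ (A v +ᶻ + (D * τ) *ᶻ (+ k *ᶻ + X v)) -ᶻ + R *ᶻ (Y +ᶻ + (D * τ) *ᶻ + t)
          ≡⟨ cong₂ (λ M R → + q *ᶻ + P *ᶻ (A v +ᶻ M *ᶻ (+ k *ᶻ + X v)) -ᶻ R *ᶻ (Y +ᶻ M *ᶻ + t)) (ℤ.pos-* D τ) (ℤ.pos-* D (ρ q r k)) ⟩
        + q *ᶻ + P *ᶻ (A v +ᶻ + D *ᶻ + τ *ᶻ (+ k *ᶻ + X v)) -ᶻ + D *ᶻ + ρ q r k *ᶻ (Y +ᶻ + D *ᶻ + τ *ᶻ + t)
          ≡⟨ lem₂ (+ q) (+ P) (A v) (+ D) (+ τ) (+ k) (+ X v) (+ ρ q r k) Y (+ t) (+ σ q r k) ⟩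
        (+ q *ᶻ + k *ᶻ (+ D *ᶻ + τ) *ᶻ (+ P *ᶻ + X v -ᶻ + D *ᶻ + τ) +ᶻ (+ q *ᶻ + P *ᶻ A v +ᶻ + D *ᶻ + D *ᶻ + σ q r k *ᶻ + τ -ᶻ + D *ᶻ + ρ q r k *ᶻ Y))
         +ᶻ + D *ᶻ + D *ᶻ + τ *ᶻ (+ k *ᶻ + q *ᶻ + τ -ᶻ (+ t *ᶻ + ρ q r k +ᶻ + σ q r k))
          ≡⟨ cong (λ x → (+ q *ᶻ + k *ᶻ (+ D *ᶻ + τ) *ᶻ (+ P *ᶻ + X v -ᶻ + D *ᶻ + τ) +ᶻ (+ q *ᶻ + P *ᶻ A v +ᶻ + D *ᶻ + D *ᶻ + σ q r k *ᶻ + τ -ᶻ + D *ᶻ + ρ q r k *ᶻ Y))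
               +ᶻ + D *ᶻ + D *ᶻ + τ *ᶻ (x -ᶻ (+ t *ᶻ + ρ q r k +ᶻ + σ q r k))) kqτ ⟩
        (+ q *ᶻ + k *ᶻ (+ D *ᶻ + τ) *ᶻ (+ P *ᶻ + X v -ᶻ + D *ᶻ + τ) +ᶻ (+ q *ᶻ + P *ᶻ A v +ᶻ + D *ᶻ + D *ᶻ + σ q r k *ᶻ + τ -ᶻ + D *ᶻ + ρ q r k *ᶻ Y))
         +ᶻ + D *ᶻ + D *ᶻ + τ *ᶻ ((+ t *ᶻ + ρ q r k +ᶻ + σ q r k) -ᶻ (+ t *ᶻ + ρ q r k +ᶻ + σ q r k))
          ≡⟨ lem₃ _ (+ D *ᶻ + D *ᶻ + τ) (+ t *ᶻ + ρ q r k +ᶻ + σ q r k) ⟩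
        + q *ᶻ + k *ᶻ (+ D *ᶻ + τ) *ᶻ (+ P *ᶻ + X v -ᶻ + D *ᶻ + τ) +ᶻ (+ q *ᶻ + P *ᶻ A v +ᶻ + D *ᶻ + D *ᶻ + σ q r k *ᶻ + τ -ᶻ + D *ᶻ + ρ q r k *ᶻ Y)
          ≡⟨ cong₂ _+ᶻ_ (cong₂ _*ᶻ_ (sym qkDτ) (sym (cong₂ _-ᶻ_ (ℤ.pos-* P (X v)) (ℤ.pos-* D τ))))
              (cong₂ _-ᶻ_ (cong₂ _+ᶻ_ (cong (_*ᶻ A v) (sym (ℤ.pos-* q P))) (sym DDστ)) (cong (_*ᶻ Y) (sym (ℤ.pos-* D (ρ q r k))))) ⟩
        + (q * k * (D * τ)) *ᶻ y v +ᶻ b v ∎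
        where
        open ≡-Reasoning
        lem₁ : ∀ q P Z R H → q *ᶻ P *ᶻ (Z -ᶻ R *ᶻ H) ≡ q *ᶻ P *ᶻ Z -ᶻ R *ᶻ (P *ᶻ (q *ᶻ H))
        lem₁ = ringᶻ
        lem₂ : ∀ q P A D τ k X ρ Y t σ → q *ᶻ P *ᶻ (A +ᶻ D *ᶻ τ *ᶻ (k *ᶻ X)) -ᶻ D *ᶻ ρ *ᶻ (Y +ᶻ D *ᶻ τ *ᶻ t) ≡
               (q *ᶻ k *ᶻ (D *ᶻ τ) *ᶻ (P *ᶻ X -ᶻ D *ᶻ τ) +ᶻ (q *ᶻ P *ᶻ A +ᶻ D *ᶻ D *ᶻ σ *ᶻ τ -ᶻ D *ᶻ ρ *ᶻ Y))
               +ᶻ D *ᶻ D *ᶻ τ *ᶻ (k *ᶻ q *ᶻ τ -ᶻ (t *ᶻ ρ +ᶻ σ))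
        lem₂ = ringᶻ
        lem₃ : ∀ a b c → a +ᶻ b *ᶻ (c -ᶻ c) ≡ a
        lem₃ = ringᶻ
        E₁ : + (P * Σᵥ (λ u → d v u * X u)) ≡ A v +ᶻ + (D * τ) *ᶻ (+ k *ᶻ + X v)
        E₁ = trans (weighted-PX (d v)) (cong (A v +ᶻ_) (trans (cong (λ x → + (D * τ * x)) (Σd v)) (trans (ℤ.pos-* (D * τ) (k * X v)) (cong (+ (D * τ) *ᶻ_) (ℤ.pos-* k (X v))))))
        E₂ : + P *ᶻ (+ q *ᶻ + H) ≡ Y +ᶻ + (D * τ) *ᶻ + t
        E₂ = trans (trans (cong (+ P *ᶻ_) (sym (ℤ.pos-* q H))) (sym (ℤ.pos-* P (q * H)))) (trans (cong (λ x → + (P * x)) (sym ΣfX)) (trans (weighted-PX f) (cong (Y +ᶻ_) (ℤ.pos-* (D * τ) t))))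
        -- The Taylor identity for the k-th power: with it the terms free of deviations cancel down
        -- to `σ`.
        kqτ : + k *ᶻ + q *ᶻ + τ ≡ + t *ᶻ + ρ q r k +ᶻ + σ q r k
        kqτ = begin
          + k *ᶻ + q *ᶻ + τ                       ≡⟨ cong (_*ᶻ + τ) (sym (ℤ.pos-* k q)) ⟩
          + (k * q) *ᶻ + τ                        ≡⟨ ℤ.pos-* (k * q) τ ⟨
          + (k * q * t ^ k)                       ≡⟨ cong (λ x → + (k * q * x ^ k)) t≡ ⟩
          + (k * q * (r + q) ^ k)                 ≡⟨ cong +_ (ρ-identity q r k) ⟨
          + ((r + q) * ρ q r k + σ q r k)         ≡⟨ cong (λ x → + (x * ρ q r k + σ q r k)) t≡ ⟨
          + (t * ρ q r k) +ᶻ + σ q r k            ≡⟨ cong (_+ᶻ + σ q r k) (ℤ.pos-* t (ρ q r k)) ⟩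
          + t *ᶻ + ρ q r k +ᶻ + σ q r k           ∎
        qkDτ : + (q * k * (D * τ)) ≡ + q *ᶻ + k *ᶻ (+ D *ᶻ + τ)
        qkDτ = trans (ℤ.pos-* (q * k) (D * τ)) (cong₂ _*ᶻ_ (ℤ.pos-* q k) (ℤ.pos-* D τ))
        DDστ : + (D * D * σ q r k * τ) ≡ + D *ᶻ + D *ᶻ + σ q r k *ᶻ + τ
        DDστ = trans (ℤ.pos-* (D * D * σ q r k) τ) (cong (_*ᶻ + τ) (trans (ℤ.pos-* (D * D) (σ q r k)) (cong (_*ᶻ + σ q r k) (ℤ.pos-* D D))))

      module _ (t≤m : t ≤ m) (kD≤mB : k * D ≤ m * B) where
        private
          0<t : 0 < r + q
          0<t = ≤-trans z<s (m≤n+m q r)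
          r+q≤m : r + q ≤ m
          r+q≤m = subst (_≤ m) t≡ t≤m

        R≤ : R ≤ q * s
        R≤ = Dρ≤ q r k′ m D B r+q≤m 0<t kD≤mB

        ∣A∣≤ : ∀ v → ∣ A v ∣ ≤ B * S
        ∣A∣≤ v = begin
          ∣ A v ∣                                  ≤⟨ ∣∑ᶻ∣≤ (verts n) _ ⟩
          Σᵥ (λ u → ∣ + d v u *ᶻ y u ∣)            ≡⟨ ∑-cong (verts n) (λ u → ℤ.∣i*j∣≡∣i∣*∣j∣ (+ d v u) (y u)) ⟩
          Σᵥ (λ u → d v u * ∣ y u ∣)               ≤⟨ ∑-mono (verts n) (λ u → *-monoˡ-≤ ∣ y u ∣ (d≤ v u)) ⟩
          Σᵥ (λ u → B * f u * ∣ y u ∣)             ≡⟨ trans (∑-cong (verts n) (λ u → *-assoc B (f u) ∣ y u ∣)) (∑-*ˡ (verts n) B _) ⟩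
          B * S                                    ∎
          where open ≤-Reasoning

        ∣Y∣≤ : ∣ Y ∣ ≤ S
        ∣Y∣≤ = ≤-trans (∣∑ᶻ∣≤ (verts n) _) (≤-reflexive (∑-cong (verts n) (λ u → ℤ.∣i*j∣≡∣i∣*∣j∣ (+ f u) (y u))))

        β : ℕ
        β = 2 * (q * s * S) + q * q * m * (s * s)

        ∣b∣≤ : ∀ v → ∣ b v ∣ ≤ β
        ∣b∣≤ v = begin
          ∣ b v ∣                                                          ≤⟨ ℤ.∣i-j∣≤∣i∣+∣j∣ (+ (q * P) *ᶻ A v +ᶻ + (D * D * σ q r k * τ)) (+ R *ᶻ Y) ⟩
          ∣ + (q * P) *ᶻ A v +ᶻ + (D * D * σ q r k * τ) ∣ + ∣ + R *ᶻ Y ∣    ≤⟨ +-monoˡ-≤ ∣ + R *ᶻ Y ∣ (ℤ.∣i+j∣≤∣i∣+∣j∣ (+ (q * P) *ᶻ A v) (+ (D * D * σ q r k * τ))) ⟩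
          ∣ + (q * P) *ᶻ A v ∣ + D * D * σ q r k * τ + ∣ + R *ᶻ Y ∣         ≡⟨ cong₂ (λ a b → a + D * D * σ q r k * τ + b) (ℤ.∣i*j∣≡∣i∣*∣j∣ (+ (q * P)) (A v)) (ℤ.∣i*j∣≡∣i∣*∣j∣ (+ R) Y) ⟩
          q * P * ∣ A v ∣ + D * D * σ q r k * τ + R * ∣ Y ∣
            ≤⟨ +-mono-≤ (+-mono-≤ (*-monoʳ-≤ (q * P) (∣A∣≤ v)) (subst (λ x → D * D * σ q r k * x ^ k ≤ q * q * m * (s * s)) (sym t≡) (D²σ≤ q r k′ m D B r+q≤m 0<t kD≤mB))) (*-mono-≤ R≤ ∣Y∣≤) ⟩
          q * P * (B * S) + q * q * m * (s * s) + q * s * S                ≡⟨ lem q P B S (q * q * m * (s * s)) ⟩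
          β                                                                ∎
          where
          open ≤-Reasoning
          lem : ∀ q P B S x → q * P * (B * S) + x + q * (P * B) * S ≡ 2 * (q * (P * B) * S) + x
          lem = ring

        -- First-order change of the potential when `e` is taken, over the vertices that are free
        -- before the step.
        g : Subset n → ℤ
        g e = ∑ᶻ (verts n) (λ v → + f v *ᶻ (-ᶻ (+ 2 *ᶻ (y v *ᶻ z e v))))

        Γ : ℤ
        Γ = ∑ᶻ (allSubsets n) (λ e → + wU e *ᶻ g e)

        Γ-value : Γ ≡ ∑ᶻ (verts n) (λ v → + f v *ᶻ (-ᶻ (+ 2 *ᶻ (y v *ᶻ T v))))
        Γ-value = begin
          ∑ᶻ (allSubsets n) (λ e → + wU e *ᶻ g e)
            ≡⟨ ∑ᶻ-cong (allSubsets n) (λ e → sym (∑ᶻ-*ˡ (verts n) (+ wU e) _)) ⟩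
          ∑ᶻ (allSubsets n) (λ e → ∑ᶻ (verts n) (λ v → + wU e *ᶻ (+ f v *ᶻ (-ᶻ (+ 2 *ᶻ (y v *ᶻ z e v))))))
            ≡⟨ ∑ᶻ-swap (allSubsets n) (verts n) _ ⟩
          ∑ᶻ (verts n) (λ v → ∑ᶻ (allSubsets n) (λ e → + wU e *ᶻ (+ f v *ᶻ (-ᶻ (+ 2 *ᶻ (y v *ᶻ z e v))))))
            ≡⟨ ∑ᶻ-cong (verts n) (λ v → trans (∑ᶻ-cong (allSubsets n) (λ e → lem (+ wU e) (+ f v) (y v) (z e v)))
                 (trans (∑ᶻ-*ˡ (allSubsets n) (-ᶻ (+ 2 *ᶻ (+ f v *ᶻ y v))) _) (lem₂ (+ f v) (y v) (T v)))) ⟩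
          ∑ᶻ (verts n) (λ v → + f v *ᶻ (-ᶻ (+ 2 *ᶻ (y v *ᶻ T v)))) ∎
          where
          open ≡-Reasoning
          lem : ∀ w f y z → w *ᶻ (f *ᶻ (-ᶻ (+ 2 *ᶻ (y *ᶻ z)))) ≡ (-ᶻ (+ 2 *ᶻ (f *ᶻ y))) *ᶻ (w *ᶻ z)
          lem = ringᶻ
          lem₂ : ∀ f y T → (-ᶻ (+ 2 *ᶻ (f *ᶻ y))) *ᶻ T ≡ f *ᶻ (-ᶻ (+ 2 *ᶻ (y *ᶻ T)))
          lem₂ = ringᶻ

        -- Averaging puts `T` in place of `z`; `drift` discards the part of `T` proportional to `y`,
        -- and the rest costs at most twice `β` times the sum `S` of the deviations.
        Γ≤ : + (q * P) *ᶻ Γ ≤ᶻ + (5 * (q * q) * s * (m * Φ + m * m * (s * s)))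
        Γ≤ = begin
          + (q * P) *ᶻ Γ                                                     ≡⟨ cong (+ (q * P) *ᶻ_) Γ-value ⟩
          + (q * P) *ᶻ ∑ᶻ (verts n) (λ v → + f v *ᶻ (-ᶻ (+ 2 *ᶻ (y v *ᶻ T v)))) ≡⟨ ∑ᶻ-*ˡ (verts n) (+ (q * P)) _ ⟨
          ∑ᶻ (verts n) (λ v → + (q * P) *ᶻ (+ f v *ᶻ (-ᶻ (+ 2 *ᶻ (y v *ᶻ T v))))) ≤⟨ ∑ᶻ-mono (verts n) pointwise ⟩
          ∑ᶻ (verts n) (λ v → + (2 * (f v * ∣ y v ∣ * β)))                    ≡⟨ ∑ᶻ-pos (verts n) _ ⟩
          + Σᵥ (λ v → 2 * (f v * ∣ y v ∣ * β))                                ≡⟨ cong +_ (trans (∑-*ˡ (verts n) 2 _) (cong (2 *_) (∑-*ʳ (verts n) β _))) ⟩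
          + (2 * (S * β))                                                     ≤⟨ ℤB.+≤+ (Γ-arith q s m S Φ (s≤s z≤n) (SS≤ t≤m)) ⟩
          + (5 * (q * q) * s * (m * Φ + m * m * (s * s)))                     ∎
          where
          open ℤ.≤-Reasoning
          lem : ∀ a f x → a *ᶻ (f *ᶻ x) ≡ f *ᶻ (a *ᶻ x)
          lem = ringᶻ
          lem₂ : ∀ f y b → f * (2 * (y * b)) ≡ 2 * (f * y * b)
          lem₂ = ring
          pointwise : ∀ v → + (q * P) *ᶻ (+ f v *ᶻ (-ᶻ (+ 2 *ᶻ (y v *ᶻ T v)))) ≤ᶻ + (2 * (f v * ∣ y v ∣ * β))
          pointwise v = begin
            + (q * P) *ᶻ (+ f v *ᶻ (-ᶻ (+ 2 *ᶻ (y v *ᶻ T v)))) ≡⟨ lem (+ (q * P)) (+ f v) _ ⟩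
            + f v *ᶻ (+ (q * P) *ᶻ (-ᶻ (+ 2 *ᶻ (y v *ᶻ T v)))) ≤⟨ ℤ.*-monoˡ-≤-nonNeg (+ f v) (drift (q * P) (q * k * (D * τ)) β (y v) (b v) (T v) (T-identity v) (∣b∣≤ v)) ⟩
            + f v *ᶻ + (2 * (∣ y v ∣ * β))                     ≡⟨ ℤ.pos-* (f v) _ ⟨
            + (f v * (2 * (∣ y v ∣ * β)))                      ≡⟨ cong +_ (lem₂ (f v) ∣ y v ∣ β) ⟩
            + (2 * (f v * ∣ y v ∣ * β))                        ∎

-- Second-order errors when a single edge is taken.

module StepUpdate where
  open FiniteSums
  open Indicators
  open Covers
  open NibbleArithmetic
  open SpreadWeights
  open ExpectedChange
  open import Data.Fin.Subset using () renaming (∣_∣ to ∥_∥)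
  open import Data.Integer using (ℤ; +_; ∣_∣) renaming (_+_ to _+ᶻ_; _*_ to _*ᶻ_; _≤_ to _≤ᶻ_; -_ to -ᶻ_; _-_ to _-ᶻ_)
  import Data.Integer as ℤB
  import Data.Integer.Properties as ℤ
  open import Data.Integer.Tactic.RingSolver using () renaming (solve-∀ to ringᶻ)
  open import Data.Nat
  open import Data.Nat.Properties
  open import Data.Nat.Tactic.RingSolver using () renaming (solve-∀ to ring)
  open import Relation.Binary.PropositionalEquality

  open import Data.Vec using (lookup)

  -- The excess b - 1 of a multiple count is at most the number b (b - 1) of ordered pairs of
  -- distinct elements, and pairs can be fed into the bound on triples.
  pairs-count : ∀ {n} (a : Fin n → ℕ) → (∀ u → a u * a u ≡ a u) →
                Σᵥ a ∸ 1 ≤ Σᵥ (λ u → Σᵥ (λ x → ν u x * (a u * a x)))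
  pairs-count {n} a idem = +-cancelʳ-≤ b _ _ (≤-trans (lem b) (≤-reflexive (sym total)))
    where
    b = Σᵥ a
    lem : ∀ b → b ∸ 1 + b ≤ b * b
    lem zero    = z≤n
    lem (suc j) = ≤-trans (≤-reflexive (+-comm j (suc j))) (+-monoʳ-≤ (suc j) (≤-trans (≤-reflexive (sym (*-identityʳ j))) (*-monoʳ-≤ j (s≤s z≤n))))
    open ≡-Reasoning
    total : Σᵥ (λ u → Σᵥ (λ x → ν u x * (a u * a x))) + b ≡ b * b
    total = begin
      Σᵥ (λ u → Σᵥ (λ x → ν u x * (a u * a x))) + Σᵥ a
        ≡⟨ ∑-+ (verts n) _ a ⟨
      Σᵥ (λ u → Σᵥ (λ x → ν u x * (a u * a x)) + a u)
        ≡⟨ ∑-cong (verts n) (λ u → cong (λ y → Σᵥ (λ x → ν u x * (a u * a x)) + y) (sym (trans (Σᵥ-δ u (λ x → a u * a x)) (idem u)))) ⟩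
      Σᵥ (λ u → Σᵥ (λ x → ν u x * (a u * a x)) + Σᵥ (λ x → δ u x * (a u * a x)))
        ≡⟨ ∑-cong (verts n) (λ u → trans (sym (∑-+ (verts n) _ _)) (trans (∑-cong (verts n) (λ x → trans (sym (*-distribʳ-+ (a u * a x) (ν u x) (δ u x)))
             (trans (cong (_* (a u * a x)) (trans (+-comm (ν u x) (δ u x)) (δ+ν u x))) (*-identityˡ _)))) (∑-*ˡ (verts n) (a u) a))) ⟩
      Σᵥ (λ u → a u * b)   ≡⟨ ∑-*ʳ (verts n) b a ⟩
      b * b                ∎

  ∉⇒ν : ∀ {n} (e : Subset n) v u → ι e v ≡ 0 → 0 < ι e u → 0 < ν v u
  ∉⇒ν e v u v∉e u∈e with δ v u in eq
  ... | zero  = z<s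
  ... | suc j with δ-≡ v u (subst (0 <_) (sym eq) z<s)
  ...   | refl = contradiction v∉e (m<n⇒n≢0 u∈e)

  module Update {n} {k′ m B C D : ℕ} {c₀ : Fin n → ℕ} {w : Subset n → ℕ} (W : SpreadWeight k′ m B C D c₀ w)
                (c : Fin n → ℕ) (r : ℕ) (e : Subset n) where
    open SpreadWeight W
    open State k′ m B D w c
    open Facts W c
    open Drift W c r
    private
      module S′ = State k′ m B D w (c ⊕ e)

    wU⇒∥e∥ : 0 < wU e → ∥ e ∥ ≡ q
    wU⇒∥e∥ pos = size e (proj₁ (*-pos⁻¹ (w e) _ pos))

    module _ (t≡ : t ≡ r + q) (t≤m : t ≤ m) (kD≤mB : k * D ≤ m * B) (pos : 0 < wU e) where
      common : Subset n → ℕ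
      common g = meet g (ι e)

      err : Fin n → ℕ
      err v = Σₛ (λ g → wU g * ι g v * (common g ∸ 1))

      t′≡r : S′.t ≡ r
      t′≡r = +-cancelʳ-≡ q _ _ (trans (cong (λ x → S′.t + x) (sym (wU⇒∥e∥ pos)))
        (trans (sym (free-⊕ c e (proj₂ (*-pos⁻¹ (w e) _ pos)))) t≡))

      loss-split : ∀ v → ι e v ≡ 0 → Σₛ (λ g → wU g * ι g v * common g) ≡ loss e v
      loss-split v v∉e = begin
        Σₛ (λ g → wU g * ι g v * common g)                              ≡⟨ ∑-cong (allSubsets n) (λ g → sym (∑-*ˡ (verts n) (wU g * ι g v) _)) ⟩
        Σₛ (λ g → Σᵥ (λ u → wU g * ι g v * (ι g u * ι e u)))             ≡⟨ ∑-swap (allSubsets n) (verts n) _ ⟩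
        Σᵥ (λ u → Σₛ (λ g → wU g * ι g v * (ι g u * ι e u)))             ≡⟨ ∑-cong (verts n) (λ u → trans (∑-cong (allSubsets n) (λ g → lem (wU g) (ι g v) (ι g u) (ι e u))) (∑-*ˡ (allSubsets n) (ι e u) _)) ⟩
        Σᵥ (λ u → ι e u * Σₛ (λ g → wU g * (ι g v * ι g u)))             ≡⟨ ∑-cong (verts n) off-diagonal ⟩
        loss e v                                                         ∎
        where
        open ≡-Reasoning
        lem : ∀ a b c d → a * b * (c * d) ≡ d * (a * (b * c))
        lem = ring
        off-diagonal : ∀ u → ι e u * Σₛ (λ g → wU g * (ι g v * ι g u)) ≡ ι e u * d v u
        off-diagonal u = ≤1-cases (ι e u) (ι≤1 e u)
          (λ u∉e → trans (cong (_* Σₛ (λ g → wU g * (ι g v * ι g u))) u∉e) (sym (cong (_* d v u) u∉e)))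
          (λ u∈e → cong (ι e u *_) (≤1-cases (ν v u) (iszero≤1 (δ v u))
            (λ ν≡0 → contradiction ν≡0 (m<n⇒n≢0 (∉⇒ν e v u v∉e (subst (0 <_) (sym u∈e) z<s))))
            (λ ν≡1 → sym (trans (cong (_* Σₛ (λ g → wU g * (ι g v * ι g u))) ν≡1) (*-identityˡ _)))))

      -- `loss` counts an edge once per vertex shared with `e`, but the edge is lost only once;
      -- `err` gives the excess back.
      X-split : ∀ v → ι e v ≡ 0 → S′.X v + loss e v ≡ X v + err v
      X-split v v∉e = begin
        S′.X v + loss e v                                      ≡⟨ cong (λ x → S′.X v + x) (loss-split v v∉e) ⟨
        S′.X v + Σₛ (λ g → wU g * ι g v * common g)           ≡⟨ ∑-+ (allSubsets n) _ _ ⟨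
        Σₛ (λ g → S′.wU g * ι g v + wU g * ι g v * common g)  ≡⟨ ∑-cong (allSubsets n) pointwise ⟩
        Σₛ (λ g → wU g * ι g v + wU g * ι g v * (common g ∸ 1)) ≡⟨ ∑-+ (allSubsets n) _ _ ⟩
        X v + err v                                            ∎
        where
        open ≡-Reasoning
        lem : ∀ a i z o → a * z * i + a * i * o ≡ a * i * (z + o)
        lem = ring
        lem₂ : ∀ a o → a * (1 + o) ≡ a + a * o
        lem₂ = ring
        iszero+ : ∀ o → iszero o + o ≡ 1 + (o ∸ 1)
        iszero+ zero    = refl
        iszero+ (suc o) = refl
        pointwise : ∀ g → S′.wU g * ι g v + wU g * ι g v * common g ≡ wU g * ι g v + wU g * ι g v * (common g ∸ 1)
        pointwise g = begin
          w g * avoid g (c ⊕ e) * ι g v + wU g * ι g v * common g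
            ≡⟨ cong (λ x → x * ι g v + wU g * ι g v * common g) (trans (cong (w g *_) (avoid-⊕ g c e)) (sym (*-assoc (w g) (avoid g c) _))) ⟩
          wU g * iszero (common g) * ι g v + wU g * ι g v * common g  ≡⟨ lem (wU g) (ι g v) (iszero (common g)) (common g) ⟩
          wU g * ι g v * (iszero (common g) + common g)               ≡⟨ cong (wU g * ι g v *_) (iszero+ (common g)) ⟩
          wU g * ι g v * (1 + (common g ∸ 1))                          ≡⟨ lem₂ (wU g * ι g v) (common g ∸ 1) ⟩
          wU g * ι g v + wU g * ι g v * (common g ∸ 1)                 ∎

      -- The excess is charged to two distinct vertices `u`, `x` of `e` that lie with `v` in a
      -- common edge. There are at most q² such pairs, and each triple carries weight at most B / m.
      err≤ : ∀ v → ι e v ≡ 0 → m * err v ≤ q * q * B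
      err≤ v v∉e = begin
        m * Σₛ (λ g → wU g * ι g v * (common g ∸ 1))
          ≤⟨ *-monoʳ-≤ m (∑-mono (allSubsets n) (λ g → *-monoʳ-≤ (wU g * ι g v) (pairs-count (λ u → ι g u * ι e u) (idem g)))) ⟩
        m * Σₛ (λ g → wU g * ι g v * Σᵥ (λ u → Σᵥ (λ x → ν u x * (ι g u * ι e u * (ι g x * ι e x)))))
          ≡⟨ cong (m *_) rearrange ⟩
        m * Σᵥ (λ u → Σᵥ (λ x → ν u x * (ι e u * ι e x) * Z u x))
          ≡⟨ trans (sym (∑-*ˡ (verts n) m _)) (∑-cong (verts n) (λ u → sym (∑-*ˡ (verts n) m _))) ⟩
        Σᵥ (λ u → Σᵥ (λ x → m * (ν u x * (ι e u * ι e x) * Z u x)))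
          ≤⟨ ∑-mono (verts n) (λ u → ∑-mono (verts n) (λ x → cell u x)) ⟩
        Σᵥ (λ u → Σᵥ (λ x → ι e u * (ι e x * B)))
          ≡⟨ ∑-cong (verts n) (λ u → trans (∑-*ˡ (verts n) (ι e u) _) (cong (ι e u *_) (∑-*ʳ (verts n) B (ι e)))) ⟩
        Σᵥ (λ u → ι e u * (Σᵥ (ι e) * B))     ≡⟨ ∑-*ʳ (verts n) (Σᵥ (ι e) * B) (ι e) ⟩
        Σᵥ (ι e) * (Σᵥ (ι e) * B)             ≡⟨ cong (λ x → x * (x * B)) (trans (Σᵥ-ι e) (wU⇒∥e∥ pos)) ⟩
        q * (q * B)                           ≡⟨ *-assoc q q B ⟨
        q * q * B                             ∎
        where
        open ≤-Reasoning
        Z : Fin n → Fin n → ℕ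
        Z u x = Σₛ (λ g → wU g * (ι g v * ι g u * ι g x))
        lem-idem : ∀ a b → a * b * (a * b) ≡ a * a * (b * b)
        lem-idem = ring
        idem : ∀ g u → ι g u * ι e u * (ι g u * ι e u) ≡ ι g u * ι e u
        idem g u = trans (lem-idem (ι g u) (ι e u)) (cong₂ _*_ (ι-idem g u) (ι-idem e u))
        lem : ∀ w i n a b a′ b′ → w * i * (n * (a * b * (a′ * b′))) ≡ n * (b * b′) * (w * (i * a * a′))
        lem = ring
        rearrange : Σₛ (λ g → wU g * ι g v * Σᵥ (λ u → Σᵥ (λ x → ν u x * (ι g u * ι e u * (ι g x * ι e x))))) ≡
                    Σᵥ (λ u → Σᵥ (λ x → ν u x * (ι e u * ι e x) * Z u x))
        rearrange =
          trans (∑-cong (allSubsets n) (λ g → trans (sym (∑-*ˡ (verts n) (wU g * ι g v) _)) (∑-cong (verts n) (λ u → sym (∑-*ˡ (verts n) (wU g * ι g v) _)))))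
          (trans (∑-swap (allSubsets n) (verts n) _)
          (∑-cong (verts n) (λ u → trans (∑-swap (allSubsets n) (verts n) _)
          (∑-cong (verts n) (λ x → trans (∑-cong (allSubsets n) (λ g → lem (wU g) (ι g v) (ν u x) (ι g u) (ι e u) (ι g x) (ι e x)))
            (∑-*ˡ (allSubsets n) (ν u x * (ι e u * ι e x)) _))))))
        1⇒ : ∀ {a} → a ≡ 1 → 0 < a
        1⇒ refl = z<s
        cell : ∀ u x → m * (ν u x * (ι e u * ι e x) * Z u x) ≤ ι e u * (ι e x * B)
        cell u x = ≤1-cases (ν u x) (iszero≤1 (δ u x))
          (λ ν≡0 → ≤-trans (≤-reflexive (trans (cong (λ a → m * (a * (ι e u * ι e x) * Z u x)) ν≡0) (*-zeroʳ m))) z≤n)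
          λ ν≡1 → ≤1-cases (ι e u) (ι≤1 e u)
          (λ u∉ → ≤-trans (≤-reflexive (trans (cong (λ a → m * (ν u x * (a * ι e x) * Z u x)) u∉) (lem₀ m (ν u x) (Z u x)))) z≤n)
          λ u∈ → ≤1-cases (ι e x) (ι≤1 e x)
          (λ x∉ → ≤-trans (≤-reflexive (trans (cong (λ a → m * (ν u x * (ι e u * a) * Z u x)) x∉) (lem₀′ m (ν u x) (ι e u) (Z u x)))) z≤n)
          λ x∈ → ≤-trans (≤-reflexive (trans (cong (λ a → m * (a * Z u x)) (cong₂ _*_ ν≡1 (cong₂ _*_ u∈ x∈))) (cong (m *_) (*-identityˡ (Z u x)))))
            (≤-trans (*-monoʳ-≤ m (∑-mono (allSubsets n) (λ g → *-monoˡ-≤ _ (wU≤w g))))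
            (≤-trans (triples v u x (∉⇒ν e v u v∉e (1⇒ u∈)) (∉⇒ν e v x v∉e (1⇒ x∈)) (1⇒ ν≡1))
            (≤-reflexive (sym (trans (cong₂ (λ a b → a * (b * B)) u∈ x∈) (lem₁ B))))))
          where
          lem₀ : ∀ m v z → m * (v * 0 * z) ≡ 0
          lem₀ = ring
          lem₀′ : ∀ m v i z → m * (v * (i * 0) * z) ≡ 0
          lem₀′ = ring
          lem₁ : ∀ b → 1 * (1 * b) ≡ b
          lem₁ = ring

      y-update : ∀ v → ι e v ≡ 0 → S′.y v ≡ y v -ᶻ z e v +ᶻ + (P * err v)
      y-update v v∉e = begin
        + (P * S′.X v) -ᶻ + (D * S′.t ^ k)
          ≡⟨ cong (λ x → + (P * S′.X v) -ᶻ + (D * x ^ k)) t′≡r ⟩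
        + (P * S′.X v) -ᶻ + (D * r ^ k)
          ≡⟨ lem (+ (P * S′.X v)) (+ (P * loss e v)) (+ (D * r ^ k)) (+ R) ⟩
        (+ (P * S′.X v) +ᶻ + (P * loss e v)) -ᶻ (+ (D * r ^ k) +ᶻ + R) -ᶻ (+ (P * loss e v) -ᶻ + R)
          ≡⟨ cong₂ (λ a b → + a -ᶻ + b -ᶻ z e v) PX-split (trans (sym (*-distribˡ-+ D (r ^ k) (ρ q r k))) (trans (cong (D *_) (r^k+ρ q r k)) (cong (λ x → D * x ^ k) (sym t≡)))) ⟩
        + (P * X v + P * err v) -ᶻ + (D * t ^ k) -ᶻ z e v
          ≡⟨ lem₂ (+ (P * X v)) (+ (P * err v)) (+ (D * t ^ k)) (z e v) ⟩
        y v -ᶻ z e v +ᶻ + (P * err v) ∎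
        where
        open ≡-Reasoning
        lem : ∀ x l d r → x -ᶻ d ≡ (x +ᶻ l) -ᶻ (d +ᶻ r) -ᶻ (l -ᶻ r)
        lem = ringᶻ
        lem₂ : ∀ x e d z → x +ᶻ e -ᶻ d -ᶻ z ≡ x -ᶻ d -ᶻ z +ᶻ e
        lem₂ = ringᶻ
        PX-split : P * S′.X v + P * loss e v ≡ P * X v + P * err v
        PX-split = trans (sym (*-distribˡ-+ P _ _)) (trans (cong (P *_) (X-split v v∉e)) (*-distribˡ-+ P _ _))

      ∣z∣≤ : ∀ v → ∣ z e v ∣ ≤ q * s
      ∣z∣≤ v = ∣a-b∣≤ (P * loss e v) R (q * s) (≤-trans (*-monoʳ-≤ P (loss≤ e pos v)) (≤-reflexive (lem P q B))) (R≤ t≡ t≤m kD≤mB)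
        where
        lem : ∀ P q B → P * (q * B) ≡ q * (P * B)
        lem = ring

      K : ℕ
      K = m * (5 * (q * q * (q * q)) * (s * s))

      RHS : Fin n → ℤ
      RHS v = (+ (m + 2 * (q * q)) *ᶻ (y v *ᶻ y v) +ᶻ + m *ᶻ (-ᶻ (+ 2 *ᶻ (y v *ᶻ z e v)))) +ᶻ + K

      -- The vertices of `e` leave the potential; at these the update needs no more than a
      -- nonnegative right side, which `square-update` without error term provides.
      0≤RHS : ∀ v → + 0 ≤ᶻ RHS v
      0≤RHS v = ℤ.≤-trans (ℤ.≤-trans (ℤ.≤-reflexive (sym (ℤ.*-zeroʳ (+ m)))) (ℤ.*-monoˡ-≤-nonNeg (+ m) (0≤y*y (y v -ᶻ z e v +ᶻ + 0))))
        (square-update m s q 0 (y v) (z e v) 0<m (≤-trans (≤-reflexive (*-zeroʳ m)) z≤n) (∣z∣≤ v) (s≤s z≤n))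

      pointwise : ∀ v → + (m * (co e v * sq (S′.y v))) ≤ᶻ RHS v
      pointwise v with lookup e v in eq
      ... | true  = ℤ.≤-trans (ℤ.≤-reflexive (cong +_ (*-zeroʳ m))) (0≤RHS v)
      ... | false = ℤ.≤-trans (ℤ.≤-reflexive (trans (cong (λ x → + (m * x)) (*-identityˡ (sq (S′.y v)))) (trans (ℤ.pos-* m (sq (S′.y v)))
              (cong (+ m *ᶻ_) (trans (+sq (S′.y v)) (cong (λ x → x *ᶻ x) (y-update v v∉e)))))))
            (square-update m s q (P * err v) (y v) (z e v) 0<m (≤-trans (≤-reflexive (lem m P (err v))) (≤-trans (*-monoʳ-≤ P (err≤ v v∉e)) (≤-reflexive (lem₂ P q B)))) (∣z∣≤ v) (s≤s z≤n))
        where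
        v∉e : ι e v ≡ 0
        v∉e = cong 𝟙 eq
        lem : ∀ m P x → m * (P * x) ≡ P * (m * x)
        lem = ring
        lem₂ : ∀ P q B → P * (q * q * B) ≡ q * q * (P * B)
        lem₂ = ring

      update : + (m * S′.Φ) ≤ᶻ + ((m + 2 * (q * q)) * Φ) +ᶻ + m *ᶻ g t≡ t≤m kD≤mB e +ᶻ + (m * K)
      update = begin
        + (m * S′.Φ)                                                    ≡⟨ cong +_ (sym (∑-*ˡ (verts n) m _)) ⟩
        + Σᵥ (λ v → m * (S′.f v * sq (S′.y v)))                         ≡⟨ ∑ᶻ-pos (verts n) _ ⟨
        ∑ᶻ (verts n) (λ v → + (m * (S′.f v * sq (S′.y v))))             ≡⟨ ∑ᶻ-cong (verts n) split ⟩
        ∑ᶻ (verts n) (λ v → + f v *ᶻ + (m * (co e v * sq (S′.y v))))    ≤⟨ ∑ᶻ-mono (verts n) (λ v → ℤ.*-monoˡ-≤-nonNeg (+ f v) (pointwise v)) ⟩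
        ∑ᶻ (verts n) (λ v → + f v *ᶻ RHS v)                             ≡⟨ ∑ᶻ-cong (verts n) (λ v → trans (lem (+ f v) (+ M) (y v) (+ m) _ (+ K)) (cong₂ _+ᶻ_ (cong (λ x → + M *ᶻ x +ᶻ + m *ᶻ (+ f v *ᶻ (-ᶻ (+ 2 *ᶻ (y v *ᶻ z e v))))) (trans (cong (+ f v *ᶻ_) (sym (+sq (y v)))) (sym (ℤ.pos-* (f v) (sq (y v)))))) (sym (ℤ.pos-* K (f v))))) ⟩
        ∑ᶻ (verts n) (λ v → (+ M *ᶻ + (f v * sq (y v)) +ᶻ + m *ᶻ (+ f v *ᶻ (-ᶻ (+ 2 *ᶻ (y v *ᶻ z e v))))) +ᶻ + (K * f v))
          ≡⟨ trans (∑ᶻ-+ (verts n) _ _) (cong₂ _+ᶻ_ (trans (∑ᶻ-+ (verts n) _ _) (cong₂ _+ᶻ_ (trans (∑ᶻ-*ˡ (verts n) (+ M) _) (cong (+ M *ᶻ_) (∑ᶻ-pos (verts n) _))) (∑ᶻ-*ˡ (verts n) (+ m) _))) (trans (∑ᶻ-pos (verts n) _) (cong +_ (∑-*ˡ (verts n) K f)))) ⟩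
        (+ M *ᶻ + Φ +ᶻ + m *ᶻ g t≡ t≤m kD≤mB e) +ᶻ + (K * t)            ≤⟨ ℤ.+-mono-≤ (ℤ.+-monoˡ-≤ _ (ℤ.≤-reflexive (sym (ℤ.pos-* M Φ)))) (ℤB.+≤+ (≤-trans (*-monoʳ-≤ K t≤m) (≤-reflexive (*-comm K m)))) ⟩
        + (M * Φ) +ᶻ + m *ᶻ g t≡ t≤m kD≤mB e +ᶻ + (m * K)               ∎
        where
        open ℤ.≤-Reasoning
        M = m + 2 * (q * q)
        lem : ∀ f M y m h K → f *ᶻ ((M *ᶻ (y *ᶻ y) +ᶻ m *ᶻ h) +ᶻ K) ≡ (M *ᶻ (f *ᶻ (y *ᶻ y)) +ᶻ m *ᶻ (f *ᶻ h)) +ᶻ K *ᶻ f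
        lem = ringᶻ
        lem₂ : ∀ m f c x → m * (f * c * x) ≡ f * (m * (c * x))
        lem₂ = ring
        split : ∀ v → + (m * (S′.f v * sq (S′.y v))) ≡ + f v *ᶻ + (m * (co e v * sq (S′.y v)))
        split v = trans (cong (λ x → + (m * (x * sq (S′.y v)))) (trans (iszero-+ (c v) (ι e v)) (cong (f v *_) (iszero-ι e v))))
          (trans (cong +_ (lem₂ m (f v) (co e v) (sq (S′.y v)))) (ℤ.pos-* (f v) _))

-- The derandomised nibble.

module GreedyMatching where
  open FiniteSums
  open Indicators
  open Covers
  open NibbleArithmetic
  open SpreadWeights
  open ExpectedChange
  open StepUpdate
  open import Data.Fin.Subset using () renaming (∣_∣ to ∥_∥)
  open import Data.Integer using (ℤ; +_) renaming (_+_ to _+ᶻ_; _*_ to _*ᶻ_; _≤_ to _≤ᶻ_; -_ to -ᶻ_; _-_ to _-ᶻ_)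
  import Data.Integer as ℤB
  import Data.Integer.Properties as ℤ
  open import Data.Integer.Tactic.RingSolver using () renaming (solve-∀ to ringᶻ)
  open import Data.List.Relation.Unary.All using (All; []; _∷_)
  open import Data.Nat
  open import Data.Nat.Properties
  open import Data.Nat.Tactic.RingSolver using () renaming (solve-∀ to ring)
  open import Relation.Binary.PropositionalEquality

  free-+cover : ∀ {n} (c : Fin n → ℕ) e N v → (c ⊕ e) v + cover N v ≡ c v + cover (e ∷ N) v
  free-+cover c e N v = +-assoc (c v) (ι e v) (cover N v)

  ⊕≤1 : ∀ {n} (c : Fin n → ℕ) e → 0 < avoid e c → (∀ v → c v ≤ 1) → ∀ v → (c ⊕ e) v ≤ 1
  ⊕≤1 c e av c≤1 v = ≤1-cases (ι e v) (ι≤1 e v)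
    (λ ∉e → subst (λ x → c v + x ≤ 1) (sym ∉e) (subst (_≤ 1) (sym (+-identityʳ (c v))) (c≤1 v)))
    (λ ∈e → subst (λ x → x + ι e v ≤ 1) (sym (avoid⇒c≡0 e c v av (subst (0 <_) (sym ∈e) z<s))) (ι≤1 e v))

  module Greedy {n} {k′ m B C D : ℕ} {c₀ : Fin n → ℕ} {w : Subset n → ℕ} (W : SpreadWeight k′ m B C D c₀ w) (E : ℕ) where
    open SpreadWeight W
    private
      module S (c : Fin n → ℕ) = State k′ m B D w c
      k q s L step bound M : ℕ
      k = suc k′
      q = suc k
      s = m ^ k * B
      L = C * E ^ q
      step = stepConst q (2 * L)
      bound = 4 ^ step
      -- The noise floor: once it is added to the potential, the additive error of a step becomes a
      -- relative one.
      M = m * m * (s * s)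

      0<s : 0 < s
      0<s = *-mono-≤ (m^n>0 m {{>-nonZero 0<m}} k) 0<B

    some-free : ∃ λ v → c₀ v ≡ 0
    some-free with ∑-pos⇒∃ (verts n) (λ v → iszero (c₀ v)) (subst (0 <_) (sym free-size) 0<m)
    ... | v , pos = v , iszero-pos pos

    X₀ : ∀ v → c₀ v ≡ 0 → S.X c₀ v ≡ D
    X₀ v v-free = trans (∑-cong (allSubsets n) (λ e → cong (_* ι e v) (unmasked e))) (regular v v-free)
      where
      unmasked : ∀ e → S.wU c₀ e ≡ w e
      unmasked e with w e in eq
      ... | zero  = refl
      ... | suc j with avoid e c₀ | avoids e (subst (0 <_) (sym eq) z<s) | iszero≤1 (meet e c₀)
      ...   | suc zero    | _ | _ = *-identityʳ (suc j)
      ...   | suc (suc _) | _ | s≤s ()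

    -- The pair weights at one free vertex sum to `k * D`, and each of the `m` free vertices
    -- accounts for at most `B` of it.
    kD≤mB : k * D ≤ m * B
    kD≤mB with some-free
    ... | v , v-free = begin
      k * D                        ≡⟨ cong (k *_) (X₀ v v-free) ⟨
      k * S.X c₀ v                 ≡⟨ Σd v ⟨
      Σᵥ (S.d c₀ v)                ≤⟨ ∑-mono (verts n) (d≤ v) ⟩
      Σᵥ (λ u → B * S.f c₀ u)      ≡⟨ ∑-*ˡ (verts n) B _ ⟩
      B * free c₀                  ≡⟨ trans (cong (B *_) free-size) (*-comm B m) ⟩
      m * B                        ∎
      where
      open ≤-Reasoning
      open Facts W c₀

    -- This is where exact regularity of the weight pays off: at the start no free vertex deviates
    -- from its prediction.
    Φ₀ : S.Φ c₀ ≡ 0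
    Φ₀ = ∑-≡0 (verts n) term
      where
      y≡0 : ∀ v → c₀ v ≡ 0 → S.y c₀ v ≡ + 0
      y≡0 v v-free = trans (cong₂ (λ a b → + a -ᶻ + b) (trans (cong (m ^ k *_) (X₀ v v-free)) (*-comm (m ^ k) D)) (cong (λ x → D * x ^ k) free-size))
        (ℤ.+-inverseʳ (+ (D * m ^ k)))
      term : ∀ v → S.f c₀ v * sq (S.y c₀ v) ≡ 0
      term v with c₀ v in eq
      ... | suc _ = refl
      ... | zero  = trans (+-identityʳ _) (cong sq (y≡0 v eq))

    greedy-step : ∀ c → free c ≤ m → m ≤ free c * E → S.Φ c + M ≤ bound * M → 4 * (L * L) * bound ≤ m →
                  ∃ λ e → 0 < S.wU c e × m * (S.Φ (c ⊕ e) + M) ≤ (m + step) * (S.Φ c + M)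
    greedy-step c t≤m m≤tE Φ≤ m-large = next (∑-pos⇒∃ (allSubsets n) (S.wU c) 0<H)
      where
      open S c hiding (s; k; q)
      open Facts W c
      H≥ : m * m * s ≤ 2 * L * (P * q * H)
      H≥ = H-large m k t D B C E S Φ bound (P * q * H) m≤tE dense PqH≤ (SS≤ t≤m) Φ≤ m-large
      0<H : 0 < H
      0<H = n≢0⇒n>0 λ H≡0 → contradiction
        (≤-trans (*-mono-≤ (*-mono-≤ 0<m 0<m) 0<s) (≤-trans H≥ (≤-reflexive (trans (cong (λ x → 2 * L * (P * q * x)) H≡0) (trans (cong (2 * L *_) (*-zeroʳ (P * q))) (*-zeroʳ (2 * L)))))))
        λ ()
      next : (∃ λ e → 0 < wU e) → ∃ λ e → 0 < wU e × m * (S.Φ (c ⊕ e) + M) ≤ (m + step) * (Φ + M)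
      next (e₀ , pos₀) = choose (average (allSubsets n) wU (g t≡ t≤m kD≤mB) 0<H)
        where
        -- All edges of the weight have `q` vertices, so the number of free vertices after the step
        -- can be read off from any available edge, before the averaging selects one.
        r : ℕ
        r = free (c ⊕ e₀)
        open Drift W c r
        t≡ : t ≡ r + q
        t≡ = trans (free-⊕ c e₀ (proj₂ (*-pos⁻¹ (w e₀) _ pos₀))) (cong (λ x → r + x) (size e₀ (proj₁ (*-pos⁻¹ (w e₀) _ pos₀))))
        choose : (∃ λ e → 0 < wU e × (+ H *ᶻ g t≡ t≤m kD≤mB e ≤ᶻ Γ t≡ t≤m kD≤mB)) → _
        choose (e , pos , Hg≤Γ) = e , pos ,
          combine m s q (2 * L) Φ (S.Φ (c ⊕ e)) P H (g t≡ t≤m kD≤mB e) (Γ t≡ t≤m kD≤mB) 0<m 0<s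
            (Update.update W c r e t≡ t≤m kD≤mB pos) Hg≤Γ (Γ≤ t≡ t≤m kD≤mB) H≥

    Result : (Fin n → ℕ) → Set
    Result c = ∃ λ N → All (λ e → 0 < w e) N × (∀ v → c v + cover N v ≤ 1) × (free (λ v → c v + cover N v) * E < m)

    -- `i` counts the edges taken. Each uses up a free vertex, so `i` stays at most `m`; then
    -- `growth` caps the potential at a constant multiple of `M`, and the next step is available.
    greedy-loop : 4 * (L * L) * bound ≤ m → ∀ fuel i c → free c ≤ fuel → i + free c ≤ m → (∀ v → c v ≤ 1) →
                  m ^ i * (S.Φ c + M) ≤ (m + step) ^ i * M → Result c
    greedy-loop m-large fuel i c t≤fuel i+t≤m c≤1 invariant with m ≤? free c * E
    ... | no  m≰tE = [] , [] , (λ v → subst (_≤ 1) (sym (+-identityʳ (c v))) (c≤1 v)) ,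
                     subst (λ t → t * E < m) (∑-cong (verts n) (λ v → cong iszero (sym (+-identityʳ (c v))))) (≰⇒> m≰tE)
    ... | yes m≤tE = continue fuel t≤fuel (greedy-step c (≤-trans (m≤n+m _ i) i+t≤m) m≤tE Φ≤ m-large)
      where
      i≤m : i ≤ m
      i≤m = ≤-trans (m≤m+n i _) i+t≤m
      Φ≤ : S.Φ c + M ≤ bound * M
      Φ≤ = *-cancelˡ-≤ (m ^ i) {{m^n≢0 m i {{>-nonZero 0<m}}}} (≤-trans invariant (≤-trans (*-monoˡ-≤ M (growth step m i i≤m)) (≤-reflexive (lem bound (m ^ i) M))))
        where
        lem : ∀ a b c → a * b * c ≡ b * (a * c)
        lem = ring
      continue : ∀ fuel → free c ≤ fuel → (∃ λ e → 0 < S.wU c e × m * (S.Φ (c ⊕ e) + M) ≤ (m + step) * (S.Φ c + M)) → Result c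
      continue zero t≤0 _ = contradiction (≤-trans m≤tE (*-monoˡ-≤ E t≤0)) (<⇒≱ 0<m)
      continue (suc fuel) t≤fuel (e , pos , Φ′≤) = extend
        (greedy-loop m-large fuel (suc i) (c ⊕ e) (s≤s⁻¹ (≤-trans t′<t t≤fuel)) (≤-trans (≤-reflexive (sym (+-suc i _))) (≤-trans (+-monoʳ-≤ i t′<t) i+t≤m)) (⊕≤1 c e av c≤1) invariant′)
        where
        we : 0 < w e
        we = proj₁ (*-pos⁻¹ (w e) _ pos)
        av : 0 < avoid e c
        av = proj₂ (*-pos⁻¹ (w e) _ pos)
        t′<t : free (c ⊕ e) < free c
        t′<t = ≤-trans (m<m+n (free (c ⊕ e)) (subst (0 <_) (sym (size e we)) z<s)) (≤-reflexive (sym (free-⊕ c e av)))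
        invariant′ : m ^ suc i * (S.Φ (c ⊕ e) + M) ≤ (m + step) ^ suc i * M
        invariant′ = begin
          m * m ^ i * (S.Φ (c ⊕ e) + M)           ≡⟨ lem₁ m (m ^ i) _ ⟩
          m ^ i * (m * (S.Φ (c ⊕ e) + M))         ≤⟨ *-monoʳ-≤ (m ^ i) Φ′≤ ⟩
          m ^ i * ((m + step) * (S.Φ c + M))      ≡⟨ lem₂ (m ^ i) (m + step) _ ⟩
          (m + step) * (m ^ i * (S.Φ c + M))      ≤⟨ *-monoʳ-≤ (m + step) invariant ⟩
          (m + step) * ((m + step) ^ i * M)       ≡⟨ *-assoc (m + step) ((m + step) ^ i) M ⟨
          (m + step) ^ suc i * M                  ∎
          where
          open ≤-Reasoning
          lem₁ : ∀ a b c → a * b * c ≡ b * (a * c)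
          lem₁ = ring
          lem₂ : ∀ a b c → a * (b * c) ≡ b * (a * c)
          lem₂ = ring
        extend : Result (c ⊕ e) → Result c
        extend (N , all , ≤1 , small) = e ∷ N , we ∷ all , (λ v → subst (_≤ 1) (free-+cover c e N v) (≤1 v)) ,
          subst (λ t → t * E < m) (∑-cong (verts n) (λ v → cong iszero (free-+cover c e N v))) small

    almost-perfect : nibbleThreshold k′ C E ≤ m → (∀ v → c₀ v ≤ 1) → Result c₀
    almost-perfect m-large c₀≤1 = greedy-loop m-large m 0 c₀ (≤-reflexive free-size) (≤-reflexive free-size) c₀≤1
      (≤-reflexive (cong (λ x → 1 * (x + M)) Φ₀))

-- Edges of complete subgraphs.

module Cliques where
  open FiniteSums
  open Indicators
  open import Data.Bool using (T)
  open import Data.Bool.ListAction using (and)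
  open import Data.Bool.Properties using (T-≡)
  open import Data.Fin using (zero; suc)
  open import Data.Fin.Subset using (∣_∣; ⁅_⁆; _∪_)
  open import Data.Fin.Subset.Properties using (∪-identityʳ)
  open import Data.List using (map)
  open import Data.List.Membership.Propositional using (_∈_)
  open import Data.List.Membership.Propositional.Properties using (∈-++⁺ˡ; ∈-++⁺ʳ; ∈-map⁺)
  open import Data.List.Relation.Unary.Any using (here; there)
  open import Data.Nat using (ℕ; zero; suc; _≡ᵇ_)
  open import Data.Nat.Properties
  open import Data.Vec using ([]; _∷_)
  open import Function using (Equivalence)
  open import Relation.Binary.PropositionalEquality

  private variable
    n : ℕ

  ∈-allSubsets : ∀ (T : Subset n) → T ∈ allSubsets n
  ∈-allSubsets []          = here refl
  ∈-allSubsets (true  ∷ T) = ∈-++⁺ˡ (∈-map⁺ (true ∷_) (∈-allSubsets T))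
  ∈-allSubsets {suc n} (false ∷ T) = ∈-++⁺ʳ (map (true ∷_) (allSubsets n)) (∈-map⁺ (false ∷_) (∈-allSubsets T))

  ∧-true : ∀ {a b} → a ∧ b ≡ true → a ≡ true × b ≡ true
  ∧-true {true} p = refl , p

  and-∈ : ∀ {A : Set} (p : A → Bool) xs {x} → and (map p xs) ≡ true → x ∈ xs → p x ≡ true
  and-∈ p (y ∷ ys) all (here refl) = proj₁ (∧-true all)
  and-∈ p (y ∷ ys) all (there x∈)  = and-∈ p ys (proj₂ (∧-true {p y} all)) x∈

  and-map : ∀ {A : Set} (p : A → Bool) xs → (∀ x → p x ≡ true) → and (map p xs) ≡ true
  and-map p []       all = refl
  and-map p (x ∷ xs) all rewrite all x = and-map p xs all

  ≡ᵇ-true⇒≡ : ∀ a b → (a ≡ᵇ b) ≡ true → a ≡ b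
  ≡ᵇ-true⇒≡ a b p = ≡ᵇ⇒≡ a b (subst T (sym p) _)

  ≡⇒≡ᵇ-true : ∀ a b → a ≡ b → (a ≡ᵇ b) ≡ true
  ≡⇒≡ᵇ-true a b p = Equivalence.to T-≡ (≡⇒≡ᵇ a b p)

  clique-size : ∀ q (G : Hypergraph n) S → isClique q G S ≡ true → ∣ S ∣ ≡ suc q
  clique-size q G S p = ≡ᵇ-true⇒≡ ∣ S ∣ (suc q) (proj₁ (∧-true p))

  clique-edge : ∀ q (G : Hypergraph n) S T → isClique q G S ≡ true → T ⊆ᵇ S ≡ true → ∣ T ∣ ≡ q → G T ≡ true
  clique-edge {n} q G S T p T⊆S ∣T∣≡q
    with and-∈ (λ T → not ((T ⊆ᵇ S) ∧ (∣ T ∣ ≡ᵇ q)) ∨ G T) (allSubsets n) (proj₂ (∧-true {∣ S ∣ ≡ᵇ suc q} p)) (∈-allSubsets T)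
  ... | GT rewrite T⊆S | ≡⇒≡ᵇ-true ∣ T ∣ q ∣T∣≡q = GT

  ⊆ᵇ-refl : ∀ (e : Subset n) → e ⊆ᵇ e ≡ true
  ⊆ᵇ-refl []          = refl
  ⊆ᵇ-refl (true  ∷ e) = ⊆ᵇ-refl e
  ⊆ᵇ-refl (false ∷ e) = ⊆ᵇ-refl e

  ⊆ᵇ-∪ : ∀ (e : Subset n) v → e ⊆ᵇ (e ∪ ⁅ v ⁆) ≡ true
  ⊆ᵇ-∪ (true  ∷ e) zero rewrite ∪-identityʳ e = ⊆ᵇ-refl e
  ⊆ᵇ-∪ (false ∷ e) zero rewrite ∪-identityʳ e = ⊆ᵇ-refl e
  ⊆ᵇ-∪ (true  ∷ e) (suc v) = ⊆ᵇ-∪ e v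
  ⊆ᵇ-∪ (false ∷ e) (suc v) = ⊆ᵇ-∪ e v

  clique-insert : ∀ q (G : Hypergraph n) e v → ι e v ≡ 0 → isClique q G (e ∪ ⁅ v ⁆) ≡ true → G e ≡ true
  clique-insert q G e v v∉e p = clique-edge q G (e ∪ ⁅ v ⁆) e p (⊆ᵇ-∪ e v)
    (suc-injective (trans (sym (∣insert∣ e v v∉e)) (clique-size q G (e ∪ ⁅ v ⁆) p)))

-- From cliques to an exactly regular weight.

module Regularisation where
  open FiniteSums
  open Indicators
  open Covers
  open Cliques
  open SpreadWeights using (SpreadWeight)
  open import Data.Fin.Subset using (∣_∣; ⁅_⁆; _∪_)
  open import Data.Nat using (ℕ; zero; suc; _+_; _*_; _∸_; _^_; _≤_; _<_; z≤n; s≤s; z<s; _≡ᵇ_)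
  open import Data.Nat.Properties
  open import Data.Nat.Tactic.RingSolver using () renaming (solve-∀ to ring)
  open import Data.Vec using (lookup)
  open import Relation.Binary.PropositionalEquality

  co-insert : ∀ {n} (e : Subset n) u v → co e u * (ν u v * ι (e ∪ ⁅ u ⁆) v) ≡ co e u * ι e v
  co-insert e u v = ≤1-cases (ν u v) (iszero≤1 (δ u v))
    (λ ν≡0 → trans (cong (λ x → co e u * (x * ι (e ∪ ⁅ u ⁆) v)) ν≡0) (trans (*-zeroʳ (co e u)) (sym (vanish ν≡0))))
    (λ ν≡1 → trans (cong (co e u *_) (trans (cong (_* ι (e ∪ ⁅ u ⁆) v) ν≡1) (*-identityˡ _)))
      (trans (ι-insert e u v) (cong (co e u *_) (trans (cong (ι e v +_) (iszero-pos (subst (0 <_) (sym ν≡1) z<s))) (+-identityʳ _)))))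
    where
    vanish : ν u v ≡ 0 → co e u * ι e v ≡ 0
    vanish ν≡0 with δ u v in eq
    ... | suc j with δ-≡ u v (subst (0 <_) (sym eq) z<s)
    ...   | refl = trans (*-comm (co e u) (ι e u)) (ι*co e u)

  insert-avoid : ∀ {n} (e : Subset n) v c → co e v ≡ 1 → avoid (e ∪ ⁅ v ⁆) c ≤ avoid e c
  insert-avoid {n} e v c v∉e = antitone (∑-mono (verts n) (λ u → *-monoˡ-≤ (c u)
      (≤-trans (m≤m+n (ι e u) (δ v u)) (≤-reflexive (sym (trans (trans (sym (*-identityˡ _)) (cong (_* ι (e ∪ ⁅ v ⁆) u) (sym v∉e)))
        (trans (ι-insert e v u) (trans (cong (_* (ι e u + δ v u)) v∉e) (*-identityˡ _)))))))))
    where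
    antitone : ∀ {a b} → a ≤ b → iszero b ≤ iszero a
    antitone {zero}  {b}     _ = iszero≤1 b
    antitone {suc a} {suc b} _ = z≤n

  -- The sum counts the elements other than `v` and `y`; the term `ν v y` keeps track of whether
  -- these are one vertex or two.
  Σ-three : ∀ {n} (S : Subset n) v y → 0 < ι S v → 0 < ι S y → Σᵥ (λ u → ι S u * (ν v u * ν y u)) + (1 + ν v y) ≡ ∣ S ∣
  Σ-three {n} S v y v∈S y∈S = begin
    Σᵥ (λ u → ι S u * (ν v u * ν y u)) + (1 + ν v y)
      ≡⟨ cong (Σᵥ (λ u → ι S u * (ν v u * ν y u)) +_) (cong₂ _+_ (sym (trans (Σᵥ-δ v (ι S)) (1-of v∈S))) (sym (trans (Σᵥ-δ y (λ u → ν v u * ι S u)) (trans (cong (ν v y *_) (1-of y∈S)) (*-identityʳ _))))) ⟩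
    Σᵥ (λ u → ι S u * (ν v u * ν y u)) + (Σᵥ (λ u → δ v u * ι S u) + Σᵥ (λ u → δ y u * (ν v u * ι S u)))
      ≡⟨ trans (∑-+ (verts n) _ _) (cong (Σᵥ (λ u → ι S u * (ν v u * ν y u)) +_) (∑-+ (verts n) _ _)) ⟨
    Σᵥ (λ u → ι S u * (ν v u * ν y u) + (δ v u * ι S u + δ y u * (ν v u * ι S u)))
      ≡⟨ ∑-cong (verts n) (λ u → trans (lem (ι S u) (ν v u) (ν y u) (δ v u) (δ y u))
           (trans (cong (λ x → ι S u * (ν v u * x + δ v u)) (δ+ν y u)) (trans (cong (ι S u *_) (trans (cong (_+ δ v u) (*-identityʳ _)) (trans (+-comm (ν v u) (δ v u)) (δ+ν v u)))) (*-identityʳ _)))) ⟩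
    Σᵥ (ι S)    ≡⟨ Σᵥ-ι S ⟩
    ∣ S ∣       ∎
    where
    open ≡-Reasoning
    1-of : ∀ {u} → 0 < ι S u → ι S u ≡ 1
    1-of {u} pos = ≤-antisym (ι≤1 S u) pos
    lem : ∀ i a b d d′ → i * (a * b) + (d * i + d′ * (a * i)) ≡ i * (a * (d′ + b) + d)
    lem = ring

  -- Q v selects, for each free vertex v, exactly K cliques through v; each of them carries
  -- the fractional gadget that raises the weight at v and nowhere else.
  record CliqueSystem {n} (k′ : ℕ) (G : Hypergraph n) (c : Fin n → ℕ) (K scale Δ top : ℕ) : Set where
    degree : Fin n → ℕ
    degree v = Σₛ (λ e → 𝟙 (G e) * avoid e c * ι e v)
    field
      Q          : Fin n → Subset n → ℕ
      uniform    : IsQGraph (suc (suc k′)) G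
      Q≤1        : ∀ v S → Q v S ≤ 1
      Q-clique   : ∀ v S → 0 < Q v S → isClique (suc (suc k′)) G S ≡ true × 0 < avoid S c × 0 < ι S v
      Q-size     : ∀ v → c v ≡ 0 → Σₛ (Q v) ≡ K
      degree≤    : ∀ v → c v ≡ 0 → degree v ≤ top
      deficit≤   : ∀ v → c v ≡ 0 → scale * top ≤ scale * degree v + Δ
      enough     : n * Δ ≤ K * scale
      0<K        : 0 < K
      0<scale    : 0 < scale
      0<free     : 0 < free c

  module Regular {n} {k′ : ℕ} {G : Hypergraph n} {c : Fin n → ℕ} {K scale Δ top : ℕ} (𝒬 : CliqueSystem k′ G c K scale Δ top) where
    open CliqueSystem 𝒬
    k q Λ : ℕ
    k = suc k′
    q = suc k
    -- The `K` cliques of a vertex each give it `q` times its deficit, and deficits are counted in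
    -- units of 1 / `scale`; this base weight makes the correction fit exactly.
    Λ = q * (K * scale)

    edge : Subset n → ℕ
    edge e = 𝟙 (G e) * avoid e c

    deficit : Fin n → ℕ
    deficit v = iszero (c v) * (scale * top ∸ scale * degree v)

    -- On a clique `S` chosen for `v`, the `q` edges of `S` through `v` gain the deficit and the
    -- edge opposite `v` loses `k` times the deficit. Any other corner lies in `k` of the raised
    -- edges, so its total is unchanged, whereas `v` gains `q` times the deficit. Gains and losses
    -- are kept apart to stay in ℕ.
    W⁺ W⁻ w : Subset n → ℕ
    W⁺ e = Λ * edge e + Σᵥ (λ v → deficit v * (ι e v * Σᵥ (λ u → co e u * Q v (e ∪ ⁅ u ⁆))))
    W⁻ e = k * Σᵥ (λ v → deficit v * (co e v * Q v (e ∪ ⁅ v ⁆)))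
    w e = W⁺ e ∸ W⁻ e

    deficit≤Δ : ∀ v → deficit v ≤ Δ
    deficit≤Δ v with c v in eq
    ... | suc _ = z≤n
    ... | zero  = ≤-trans (≤-reflexive (+-identityʳ _)) (m≤n+o⇒m∸n≤o (scale * top) (scale * degree v) (deficit≤ v eq))

    edge≤1 : ∀ e → edge e ≤ 1
    edge≤1 e = *-mono-≤ (𝟙≤1 (G e)) (iszero≤1 (meet e c))

    edge-size : ∀ e → 0 < edge e → ∣ e ∣ ≡ q
    edge-size e pos = uniform e (𝟙-true (proj₁ (*-pos⁻¹ (𝟙 (G e)) _ pos)))

    ≤edge : ∀ e {x} → x ≤ 1 → (0 < x → 0 < edge e) → x ≤ edge e
    ≤edge e {zero}        _         _ = z≤n
    ≤edge e {suc zero}    _         f = f z<s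
    ≤edge e {suc (suc _)} (s≤s ()) _

    co≤1 : ∀ (e : Subset n) u → co e u ≤ 1
    co≤1 e u = 𝟙≤1 (not (lookup e u))

    Q-insert≤edge : ∀ v e u → co e u * Q v (e ∪ ⁅ u ⁆) ≤ edge e
    Q-insert≤edge v e u = ≤edge e (*-mono-≤ (co≤1 e u) (Q≤1 v (e ∪ ⁅ u ⁆))) λ pos →
      let co-pos , Q-pos = *-pos⁻¹ (co e u) _ pos
          co≡1 = ≤-antisym (co≤1 e u) co-pos
          clique , av , _ = Q-clique v _ Q-pos
          u∉e = +-cancelʳ-≡ 1 (ι e u) 0 (trans (cong (ι e u +_) (sym co≡1)) (ι+co e u))
      in *-mono-≤ {1} (subst (λ b → 0 < 𝟙 b) (sym (clique-insert q G e u u∉e clique)) z<s) (≤-trans av (insert-avoid e u c co≡1))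

    -- Each vertex lowers `e` through at most one clique, by `k` times a deficit of at most `Δ`;
    -- over all `n` vertices `enough` keeps this within the base weight. Hence the truncated
    -- subtraction in `w` is exact.
    W⁻≤ : ∀ e → W⁻ e ≤ Λ * edge e
    W⁻≤ e = begin
      k * Σᵥ (λ v → deficit v * (co e v * Q v (e ∪ ⁅ v ⁆)))   ≤⟨ *-monoʳ-≤ k (∑-mono (verts n) (λ v → *-mono-≤ (deficit≤Δ v) (Q-insert≤edge v e v))) ⟩
      k * Σᵥ {n} (λ v → Δ * edge e)                           ≡⟨ cong (k *_) (Σᵥ-const {n} (Δ * edge e)) ⟩
      k * (n * (Δ * edge e))                                  ≡⟨ cong (k *_) (*-assoc n Δ (edge e)) ⟨
      k * (n * Δ * edge e)                                    ≤⟨ *-mono-≤ (n≤1+n k) (*-monoˡ-≤ (edge e) enough) ⟩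
      q * (K * scale * edge e)                                ≡⟨ *-assoc q (K * scale) (edge e) ⟨
      Λ * edge e                                              ∎
      where open ≤-Reasoning

    W⁻≤W⁺ : ∀ e → W⁻ e ≤ W⁺ e
    W⁻≤W⁺ e = ≤-trans (W⁻≤ e) (m≤m+n _ _)

    -- At most `n * Δ` is added for each of the `q` vertices of `e`, which is no more than the base
    -- weight once again.
    W⁺≤ : ∀ e → W⁺ e ≤ 2 * Λ * edge e
    W⁺≤ e = begin
      Λ * edge e + Σᵥ (λ v → deficit v * (ι e v * Σᵥ (λ u → co e u * Q v (e ∪ ⁅ u ⁆))))
        ≤⟨ +-monoʳ-≤ (Λ * edge e) (∑-mono (verts n) (λ v → *-mono-≤ (deficit≤Δ v) (*-monoʳ-≤ (ι e v) (∑-mono (verts n) (λ u → Q-insert≤edge v e u))))) ⟩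
      Λ * edge e + Σᵥ (λ v → Δ * (ι e v * Σᵥ {n} (λ u → edge e)))
        ≡⟨ cong (Λ * edge e +_) (trans (∑-cong (verts n) (λ v → trans (cong (λ x → Δ * (ι e v * x)) (Σᵥ-const {n} (edge e))) (lem Δ (ι e v) n (edge e)))) (trans (∑-*ˡ (verts n) (n * Δ * edge e) (ι e)) (cong (n * Δ * edge e *_) (Σᵥ-ι e)))) ⟩
      Λ * edge e + n * Δ * edge e * ∣ e ∣       ≡⟨ cong (Λ * edge e +_) (size-q (edge e) refl) ⟩
      Λ * edge e + n * Δ * edge e * q           ≤⟨ +-monoʳ-≤ (Λ * edge e) (*-monoˡ-≤ q (*-monoˡ-≤ (edge e) enough)) ⟩
      Λ * edge e + K * scale * edge e * q       ≡⟨ lem₂ q (K * scale) (edge e) ⟩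
      2 * Λ * edge e                            ∎
      where
      open ≤-Reasoning
      lem : ∀ Δ i n e → Δ * (i * (n * e)) ≡ n * Δ * e * i
      lem = ring
      lem₂ : ∀ q K e → q * K * e + K * e * q ≡ 2 * (q * K) * e
      lem₂ = ring
      size-q : ∀ x → x ≡ edge e → n * Δ * x * ∣ e ∣ ≡ n * Δ * x * q
      size-q zero    _  = trans (cong (_* ∣ e ∣) (*-zeroʳ (n * Δ))) (sym (cong (_* q) (*-zeroʳ (n * Δ))))
      size-q (suc x) eq = cong (n * Δ * suc x *_) (edge-size e (subst (0 <_) eq z<s))

    w≤ : ∀ e → w e ≤ 2 * Λ * edge e
    w≤ e = ≤-trans (m∸n≤m (W⁺ e) (W⁻ e)) (W⁺≤ e)

    w⇒edge : ∀ e → 0 < w e → 0 < edge e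
    w⇒edge e pos = proj₂ (*-pos⁻¹ (2 * Λ) (edge e) (≤-trans pos (w≤ e)))

    through : Fin n → Fin n → ℕ
    through v y = Σₛ (λ S → Q v S * (ι S v * ι S y))

    -- Of the q + 1 corners, `q` differ from `v`, and `k` differ from both `v` and another corner
    -- `y`; the summand `δ v y` merges the two cases.
    clique-corners : ∀ v y S → Q v S * (ι S v * ι S y) * Σᵥ (λ u → ι S u * (ν v u * ν y u)) ≡ (k + δ v y) * (Q v S * (ι S v * ι S y))
    clique-corners v y S with Q v S * (ι S v * ι S y) in eq
    ... | zero  = sym (*-zeroʳ (k + δ v y))
    ... | suc j = trans (*-comm (suc j) _) (cong (_* suc j) (+-cancelʳ-≡ (1 + ν v y) _ _ (begin
        Σᵥ (λ u → ι S u * (ν v u * ν y u)) + (1 + ν v y)     ≡⟨ Σ-three S v y (proj₁ (*-pos⁻¹ (ι S v) _ (proj₂ pos))) (proj₂ (*-pos⁻¹ (ι S v) _ (proj₂ pos))) ⟩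
        ∣ S ∣                                                ≡⟨ clique-size q G S (proj₁ (Q-clique v S (proj₁ pos))) ⟩
        suc q                                                ≡⟨ lem k ⟩
        k + (1 + 1)                                          ≡⟨ cong (λ x → k + (1 + x)) (δ+ν v y) ⟨
        k + (1 + (δ v y + ν v y))                            ≡⟨ lem₂ k (δ v y) (ν v y) ⟩
        k + δ v y + (1 + ν v y)                              ∎)))
      where
      open ≡-Reasoning
      pos : 0 < Q v S × 0 < ι S v * ι S y
      pos = *-pos⁻¹ (Q v S) _ (subst (0 <_) (sym eq) z<s)
      lem : ∀ k → 2 + k ≡ k + (1 + 1)
      lem = ring
      lem₂ : ∀ k d n → k + (1 + (d + n)) ≡ k + d + (1 + n)
      lem₂ = ring

    -- An edge `e` with a vertex `u` outside it amounts to a set `S` with a marked element, by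
    -- `Σₛ-insert`; `clique-corners` then counts the marks.
    W⁺-sum : ∀ y → Σₛ (λ e → W⁺ e * ι e y) ≡ Λ * degree y + Σᵥ (λ v → deficit v * ((k + δ v y) * through v y))
    W⁺-sum y = begin
      Σₛ (λ e → W⁺ e * ι e y)
        ≡⟨ trans (∑-cong (allSubsets n) row) (∑-+ (allSubsets n) _ _) ⟩
      Σₛ (λ e → Λ * (edge e * ι e y)) + Σₛ (λ e → Σᵥ (λ v → deficit v * Σᵥ (λ u → co e u * (ι e v * ι e y * Q v (e ∪ ⁅ u ⁆)))))
        ≡⟨ cong₂ _+_ (∑-*ˡ (allSubsets n) Λ _) (trans (∑-swap (allSubsets n) (verts n) _) (∑-cong (verts n) column)) ⟩
      Λ * degree y + Σᵥ (λ v → deficit v * ((k + δ v y) * through v y)) ∎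
      where
      open ≡-Reasoning
      lem₀ : ∀ Λ e x y → (Λ * e + x) * y ≡ Λ * (e * y) + x * y
      lem₀ = ring
      lem₁ : ∀ d i s y → d * (i * s) * y ≡ d * (s * (i * y))
      lem₁ = ring
      lem₂ : ∀ c Q x → c * Q * x ≡ c * (x * Q)
      lem₂ = ring
      row : ∀ e → W⁺ e * ι e y ≡ Λ * (edge e * ι e y) + Σᵥ (λ v → deficit v * Σᵥ (λ u → co e u * (ι e v * ι e y * Q v (e ∪ ⁅ u ⁆))))
      row e = trans (lem₀ Λ (edge e) _ (ι e y)) (cong (Λ * (edge e * ι e y) +_) (trans (sym (∑-*ʳ (verts n) (ι e y) _)) (∑-cong (verts n) (λ v →
        trans (lem₁ (deficit v) (ι e v) _ (ι e y)) (cong (deficit v *_) (trans (sym (∑-*ʳ (verts n) (ι e v * ι e y) _)) (∑-cong (verts n) (λ u → lem₂ (co e u) (Q v (e ∪ ⁅ u ⁆)) (ι e v * ι e y)))))))))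
      F : Fin n → Fin n → Subset n → ℕ
      F v u S = ν u v * ι S v * (ν u y * ι S y) * Q v S
      co-idem : ∀ (e : Subset n) u → co e u * co e u ≡ co e u
      co-idem e u with lookup e u
      ... | true  = refl
      ... | false = refl
      lem₃ : ∀ c a b Q → c * c * (a * b * Q) ≡ c * a * (c * b) * Q
      lem₃ = ring
      to-F : ∀ v u e → co e u * (ι e v * ι e y * Q v (e ∪ ⁅ u ⁆)) ≡ co e u * F v u (e ∪ ⁅ u ⁆)
      to-F v u e = begin
        co e u * (ι e v * ι e y * Q v S)               ≡⟨ cong (_* (ι e v * ι e y * Q v S)) (co-idem e u) ⟨
        co e u * co e u * (ι e v * ι e y * Q v S)      ≡⟨ lem₃ (co e u) (ι e v) (ι e y) (Q v S) ⟩
        co e u * ι e v * (co e u * ι e y) * Q v S      ≡⟨ cong₂ (λ a b → a * b * Q v S) (co-insert e u v) (co-insert e u y) ⟨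
        co e u * (ν u v * ι S v) * (co e u * (ν u y * ι S y)) * Q v S ≡⟨ lem₃ (co e u) (ν u v * ι S v) (ν u y * ι S y) (Q v S) ⟨
        co e u * co e u * F v u S                      ≡⟨ cong (_* F v u S) (co-idem e u) ⟩
        co e u * F v u S                               ∎
        where S = e ∪ ⁅ u ⁆
      lem₄ : ∀ i a v b y Q → i * (a * v * (b * y) * Q) ≡ Q * (v * y) * (i * (a * b))
      lem₄ = ring
      column : ∀ v → Σₛ (λ e → deficit v * Σᵥ (λ u → co e u * (ι e v * ι e y * Q v (e ∪ ⁅ u ⁆)))) ≡ deficit v * ((k + δ v y) * through v y)
      column v = trans (∑-*ˡ (allSubsets n) (deficit v) _) (cong (deficit v *_) (begin
        Σₛ (λ e → Σᵥ (λ u → co e u * (ι e v * ι e y * Q v (e ∪ ⁅ u ⁆))))    ≡⟨ ∑-swap (allSubsets n) (verts n) _ ⟩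
        Σᵥ (λ u → Σₛ (λ e → co e u * (ι e v * ι e y * Q v (e ∪ ⁅ u ⁆))))    ≡⟨ ∑-cong (verts n) (λ u → trans (∑-cong (allSubsets n) (to-F v u)) (Σₛ-insert u (F v u))) ⟩
        Σᵥ (λ u → Σₛ (λ S → ι S u * F v u S))                               ≡⟨ ∑-swap (verts n) (allSubsets n) _ ⟩
        Σₛ (λ S → Σᵥ (λ u → ι S u * F v u S))                               ≡⟨ ∑-cong (allSubsets n) (λ S → trans (∑-cong (verts n) (λ u → trans (lem₄ (ι S u) (ν u v) (ι S v) (ν u y) (ι S y) (Q v S)) (cong₂ (λ a b → Q v S * (ι S v * ι S y) * (ι S u * (a * b))) (ν-sym u v) (ν-sym u y)))) (∑-*ˡ (verts n) (Q v S * (ι S v * ι S y)) _)) ⟩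
        Σₛ (λ S → Q v S * (ι S v * ι S y) * Σᵥ (λ u → ι S u * (ν v u * ν y u))) ≡⟨ ∑-cong (allSubsets n) (clique-corners v y) ⟩
        Σₛ (λ S → (k + δ v y) * (Q v S * (ι S v * ι S y)))                  ≡⟨ ∑-*ˡ (allSubsets n) (k + δ v y) _ ⟩
        (k + δ v y) * through v y                                           ∎))

    W⁻-sum : ∀ y → Σₛ (λ e → W⁻ e * ι e y) ≡ k * Σᵥ (λ v → deficit v * (ν v y * through v y))
    W⁻-sum y = begin
      Σₛ (λ e → W⁻ e * ι e y)
        ≡⟨ trans (∑-cong (allSubsets n) row) (∑-*ˡ (allSubsets n) k _) ⟩
      k * Σₛ (λ e → Σᵥ (λ v → deficit v * (co e v * F v (e ∪ ⁅ v ⁆))))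
        ≡⟨ cong (k *_) (trans (∑-swap (allSubsets n) (verts n) _) (∑-cong (verts n) (λ v → trans (∑-*ˡ (allSubsets n) (deficit v) _) (cong (deficit v *_) (column v))))) ⟩
      k * Σᵥ (λ v → deficit v * (ν v y * through v y)) ∎
      where
      open ≡-Reasoning
      F : Fin n → Subset n → ℕ
      F v S = ν v y * ι S y * Q v S
      lem₁ : ∀ d c Q y → d * (c * Q) * y ≡ d * (c * y * Q)
      lem₁ = ring
      lowered : Subset n → Fin n → ℕ
      lowered e v = deficit v * (co e v * Q v (e ∪ ⁅ v ⁆))
      row : ∀ e → W⁻ e * ι e y ≡ k * Σᵥ (λ v → deficit v * (co e v * F v (e ∪ ⁅ v ⁆)))
      row e = trans (*-assoc k (Σᵥ (lowered e)) (ι e y)) (cong (k *_) (trans (sym (∑-*ʳ (verts n) (ι e y) (lowered e))) (∑-cong (verts n) (λ v →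
        trans (lem₁ (deficit v) (co e v) (Q v (e ∪ ⁅ v ⁆)) (ι e y)) (cong (deficit v *_) (trans (cong (_* Q v (e ∪ ⁅ v ⁆)) (sym (co-insert e v y))) (*-assoc (co e v) _ _)))))))
      lem₂ : ∀ a n y Q → a * (n * y * Q) ≡ n * (Q * (a * y))
      lem₂ = ring
      column : ∀ v → Σₛ (λ e → co e v * F v (e ∪ ⁅ v ⁆)) ≡ ν v y * through v y
      column v = trans (Σₛ-insert v (F v)) (trans (∑-cong (allSubsets n) (λ S → lem₂ (ι S v) (ν v y) (ι S y) (Q v S))) (∑-*ˡ (allSubsets n) (ν v y) _))

    through-self : ∀ y → c y ≡ 0 → through y y ≡ K
    through-self y y-free = trans (∑-cong (allSubsets n) (λ S → trans (cong (Q y S *_) (ι-idem S y)) (absorbed S))) (Q-size y y-free)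
      where
      absorbed : ∀ S → Q y S * ι S y ≡ Q y S
      absorbed S with Q y S in eq
      ... | zero  = refl
      ... | suc j = trans (cong (suc j *_) (≤-antisym (ι≤1 S y) (proj₂ (proj₂ (Q-clique y S (subst (0 <_) (sym eq) z<s)))))) (*-identityʳ (suc j))

    -- `k + δ v y` splits into `q` on the diagonal and `k` off it. The off-diagonal part is what
    -- `W⁻` takes away, and on the diagonal the `K` cliques of `y` make up exactly its deficit.
    regular : ∀ y → c y ≡ 0 → Σₛ (λ e → w e * ι e y) ≡ Λ * top
    regular y y-free = +-cancelʳ-≡ (Σₛ (λ e → W⁻ e * ι e y)) _ _ (begin
      Σₛ (λ e → w e * ι e y) + Σₛ (λ e → W⁻ e * ι e y)
        ≡⟨ ∑-+ (allSubsets n) _ _ ⟨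
      Σₛ (λ e → w e * ι e y + W⁻ e * ι e y)
        ≡⟨ ∑-cong (allSubsets n) (λ e → trans (sym (*-distribʳ-+ (ι e y) (w e) (W⁻ e))) (cong (_* ι e y) (m∸n+n≡m (W⁻≤W⁺ e)))) ⟩
      Σₛ (λ e → W⁺ e * ι e y)
        ≡⟨ W⁺-sum y ⟩
      Λ * degree y + Σᵥ (λ v → deficit v * ((k + δ v y) * through v y))
        ≡⟨ cong (Λ * degree y +_) (trans (∑-cong (verts n) split) (trans (∑-+ (verts n) _ _) (cong₂ _+_ (trans (∑-*ˡ (verts n) q _) (cong (q *_) diagonal)) (∑-*ˡ (verts n) k _)))) ⟩
      Λ * degree y + (q * (deficit y * K) + k * Σᵥ (λ v → deficit v * (ν v y * through v y)))
        ≡⟨ +-assoc (Λ * degree y) _ _ ⟨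
      Λ * degree y + q * (deficit y * K) + k * Σᵥ (λ v → deficit v * (ν v y * through v y))
        ≡⟨ cong₂ _+_ fill (sym (W⁻-sum y)) ⟩
      Λ * top + Σₛ (λ e → W⁻ e * ι e y) ∎)
      where
      open ≡-Reasoning
      lem : ∀ d k x n t → (x + n ≡ 1) → d * ((k + x) * t) ≡ (1 + k) * (x * (d * t)) + k * (d * (n * t))
      lem d k x n t x+n≡1 = trans (cong (λ y → d * ((y + x) * t)) (sym (trans (cong (k *_) x+n≡1) (*-identityʳ k)))) (expand d k x n t)
        where
        expand : ∀ d k x n t → d * ((k * (x + n) + x) * t) ≡ (1 + k) * (x * (d * t)) + k * (d * (n * t))
        expand = ring
      split : ∀ v → deficit v * ((k + δ v y) * through v y) ≡ q * (δ v y * (deficit v * through v y)) + k * (deficit v * (ν v y * through v y))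
      split v = lem (deficit v) k (δ v y) (ν v y) (through v y) (δ+ν v y)
      diagonal : Σᵥ (λ v → δ v y * (deficit v * through v y)) ≡ deficit y * K
      diagonal = trans (∑-cong (verts n) (λ v → cong (_* (deficit v * through v y)) (δ-sym v y)))
        (trans (Σᵥ-δ y (λ v → deficit v * through v y)) (cong (deficit y *_) (through-self y y-free)))
      deficit-y : scale * degree y + deficit y ≡ scale * top
      deficit-y = trans (cong (λ x → scale * degree y + iszero x * (scale * top ∸ scale * degree y)) y-free)
        (trans (cong (scale * degree y +_) (+-identityʳ _)) (m+[n∸m]≡n (*-monoʳ-≤ scale (degree≤ y y-free))))
      lem₂ : ∀ q K s d x → q * (K * s) * d + q * (x * K) ≡ q * (K * (s * d + x))
      lem₂ = ring
      lem₃ : ∀ q K s t → q * (K * (s * t)) ≡ q * (K * s) * t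
      lem₃ = ring
      fill : Λ * degree y + q * (deficit y * K) ≡ Λ * top
      fill = trans (lem₂ q K scale (degree y) (deficit y)) (trans (cong (λ x → q * (K * x)) deficit-y) (lem₃ q K scale top))

    0<n : 0 < n
    0<n = ≤-trans 0<free (≤-trans (∑-mono (verts n) (λ v → iszero≤1 (c v))) (≤-reflexive (trans (Σᵥ-const {n} 1) (*-identityʳ n))))

    free≤n : free c ≤ n
    free≤n = ≤-trans (∑-mono (verts n) (λ v → iszero≤1 (c v))) (≤-reflexive (trans (Σᵥ-const {n} 1) (*-identityʳ n)))

    0<Λ : 0 < Λ
    0<Λ = *-mono-≤ {1} {q} (s≤s z≤n) (*-mono-≤ 0<K 0<scale)

    w≤size : ∀ e → w e ≤ 2 * Λ * 𝟙 (∣ e ∣ ≡ᵇ q)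
    w≤size e = ≤-trans (w≤ e) (*-monoʳ-≤ (2 * Λ) (bound (edge e) refl))
      where
      bound : ∀ x → x ≡ edge e → edge e ≤ 𝟙 (∣ e ∣ ≡ᵇ q)
      bound zero    eq = subst (_≤ 𝟙 (∣ e ∣ ≡ᵇ q)) eq z≤n
      bound (suc x) eq = ≤-trans (edge≤1 e) (subst (λ b → 1 ≤ 𝟙 b) (sym (≡⇒≡ᵇ-true ∣ e ∣ q (edge-size e (subst (0 <_) eq z<s)))) ≤-refl)

    weighted≤ : ∀ (F : Subset n → ℕ) {N} → Σₛ (λ e → 𝟙 (∣ e ∣ ≡ᵇ q) * F e) ≤ N → Σₛ (λ e → w e * F e) ≤ 2 * Λ * N
    weighted≤ F {N} F≤ = begin
      Σₛ (λ e → w e * F e)                             ≤⟨ ∑-mono (allSubsets n) (λ e → ≤-trans (*-monoˡ-≤ (F e) (w≤size e)) (≤-reflexive (*-assoc (2 * Λ) _ (F e)))) ⟩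
      Σₛ (λ e → 2 * Λ * (𝟙 (∣ e ∣ ≡ᵇ q) * F e))        ≡⟨ ∑-*ˡ (allSubsets n) (2 * Λ) _ ⟩
      2 * Λ * Σₛ (λ e → 𝟙 (∣ e ∣ ≡ᵇ q) * F e)          ≤⟨ *-monoʳ-≤ (2 * Λ) F≤ ⟩
      2 * Λ * N                                        ∎
      where open ≤-Reasoning

  -- The factor `n` gives the bound the exponent `k′` for every q; for q = 2 the sum itself
  -- vanishes.
  triples≤ : ∀ {n} k′ (v u x : Fin n) → 0 < ν v u → 0 < ν v x → 0 < ν u x →
             n * Σₛ (λ e → 𝟙 (∣ e ∣ ≡ᵇ suc (suc k′)) * (ι e v * ι e u * ι e x)) ≤ n ^ k′
  triples≤ {n} zero     v u x a b c = ≤-trans (≤-reflexive (trans (cong (n *_) (∑-≡0 (allSubsets n) (pairs∌triple v u x a b c))) (*-zeroʳ n))) z≤n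
  triples≤ {n} (suc k″) v u x a b c = *-monoʳ-≤ n (sets∋∋∋≤ k″ v u x a b c)

  -- The pair bound is the number of q-sets through two vertices times the largest weight; the
  -- hypothesis on `C` says that this is of the order of the degree divided by `n`.
  regularised : ∀ {n} {k′ : ℕ} {G : Hypergraph n} {c : Fin n → ℕ} {K scale Δ top : ℕ} (𝒬 : CliqueSystem k′ G c K scale Δ top) →
    ∀ C → 2 * (n * n ^ k′) ≤ C * top →
    SpreadWeight k′ (free c) (2 * Regular.Λ 𝒬 * n ^ k′) C (Regular.Λ 𝒬 * top) c (Regular.w 𝒬)
  regularised {n} {k′} {G} {c} {K} {scale} {Δ} {top} 𝒬 C dense = record
    { free-size = refl
    ; size      = λ e pos → edge-size e (w⇒edge e pos)
    ; avoids    = λ e pos → proj₂ (*-pos⁻¹ (𝟙 (G e)) _ (w⇒edge e pos))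
    ; regular   = regular
    ; pairs     = λ v u v≢u → weighted≤ _ (sets∋∋≤ k′ v u v≢u)
    ; triples   = λ v u x a b d → ≤-trans (*-mono-≤ free≤n (weighted≤ (λ e → ι e v * ι e u * ι e x) ≤-refl))
                    (≤-trans (≤-reflexive (lem n (2 * Λ) _)) (*-monoʳ-≤ (2 * Λ) (triples≤ k′ v u x a b d)))
    ; dense     = ≤-trans (*-monoˡ-≤ _ free≤n) (≤-trans (≤-reflexive (lem₂ n Λ (n ^ k′))) (≤-trans (*-monoʳ-≤ Λ dense) (≤-reflexive (lem Λ C top))))
    ; 0<B       = *-mono-≤ {1} (*-mono-≤ {1} {2} (s≤s z≤n) 0<Λ) (m^n>0 n {{>-nonZero 0<n}} k′)
    ; 0<m       = 0<free
    }
    where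
    open Regular 𝒬
    open CliqueSystem 𝒬 using (0<free)
    open import Data.Nat using (>-nonZero)
    lem : ∀ a b c → a * (b * c) ≡ b * (a * c)
    lem = ring
    lem₂ : ∀ n Λ N → n * (2 * Λ * N) ≡ Λ * (2 * (n * N))
    lem₂ = ring

-- Links, rich sets and the supply of helpers.

module Links where
  open FiniteSums
  open Indicators
  open Covers
  open Cliques
  open import Data.Bool using (T)
  open import Data.Fin.Subset using (∣_∣; ⁅_⁆; _∪_)
  open import Data.Nat using (ℕ; suc; _+_; _*_; _^_; _≤_; _<_; z≤n; z<s; _≡ᵇ_; _≤ᵇ_; >-nonZero)
  open import Data.Nat.Properties
  open import Data.Nat.Tactic.RingSolver using () renaming (solve-∀ to ring)
  open import Data.Vec using (lookup)
  open import Relation.Binary.PropositionalEquality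

  lk : ∀ {n} → Hypergraph n → Fin n → Subset n → ℕ
  lk G v f = 𝟙 (link G v f)

  lk≤1 : ∀ {n} (G : Hypergraph n) v f → lk G v f ≤ 1
  lk≤1 G v f = 𝟙≤1 (link G v f)

  lk-∉ : ∀ {n} (G : Hypergraph n) v f → 0 < lk G v f → ι f v ≡ 0
  lk-∉ G v f pos with lookup f v
  ... | false = refl

  lk-edge : ∀ {n} (G : Hypergraph n) v f → 0 < lk G v f → G (f ∪ ⁅ v ⁆) ≡ true
  lk-edge G v f pos = proj₂ (∧-true {not (lookup f v)} (𝟙-true pos))

  record DenseLinks {n} (k′ : ℕ) (G : Hypergraph n) (K : ℕ) : Set where
    field
      uniform : IsQGraph (suc (suc k′)) G
      codense : ∀ v w → n ^ suc k′ ≤ K * Σₛ (λ f → lk G v f * lk G w f)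
      0<n     : 0 < n

  module LinkFacts {n} {k′ : ℕ} {G : Hypergraph n} {K : ℕ} (𝒟 : DenseLinks k′ G K) where
    open DenseLinks 𝒟
    k q : ℕ
    k = suc k′
    q = suc k

    lk-size : ∀ v f → 0 < lk G v f → ∣ f ∣ ≡ k
    lk-size v f pos = suc-injective (trans (sym (∣insert∣ f v (lk-∉ G v f pos))) (uniform _ (lk-edge G v f pos)))

    lk≤size : ∀ v f → lk G v f ≤ 𝟙 (∣ f ∣ ≡ᵇ k)
    lk≤size v f = ≤1-cases (lk G v f) (lk≤1 G v f)
      (λ ≡0 → subst (_≤ 𝟙 (∣ f ∣ ≡ᵇ k)) (sym ≡0) z≤n)
      (λ ≡1 → subst₂ (λ a b → a ≤ 𝟙 b) (sym ≡1) (sym (≡⇒≡ᵇ-true ∣ f ∣ k (lk-size v f (subst (0 <_) (sym ≡1) z<s)))) ≤-refl)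

    Σlk≤ : ∀ v → Σₛ (lk G v) ≤ n ^ k
    Σlk≤ v = ≤-trans (∑-mono (allSubsets n) (lk≤size v)) (sets≤ {n} k)

    Σlk-meet≤ : ∀ v c → Σₛ (λ f → lk G v f * meet f c) ≤ Σᵥ c * n ^ k′
    Σlk-meet≤ v c = ≤-trans (∑-mono (allSubsets n) (λ f → *-monoˡ-≤ (meet f c) (lk≤size v f))) Σsize-meet≤
      where
      lem : ∀ s i c → s * (i * c) ≡ c * (s * i)
      lem = ring
      Σsize-meet≤ : Σₛ (λ f → 𝟙 (∣ f ∣ ≡ᵇ k) * meet f c) ≤ Σᵥ c * n ^ k′
      Σsize-meet≤ = begin
        Σₛ (λ f → 𝟙 (∣ f ∣ ≡ᵇ k) * meet f c)                    ≡⟨ ∑-cong (allSubsets n) (λ f → trans (sym (∑-*ˡ (verts n) (𝟙 (∣ f ∣ ≡ᵇ k)) _)) (∑-cong (verts n) (λ v → lem (𝟙 (∣ f ∣ ≡ᵇ k)) (ι f v) (c v)))) ⟩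
        Σₛ (λ f → Σᵥ (λ v → c v * (𝟙 (∣ f ∣ ≡ᵇ k) * ι f v)))    ≡⟨ ∑-swap (allSubsets n) (verts n) _ ⟩
        Σᵥ (λ v → Σₛ (λ f → c v * (𝟙 (∣ f ∣ ≡ᵇ k) * ι f v)))    ≤⟨ ∑-mono (verts n) (λ v → ≤-trans (≤-reflexive (∑-*ˡ (allSubsets n) (c v) _)) (*-monoʳ-≤ (c v) (sets∋≤ k′ v))) ⟩
        Σᵥ (λ v → c v * n ^ k′)                                 ≡⟨ ∑-*ʳ (verts n) (n ^ k′) c ⟩
        Σᵥ c * n ^ k′                                           ∎
        where open ≤-Reasoning

    codeg′ : Subset n → ℕ
    codeg′ f = Σᵥ (λ w → lk G w f)

    codeg′≤n : ∀ f → codeg′ f ≤ n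
    codeg′≤n f = ≤-trans (∑-mono (verts n) (λ w → lk≤1 G w f)) (≤-reflexive (trans (Σᵥ-const {n} 1) (*-identityʳ n)))

    -- The threshold n / (2K) is half of the average degree that `codense` forces on the sets of any
    -- link.
    rich : Subset n → Bool
    rich f = n ≤ᵇ 2 * K * codeg′ f

    rich⇒ : ∀ f → rich f ≡ true → n ≤ 2 * K * codeg′ f
    rich⇒ f p = ≤ᵇ⇒≤ n _ (subst T (sym p) _)

    2Kcodeg′≤ : ∀ f → 2 * K * codeg′ f ≤ 2 * K * n * 𝟙 (rich f) + n
    2Kcodeg′≤ f with rich f in eq
    ... | true  = ≤-trans (*-monoʳ-≤ (2 * K) (codeg′≤n f)) (≤-trans (≤-reflexive (sym (*-identityʳ _))) (m≤m+n _ n))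
    ... | false = ≤-trans (≰⇒≥ λ n≤ → contradiction (≤⇒≤ᵇ n≤) (λ t → subst T eq t)) (m≤n+m n _)

    -- Summing the codegrees of `w` over all vertices, the sets of its link have total degree at
    -- least n^q / K. Those that are not rich supply at most half of it, and each rich one at most
    -- `n`.
    rich-link : ∀ w → n ^ k ≤ 2 * K * Σₛ (λ f → lk G w f * 𝟙 (rich f))
    rich-link w = *-cancelˡ-≤ n {{>-nonZero 0<n}} (+-cancelʳ-≤ (n * n ^ k) _ _ (begin
      n * n ^ k + n * n ^ k                                        ≡⟨ lem₀ (n * n ^ k) ⟩
      2 * (n * n ^ k)                                              ≡⟨ cong (2 *_) (Σᵥ-const {n} (n ^ k)) ⟨
      2 * Σᵥ {n} (λ _ → n ^ k)                                     ≤⟨ *-monoʳ-≤ 2 (∑-mono (verts n) (codense w)) ⟩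
      2 * Σᵥ (λ v → K * Σₛ (λ f → lk G w f * lk G v f))            ≡⟨ cong (2 *_) (trans (∑-*ˡ (verts n) K _) (cong (K *_) (trans (∑-swap (verts n) (allSubsets n) _) (∑-cong (allSubsets n) (λ f → ∑-*ˡ (verts n) (lk G w f) _))))) ⟩
      2 * (K * Σₛ (λ f → lk G w f * codeg′ f))                     ≡⟨ trans (sym (*-assoc 2 K _)) (trans (sym (∑-*ˡ (allSubsets n) (2 * K) _)) (∑-cong (allSubsets n) (λ f → lem₁ (2 * K) (lk G w f) (codeg′ f)))) ⟩
      Σₛ (λ f → lk G w f * (2 * K * codeg′ f))                     ≤⟨ ∑-mono (allSubsets n) (λ f → *-monoʳ-≤ (lk G w f) (2Kcodeg′≤ f)) ⟩
      Σₛ (λ f → lk G w f * (2 * K * n * 𝟙 (rich f) + n))           ≡⟨ trans (∑-cong (allSubsets n) (λ f → lem₂ (lk G w f) (2 * K) n (𝟙 (rich f)))) (trans (∑-+ (allSubsets n) _ _) (cong₂ _+_ (∑-*ˡ (allSubsets n) (n * (2 * K)) _) (∑-*ˡ (allSubsets n) n _))) ⟩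
      n * (2 * K) * Σₛ (λ f → lk G w f * 𝟙 (rich f)) + n * Σₛ (lk G w) ≤⟨ +-mono-≤ (≤-reflexive (*-assoc n (2 * K) _)) (*-monoʳ-≤ n (Σlk≤ w)) ⟩
      n * (2 * K * Σₛ (λ f → lk G w f * 𝟙 (rich f))) + n * n ^ k   ∎))
      where
      open ≤-Reasoning
      lem₀ : ∀ x → x + x ≡ 2 * x
      lem₀ = ring
      lem₁ : ∀ a b c → a * (b * c) ≡ b * (a * c)
      lem₁ = ring
      lem₂ : ∀ l K n r → l * (K * n * r + n) ≡ n * K * (l * r) + n * l
      lem₂ = ring

    -- Each blocked vertex lies in at most n^k′ sets of the link, so too few of them are spoilt to
    -- exhaust the rich ones.
    find-rich : ∀ w c → 2 * K * Σᵥ c < n → ∃ λ f → 0 < lk G w f × rich f ≡ true × 0 < avoid f c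
    find-rich w c small = conclude (∑-pos⇒∃ (allSubsets n) (λ f → lk G w f * 𝟙 (rich f) * avoid f c) (n≢0⇒n>0 none))
      where
      conclude : (∃ λ f → 0 < lk G w f * 𝟙 (rich f) * avoid f c) → ∃ λ f → 0 < lk G w f × rich f ≡ true × 0 < avoid f c
      conclude (f , pos) with *-pos⁻¹ (lk G w f * 𝟙 (rich f)) (avoid f c) pos
      ... | pos′ , av with *-pos⁻¹ (lk G w f) (𝟙 (rich f)) pos′
      ...   | l , r = f , l , 𝟙-true r , av
      none : Σₛ (λ f → lk G w f * 𝟙 (rich f) * avoid f c) ≢ 0
      none ≡0 = contradiction (begin-strict
        n * n ^ k′                                                     ≤⟨ rich-link w ⟩
        2 * K * Σₛ (λ f → lk G w f * 𝟙 (rich f))                       ≤⟨ *-monoʳ-≤ (2 * K) (∑-mono (allSubsets n) pointwise) ⟩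
        2 * K * Σₛ (λ f → lk G w f * 𝟙 (rich f) * avoid f c + lk G w f * meet f c) ≡⟨ cong (2 * K *_) (trans (∑-+ (allSubsets n) _ _) (cong (_+ Σₛ (λ f → lk G w f * meet f c)) ≡0)) ⟩
        2 * K * Σₛ (λ f → lk G w f * meet f c)                         ≤⟨ *-monoʳ-≤ (2 * K) (Σlk-meet≤ w c) ⟩
        2 * K * (Σᵥ c * n ^ k′)                                        ≡⟨ *-assoc (2 * K) (Σᵥ c) (n ^ k′) ⟨
        2 * K * Σᵥ c * n ^ k′                                          <⟨ *-monoˡ-< (n ^ k′) {{m^n≢0 n k′ {{>-nonZero 0<n}}}} small ⟩
        n * n ^ k′                                                     ∎) (n≮n _)
        where
        open ≤-Reasoning
        pointwise : ∀ f → lk G w f * 𝟙 (rich f) ≤ lk G w f * 𝟙 (rich f) * avoid f c + lk G w f * meet f c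
        pointwise f = begin
          lk G w f * 𝟙 (rich f)                                        ≡⟨ *-identityʳ _ ⟨
          lk G w f * 𝟙 (rich f) * 1                                    ≤⟨ *-monoʳ-≤ (lk G w f * 𝟙 (rich f)) (1≤a+iszero (meet f c)) ⟩
          lk G w f * 𝟙 (rich f) * (meet f c + avoid f c)               ≡⟨ lem (lk G w f) (𝟙 (rich f)) (meet f c) (avoid f c) ⟩
          lk G w f * 𝟙 (rich f) * avoid f c + lk G w f * 𝟙 (rich f) * meet f c
            ≤⟨ +-monoʳ-≤ _ (*-monoˡ-≤ (meet f c) (≤-trans (*-monoʳ-≤ (lk G w f) (𝟙≤1 (rich f))) (≤-reflexive (*-identityʳ (lk G w f))))) ⟩
          lk G w f * 𝟙 (rich f) * avoid f c + lk G w f * meet f c      ∎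
          where
          lem : ∀ l r m a → l * r * (m + a) ≡ l * r * a + l * r * m
          lem = ring

    allowed : (Fin n → ℕ) → Subset n → Fin n → ℕ
    allowed c f w = lk G w f * avoid (f ∪ ⁅ w ⁆) c

    helps : Fin n → Subset n → Subset n → Fin n → ℕ
    helps v f* f w = lk G v f * lk G w f*

    meet-insert : ∀ w f c → 0 < lk G w f → meet (f ∪ ⁅ w ⁆) c ≡ meet f c + c w
    meet-insert w f c pos = begin
      Σᵥ (λ u → ι (f ∪ ⁅ w ⁆) u * c u)            ≡⟨ ∑-cong (verts n) (λ u → trans (cong (_* c u) (∉⇒ι-insert f w u (lk-∉ G w f pos))) (*-distribʳ-+ (c u) (ι f u) (δ w u))) ⟩
      Σᵥ (λ u → ι f u * c u + δ w u * c u)        ≡⟨ ∑-+ (verts n) _ _ ⟩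
      meet f c + Σᵥ (λ u → δ w u * c u)           ≡⟨ cong (meet f c +_) (Σᵥ-δ w c) ⟩
      meet f c + c w                              ∎
      where open ≡-Reasoning

    -- A union bound over the blocked vertices, which a token meets in `f` or in `w`; both cases
    -- contribute the same amount.
    blocked≤ : ∀ c → Σₛ (λ f → Σᵥ (λ w → lk G w f * (meet f c + c w))) ≤ 2 * (Σᵥ c * n ^ k)
    blocked≤ c = begin
      Σₛ (λ f → Σᵥ (λ w → lk G w f * (meet f c + c w)))                    ≡⟨ ∑-cong (allSubsets n) (λ f → trans (∑-cong (verts n) (λ w → *-distribˡ-+ (lk G w f) (meet f c) (c w))) (∑-+ (verts n) _ _)) ⟩
      Σₛ (λ f → Σᵥ (λ w → lk G w f * meet f c) + Σᵥ (λ w → lk G w f * c w)) ≡⟨ ∑-+ (allSubsets n) _ _ ⟩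
      Σₛ (λ f → Σᵥ (λ w → lk G w f * meet f c)) + Σₛ (λ f → Σᵥ (λ w → lk G w f * c w)) ≡⟨ cong₂ _+_ (∑-swap (allSubsets n) (verts n) _) (∑-swap (allSubsets n) (verts n) _) ⟩
      Σᵥ (λ w → Σₛ (λ f → lk G w f * meet f c)) + Σᵥ (λ w → Σₛ (λ f → lk G w f * c w))
        ≤⟨ +-mono-≤ (∑-mono (verts n) (λ w → Σlk-meet≤ w c)) (∑-mono (verts n) (λ w → ≤-trans (≤-reflexive (∑-*ʳ (allSubsets n) (c w) _)) (≤-trans (*-monoˡ-≤ (c w) (Σlk≤ w)) (≤-reflexive (*-comm (n ^ k) (c w)))))) ⟩
      Σᵥ {n} (λ w → Σᵥ c * n ^ k′) + Σᵥ (λ w → c w * n ^ k)                ≡⟨ cong₂ _+_ (Σᵥ-const {n} (Σᵥ c * n ^ k′)) (∑-*ʳ (verts n) (n ^ k) c) ⟩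
      n * (Σᵥ c * n ^ k′) + Σᵥ c * n ^ k                                   ≡⟨ lem n (Σᵥ c) (n ^ k′) ⟩
      2 * (Σᵥ c * n ^ k)                                                   ∎
      where
      open ≤-Reasoning
      lem : ∀ n c x → n * (c * x) + c * (n * x) ≡ 2 * (c * (n * x))
      lem = ring

    -- Take for `w` any of the n / (2K) completions of the rich set `f*`, then for `f` any of the
    -- n^k / K sets in the common link of `v` and `w`. At most half of these tokens are blocked.
    helpers-dense : ∀ c v f* → rich f* ≡ true → 8 * (K * K) * Σᵥ c ≤ n →
                    n * n ^ k ≤ 4 * (K * K) * Σₛ (λ f → Σᵥ (λ w → allowed c f w * helps v f* f w))
    helpers-dense c v f* r small = +-cancelʳ-≤ (n * n ^ k) _ _ (begin
      n * n ^ k + n * n ^ k                              ≡⟨ lem₀ (n * n ^ k) ⟩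
      2 * (n * n ^ k)                                    ≤⟨ *-monoʳ-≤ 2 (*-monoˡ-≤ (n ^ k) (rich⇒ f* r)) ⟩
      2 * (2 * K * codeg′ f* * n ^ k)                    ≡⟨ cong (2 *_) (trans (*-assoc (2 * K) _ _) (cong (2 * K *_) (sym (∑-*ʳ (verts n) (n ^ k) _)))) ⟩
      2 * (2 * K * Σᵥ (λ w → lk G w f* * n ^ k))         ≤⟨ *-monoʳ-≤ 2 (*-monoʳ-≤ (2 * K) (∑-mono (verts n) (λ w → *-monoʳ-≤ (lk G w f*) (codense v w)))) ⟩
      2 * (2 * K * Σᵥ (λ w → lk G w f* * (K * Σₛ (λ f → lk G v f * lk G w f))))
        ≡⟨ cong (λ x → 2 * (2 * K * x)) (trans (∑-cong (verts n) (λ w → trans (lem₁ (lk G w f*) K _) (cong (K *_) (sym (∑-*ˡ (allSubsets n) (lk G w f*) _))))) (trans (∑-*ˡ (verts n) K _) (cong (K *_) (∑-swap (verts n) (allSubsets n) _)))) ⟩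
      2 * (2 * K * (K * Σₛ (λ f → Σᵥ (λ w → lk G w f* * (lk G v f * lk G w f)))))
        ≤⟨ *-monoʳ-≤ 2 (*-monoʳ-≤ (2 * K) (*-monoʳ-≤ K (∑-mono (allSubsets n) (λ f → ∑-mono (verts n) (pointwise f))))) ⟩
      2 * (2 * K * (K * Σₛ (λ f → Σᵥ (λ w → allowed c f w * helps v f* f w + lk G w f * (meet f c + c w)))))
        ≡⟨ cong (λ x → 2 * (2 * K * (K * x))) (trans (∑-cong (allSubsets n) (λ f → ∑-+ (verts n) _ _)) (∑-+ (allSubsets n) _ _)) ⟩
      2 * (2 * K * (K * (Y + Z)))                        ≡⟨ lem₂ K Y Z ⟩
      4 * (K * K) * Y + 4 * (K * K) * Z                  ≤⟨ +-monoʳ-≤ (4 * (K * K) * Y) (*-monoʳ-≤ (4 * (K * K)) (blocked≤ c)) ⟩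
      4 * (K * K) * Y + 4 * (K * K) * (2 * (Σᵥ c * n ^ k)) ≡⟨ cong (4 * (K * K) * Y +_) (lem₃ (K * K) (Σᵥ c) (n ^ k)) ⟩
      4 * (K * K) * Y + 8 * (K * K) * Σᵥ c * n ^ k       ≤⟨ +-monoʳ-≤ (4 * (K * K) * Y) (*-monoˡ-≤ (n ^ k) small) ⟩
      4 * (K * K) * Y + n * n ^ k                        ∎)
      where
      open ≤-Reasoning
      Y Z : ℕ
      Y = Σₛ (λ f → Σᵥ (λ w → allowed c f w * helps v f* f w))
      Z = Σₛ (λ f → Σᵥ (λ w → lk G w f * (meet f c + c w)))
      lem₀ : ∀ x → x + x ≡ 2 * x
      lem₀ = ring
      lem₁ : ∀ a b c → a * (b * c) ≡ b * (a * c)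
      lem₁ = ring
      lem₂ : ∀ K Y Z → 2 * (2 * K * (K * (Y + Z))) ≡ 4 * (K * K) * Y + 4 * (K * K) * Z
      lem₂ = ring
      lem₃ : ∀ K c x → 4 * K * (2 * (c * x)) ≡ 8 * K * c * x
      lem₃ = ring
      pointwise : ∀ f w → lk G w f* * (lk G v f * lk G w f) ≤ allowed c f w * helps v f* f w + lk G w f * (meet f c + c w)
      pointwise f w = ≤1-cases (lk G w f) (lk≤1 G w f)
        (λ ≡0 → ≤-trans (≤-reflexive (trans (cong (λ x → lk G w f* * (lk G v f * x)) ≡0) (trans (cong (lk G w f* *_) (*-zeroʳ (lk G v f))) (*-zeroʳ (lk G w f*))))) z≤n)
        λ ≡1 → let m≡ = meet-insert w f c (subst (0 <_) (sym ≡1) z<s) in begin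
          lk G w f* * (lk G v f * lk G w f)                        ≡⟨ lem₅ (lk G w f*) (lk G v f) (lk G w f) ⟩
          lk G w f * helps v f* f w * 1                            ≤⟨ *-monoʳ-≤ (lk G w f * helps v f* f w) (1≤a+iszero (meet (f ∪ ⁅ w ⁆) c)) ⟩
          lk G w f * helps v f* f w * (meet (f ∪ ⁅ w ⁆) c + avoid (f ∪ ⁅ w ⁆) c) ≡⟨ lem₆ (lk G w f) (helps v f* f w) _ _ ⟩
          allowed c f w * helps v f* f w + lk G w f * (helps v f* f w * meet (f ∪ ⁅ w ⁆) c)
            ≤⟨ +-monoʳ-≤ (allowed c f w * helps v f* f w) (*-monoʳ-≤ (lk G w f) (≤-trans (*-monoˡ-≤ _ (*-mono-≤ (lk≤1 G v f) (lk≤1 G w f*))) (≤-reflexive (trans (*-identityˡ _) m≡)))) ⟩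
          allowed c f w * helps v f* f w + lk G w f * (meet f c + c w) ∎
        where
        lem₅ : ∀ a b c → a * (b * c) ≡ c * (b * a) * 1
        lem₅ = ring
        lem₆ : ∀ l h m a → l * h * (m + a) ≡ l * a * h + l * (h * m)
        lem₆ = ring

-- Choosing helper tokens by conditional expectations.

module Helpers where
  open FiniteSums
  open Indicators
  open Covers
  open Cliques
  open Links
  open GreedyMatching using (⊕≤1)
  open import Data.Fin.Subset using (∣_∣; ⁅_⁆; _∪_)
  open import Data.List using (map; length; cartesianProduct)
  open NibbleArithmetic using (*-^)
  open import Data.List.Relation.Unary.All using (All; []; _∷_)
  import Data.List.Relation.Unary.All.Properties as All
  open import Data.Nat using (ℕ; zero; suc; _+_; _*_; _∸_; _^_; _≤_; _<_; z≤n; s≤s; s≤s⁻¹; z<s; _≡ᵇ_; >-nonZero)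
  open import Data.Nat.Properties
  open import Data.Nat.Tactic.RingSolver using () renaming (solve-∀ to ring)
  open import Relation.Binary.PropositionalEquality

  -- Adding one to `h` makes the comparison of sums strict, so some term is strictly smaller and
  -- therefore has positive weight.
  pick≤ : ∀ {A : Set} (xs : List A) (w g h : A → ℕ) → 0 < ∑ xs w → ∑ xs (λ x → w x * g x) ≤ ∑ xs (λ x → w x * h x) →
          ∃ λ x → 0 < w x × g x ≤ h x
  pick≤ xs w g h 0<W le = conclude (∑<⇒∃< xs (λ x → w x * g x) (λ x → w x * suc (h x)) (begin-strict
    ∑ xs (λ x → w x * g x)               ≤⟨ le ⟩
    ∑ xs (λ x → w x * h x)               <⟨ m<n+m _ 0<W ⟩
    ∑ xs w + ∑ xs (λ x → w x * h x)      ≡⟨ ∑-+ xs _ _ ⟨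
    ∑ xs (λ x → w x + w x * h x)         ≡⟨ ∑-cong xs (λ x → sym (*-suc (w x) (h x))) ⟩
    ∑ xs (λ x → w x * suc (h x))         ∎))
    where
    open ≤-Reasoning
    conclude : (∃ λ x → w x * g x < w x * suc (h x)) → ∃ λ x → 0 < w x × g x ≤ h x
    conclude (x , lt) = x , proj₁ (*-pos⁻¹ (w x) (suc (h x)) (≤-trans (s≤s z≤n) lt)) , s≤s⁻¹ (*-cancelˡ-< (w x) _ _ lt)

  -- The splitting is recorded by its effect on all sums, because coverage, hits and validity of
  -- tokens are all read off from sums.
  remove : ∀ {A : Set} (xs : List A) (h : A → ℕ) → 0 < ∑ xs h →
           ∃₂ λ x ys → 0 < h x × (∀ (g : A → ℕ) → ∑ xs g ≡ g x + ∑ ys g)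
  remove (x ∷ xs) h pos with h x in eq
  ... | suc j = x , xs , subst (0 <_) (sym eq) z<s , λ g → refl
  ... | zero with remove xs h pos
  ...   | y , ys , hy , split = y , x ∷ ys , hy , λ g → trans (cong (g x +_) (split g)) (lem (g x) (g y) (∑ ys g))
    where
    lem : ∀ a b c → a + (b + c) ≡ b + (a + c)
    lem = ring

  ∑-all : ∀ {A : Set} {P : A → Set} (xs : List A) (b : A → Bool) → ∑ xs (λ x → 𝟙 (not (b x))) ≡ 0 → (∀ x → b x ≡ true → P x) → All P xs
  ∑-all []       b _  _ = []
  ∑-all (x ∷ xs) b ≡0 f with b x in eq
  ... | true = f x eq ∷ ∑-all xs b ≡0 f

  all-∑ : ∀ {A : Set} {P : A → Set} (xs : List A) (b : A → Bool) → (∀ {x} → P x → b x ≡ true) → All P xs → ∑ xs (λ x → 𝟙 (not (b x))) ≡ 0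
  all-∑ []       b f []         = refl
  all-∑ (x ∷ xs) b f (px ∷ pxs) rewrite f px = all-∑ xs b f pxs

  ∑-product : ∀ {A B : Set} (xs : List A) (ys : List B) (g : A × B → ℕ) →
              ∑ (cartesianProduct xs ys) g ≡ ∑ xs (λ x → ∑ ys (λ y → g (x , y)))
  ∑-product []       ys g = refl
  ∑-product (x ∷ xs) ys g = trans (∑-++ (map (x ,_) ys) _ g) (cong₂ _+_ (∑-map (x ,_) ys g) (∑-product xs ys g))

  -- Bernoulli's inequality for the base 1 + 1 / x, denominators cleared.
  doubling : ∀ x m → (x + m) * x ^ m ≤ x * suc x ^ m
  doubling x zero    = ≤-reflexive (cong (_* 1) (+-identityʳ x))
  doubling x (suc m) = begin
    (x + suc m) * (x * x ^ m)        ≡⟨ lem x m (x ^ m) ⟩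
    x * ((x + m) * x ^ m) + x * x ^ m ≤⟨ +-mono-≤ (*-monoʳ-≤ x (doubling x m)) (*-monoʳ-≤ x (^-monoˡ-≤ m (n≤1+n x))) ⟩
    x * (x * suc x ^ m) + x * suc x ^ m ≡⟨ lem₂ x (suc x ^ m) ⟩
    x * (suc x * suc x ^ m)          ∎
    where
    open ≤-Reasoning
    lem : ∀ x m X → (x + (1 + m)) * (x * X) ≡ x * ((x + m) * X) + x * X
    lem = ring
    lem₂ : ∀ x Y → x * (x * Y) + x * Y ≡ x * ((1 + x) * Y)
    lem₂ = ring

  doubling-suc : ∀ x → 0 < x → 2 * x ^ suc x ≤ suc x ^ suc x
  doubling-suc x 0<x = *-cancelˡ-≤ x {{>-nonZero 0<x}} (begin
    x * (2 * x ^ suc x)           ≡⟨ lem x (x ^ suc x) ⟩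
    (x + x) * x ^ suc x           ≤⟨ *-monoˡ-≤ (x ^ suc x) (+-monoʳ-≤ x (n≤1+n x)) ⟩
    (x + suc x) * x ^ suc x       ≤⟨ doubling x (suc x) ⟩
    x * suc x ^ suc x             ∎)
    where
    open ≤-Reasoning
    lem : ∀ x X → x * (2 * X) ≡ (x + x) * X
    lem = ring

  -- Every `suc x` factors x / (x + 1) cost at least one factor 2.
  doubling-power : ∀ x j → 0 < x → 2 ^ j * x ^ (suc x * j) ≤ suc x ^ (suc x * j)
  doubling-power x zero    _   = subst (λ y → 1 * x ^ y ≤ suc x ^ y) (sym (*-zeroʳ x)) ≤-refl
  doubling-power x (suc j) 0<x = begin
    2 ^ suc j * x ^ (suc x * suc j)                    ≡⟨ cong (λ y → 2 ^ suc j * x ^ y) (*-suc (suc x) j) ⟩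
    2 ^ suc j * x ^ (suc x + suc x * j)                ≡⟨ cong (2 ^ suc j *_) (^-distribˡ-+-* x (suc x) (suc x * j)) ⟩
    2 * 2 ^ j * (x ^ suc x * x ^ (suc x * j))          ≡⟨ lem (2 ^ j) (x ^ suc x) _ ⟩
    (2 * x ^ suc x) * (2 ^ j * x ^ (suc x * j))        ≤⟨ *-mono-≤ (doubling-suc x 0<x) (doubling-power x j 0<x) ⟩
    suc x ^ suc x * suc x ^ (suc x * j)                ≡⟨ ^-distribˡ-+-* (suc x) (suc x) (suc x * j) ⟨
    suc x ^ (suc x + suc x * j)                        ≡⟨ cong (suc x ^_) (*-suc (suc x) j) ⟨
    suc x ^ (suc x * suc j)                            ∎
    where
    open ≤-Reasoning
    lem : ∀ a b c → 2 * a * (b * c) ≡ (2 * b) * (a * c)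
    lem = ring

  module Absorbing {n} {k′ : ℕ} {G : Hypergraph n} {K : ℕ} (𝒟 : DenseLinks k′ G K) (0<K : 0 < K) where
    open DenseLinks 𝒟
    open LinkFacts 𝒟

    Token : Set
    Token = Subset n × Fin n

    edgeOf : Token → Subset n
    edgeOf (f , w) = f ∪ ⁅ w ⁆

    valid : Token → Bool
    valid (f , w) = link G w f

    hit : Fin n → Subset n → Token → ℕ
    hit v f* (f , w) = helps v f* f w

    hit≤1 : ∀ v f* x → hit v f* x ≤ 1
    hit≤1 v f* (f , w) = *-mono-≤ (lk≤1 G v f) (lk≤1 G w f*)

    hits : List Token → Fin n → Subset n → ℕ
    hits F v f* = ∑ F (hit v f*)

    edges : List Token → List (Subset n)
    edges = map edgeOf

    valid⇒lk : ∀ f w → valid (f , w) ≡ true → 0 < lk G w f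
    valid⇒lk f w p = subst (λ b → 0 < 𝟙 b) (sym p) z<s

    ι-edge : ∀ f w u → valid (f , w) ≡ true → ι (f ∪ ⁅ w ⁆) u ≡ ι f u + δ w u
    ι-edge f w u p = ∉⇒ι-insert f w u (lk-∉ G w f (valid⇒lk f w p))

    valid-edges : ∀ {F} → All (λ x → valid x ≡ true) F → All (λ e → G e ≡ true) (edges F)
    valid-edges []               = []
    valid-edges (_∷_ {x = f , w} p ps) = lk-edge G w f (valid⇒lk f w p) ∷ valid-edges ps

    -- Each pair (v , f*) is served by its own helper token (f , w): the edge f ∪ w of the
    -- matching is traded for the two edges f ∪ v and f* ∪ w.
    swap : ∀ (ps : List (Fin n × Subset n)) F →
           All (λ x → valid x ≡ true) F → All (λ p → rich (proj₂ p) ≡ true) ps →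
           (∀ v f* → rich f* ≡ true → length ps ≤ hits F v f*) →
           ∃ λ N → All (λ e → G e ≡ true) N × (∀ u → cover N u ≡ cover (edges F) u + ∑ ps (λ p → ι (proj₂ p) u + δ (proj₁ p) u))
    swap []              F vF _        _    = edges F , valid-edges vF , λ u → sym (+-identityʳ _)
    swap ((v , f*) ∷ ps) F vF (r ∷ rs) many = use (remove F (hit v f*) (≤-trans z<s (many v f* r)))
      where
      use : (∃₂ λ x F′ → 0 < hit v f* x × (∀ g → ∑ F g ≡ g x + ∑ F′ g)) → _
      use ((f , w) , F′ , pos , split) = continue (swap ps F′ vF′ rs many′)
        where
        lk-v : 0 < lk G v f
        lk-v = proj₁ (*-pos⁻¹ (lk G v f) _ pos)
        lk-w : 0 < lk G w f*
        lk-w = proj₂ (*-pos⁻¹ (lk G v f) _ pos)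
        invalid≡0 : 𝟙 (not (valid (f , w))) + ∑ F′ (λ x → 𝟙 (not (valid x))) ≡ 0
        invalid≡0 = trans (sym (split (λ x → 𝟙 (not (valid x))))) (all-∑ F valid (λ p → p) vF)
        vx : valid (f , w) ≡ true
        vx with valid (f , w) | invalid≡0
        ... | true | _ = refl
        vF′ : All (λ x → valid x ≡ true) F′
        vF′ = ∑-all F′ valid (m+n≡0⇒n≡0 (𝟙 (not (valid (f , w)))) invalid≡0) (λ x p → p)
        -- A used token lowers any hit count by at most one, and the number of pairs still to be
        -- served falls by one as well.
        many′ : ∀ v f* → rich f* ≡ true → length ps ≤ hits F′ v f*
        many′ v f* r = s≤s⁻¹ (≤-trans (many v f* r) (≤-trans (≤-reflexive (split (hit v f*))) (+-monoˡ-≤ _ (hit≤1 v f* (f , w)))))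
        ∑-edges : ∀ F u → cover (edges F) u ≡ ∑ F (λ x → ι (edgeOf x) u)
        ∑-edges F u = ∑-map edgeOf F (λ e → ι e u)
        continue : _ → _
        continue (N , GN , cov) = f ∪ ⁅ v ⁆ ∷ f* ∪ ⁅ w ⁆ ∷ N , lk-edge G v f lk-v ∷ lk-edge G w f* lk-w ∷ GN , λ u → begin
          ι (f ∪ ⁅ v ⁆) u + (ι (f* ∪ ⁅ w ⁆) u + cover N u)
            ≡⟨ cong₂ _+_ (∉⇒ι-insert f v u (lk-∉ G v f lk-v)) (cong₂ _+_ (∉⇒ι-insert f* w u (lk-∉ G w f* lk-w)) (cov u)) ⟩
          ι f u + δ v u + (ι f* u + δ w u + (cover (edges F′) u + ∑ ps (λ p → ι (proj₂ p) u + δ (proj₁ p) u)))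
            ≡⟨ lem (ι f u) (δ v u) (ι f* u) (δ w u) (cover (edges F′) u) _ ⟩
          ι f u + δ w u + cover (edges F′) u + (ι f* u + δ v u + ∑ ps (λ p → ι (proj₂ p) u + δ (proj₁ p) u))
            ≡⟨ cong (_+ (ι f* u + δ v u + ∑ ps (λ p → ι (proj₂ p) u + δ (proj₁ p) u)))
                 (sym (trans (∑-edges F u) (trans (split (λ x → ι (edgeOf x) u)) (cong₂ _+_ (ι-edge f w u vx) (sym (∑-edges F′ u)))))) ⟩
          cover (edges F) u + (ι f* u + δ v u + ∑ ps (λ p → ι (proj₂ p) u + δ (proj₁ p) u)) ∎
          where
          open ≡-Reasoning
          lem : ∀ a b c d e g → a + b + (c + d + (e + g)) ≡ a + d + e + (c + b + g)
          lem = ring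

    tests : Subset n → ℕ
    tests f* = 𝟙 (rich f*) * 𝟙 (∣ f* ∣ ≡ᵇ k)

    weight : List Token → Fin n → Subset n → ℕ
    weight []      v f* = 1
    weight (x ∷ F) v f* = (2 ∸ hit v f* x) * weight F v f*

    weight-hits : ∀ F v f* → weight F v f* * 2 ^ hits F v f* ≡ 2 ^ length F
    weight-hits []      v f* = refl
    weight-hits (x ∷ F) v f* = ≤1-cases (hit v f* x) (hit≤1 v f* x)
      (λ ≡0 → trans (cong (λ h → (2 ∸ h) * weight F v f* * 2 ^ (h + hits F v f*)) ≡0) (trans (*-assoc 2 (weight F v f*) (2 ^ hits F v f*)) (cong (2 *_) (weight-hits F v f*))))
      (λ ≡1 → trans (cong (λ h → (2 ∸ h) * weight F v f* * 2 ^ (h + hits F v f*)) ≡1) (trans (lem (weight F v f*) (2 ^ hits F v f*)) (cong (2 *_) (weight-hits F v f*))))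
      where
      lem : ∀ w h → 1 * w * (2 * h) ≡ 2 * (w * h)
      lem = ring

    -- The method of conditional expectations: a test that has been hit h times by the helpers
    -- chosen so far contributes 2 ^ (length F ∸ h).
    Ψ : List Token → ℕ
    Ψ F = Σᵥ (λ v → Σₛ (λ f* → tests f* * weight F v f*))

    saving : List Token → Token → ℕ
    saving F x = Σᵥ (λ v → Σₛ (λ f* → tests f* * weight F v f* * hit v f* x))

    -- A test that is missed doubles and a test that is hit keeps its weight, so the saving is the
    -- weight of the tests hit.
    Ψ-step : ∀ F x → Ψ (x ∷ F) + saving F x ≡ 2 * Ψ F
    Ψ-step F x = begin
      Ψ (x ∷ F) + saving F x     ≡⟨ ∑-+ (verts n) _ _ ⟨
      Σᵥ (λ v → Σₛ (λ f* → tests f* * weight (x ∷ F) v f*) + Σₛ (λ f* → tests f* * weight F v f* * hit v f* x))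
        ≡⟨ ∑-cong (verts n) (λ v → trans (sym (∑-+ (allSubsets n) _ _)) (trans (∑-cong (allSubsets n) (pointwise v)) (∑-*ˡ (allSubsets n) 2 _))) ⟩
      Σᵥ (λ v → 2 * Σₛ (λ f* → tests f* * weight F v f*))   ≡⟨ ∑-*ˡ (verts n) 2 _ ⟩
      2 * Ψ F                    ∎
      where
      open ≡-Reasoning
      lem : ∀ t a w h → t * (a * w) + t * w * h ≡ (a + h) * (t * w)
      lem = ring
      pointwise : ∀ v f* → tests f* * weight (x ∷ F) v f* + tests f* * weight F v f* * hit v f* x ≡ 2 * (tests f* * weight F v f*)
      pointwise v f* = trans (lem (tests f*) (2 ∸ hit v f* x) (weight F v f*) (hit v f* x))
        (cong (_* (tests f* * weight F v f*)) (m∸n+n≡m (≤-trans (hit≤1 v f* x) (s≤s z≤n))))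

    a : ℕ
    a = 4 * (K * K)

    Ψ[]≤ : Ψ [] ≤ n * n ^ k
    Ψ[]≤ = ≤-trans (∑-mono (verts n) (λ v → ≤-trans (∑-mono (allSubsets n) (λ f* → ≤-trans (≤-reflexive (*-identityʳ _))
        (≤-trans (*-monoˡ-≤ (𝟙 (∣ f* ∣ ≡ᵇ k)) (𝟙≤1 (rich f*))) (≤-reflexive (*-identityˡ _))))) (sets≤ {n} k)))
      (≤-reflexive (Σᵥ-const {n} (n ^ k)))

    allowed-count : ∀ c → Σₛ (λ f → Σᵥ (allowed c f)) ≤ n * n ^ k
    allowed-count c = begin
      Σₛ (λ f → Σᵥ (allowed c f))    ≤⟨ ∑-mono (allSubsets n) (λ f → ∑-mono (verts n) (λ w → ≤-trans (*-monoʳ-≤ (lk G w f) (iszero≤1 (meet (f ∪ ⁅ w ⁆) c))) (≤-reflexive (*-identityʳ (lk G w f))))) ⟩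
      Σₛ (λ f → Σᵥ (λ w → lk G w f)) ≡⟨ ∑-swap (allSubsets n) (verts n) _ ⟩
      Σᵥ (λ w → Σₛ (lk G w))         ≤⟨ ∑-mono (verts n) Σlk≤ ⟩
      Σᵥ {n} (λ w → n ^ k)           ≡⟨ Σᵥ-const {n} (n ^ k) ⟩
      n * n ^ k                      ∎
      where open ≤-Reasoning

    -- By `helpers-dense` at least n^q / `a` allowed tokens hit any given rich test; weighting this
    -- by the current contributions and summing over the tests bounds the total saving.
    total-saving : ∀ c F → 8 * (K * K) * Σᵥ c ≤ n →
      n * n ^ k * Ψ F ≤ a * Σₛ (λ f → Σᵥ (λ w → allowed c f w * saving F (f , w)))
    total-saving c F small = begin
      n * n ^ k * Ψ F
        ≡⟨ trans (sym (∑-*ˡ (verts n) (n * n ^ k) _)) (∑-cong (verts n) (λ v → sym (∑-*ˡ (allSubsets n) (n * n ^ k) _))) ⟩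
      Σᵥ (λ v → Σₛ (λ f* → n * n ^ k * (tests f* * weight F v f*)))
        ≤⟨ ∑-mono (verts n) (λ v → ∑-mono (allSubsets n) (cell v)) ⟩
      Σᵥ (λ v → Σₛ (λ f* → a * Σₛ (λ f → Σᵥ (λ w → allowed c f w * (tests f* * weight F v f* * hit v f* (f , w))))))
        ≡⟨ trans (∑-cong (verts n) (λ v → ∑-*ˡ (allSubsets n) a _)) (∑-*ˡ (verts n) a _) ⟩
      a * Σᵥ (λ v → Σₛ (λ f* → Σₛ (λ f → Σᵥ (λ w → allowed c f w * (tests f* * weight F v f* * hit v f* (f , w))))))
        ≡⟨ cong (a *_) exchange ⟩
      a * Σₛ (λ f → Σᵥ (λ w → allowed c f w * saving F (f , w))) ∎
      where
      open ≤-Reasoning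
      lem : ∀ x y z → x * (y * z) ≡ y * (x * z)
      lem = ring
      cell : ∀ v f* → n * n ^ k * (tests f* * weight F v f*) ≤ a * Σₛ (λ f → Σᵥ (λ w → allowed c f w * (tests f* * weight F v f* * hit v f* (f , w))))
      cell v f* with rich f* in r
      ... | false = ≤-trans (≤-reflexive (*-zeroʳ (n * n ^ k))) z≤n
      ... | true  = begin
        n * n ^ k * W                                                   ≤⟨ *-monoˡ-≤ W (helpers-dense c v f* r small) ⟩
        a * Σₛ (λ f → Σᵥ (λ w → allowed c f w * hit v f* (f , w))) * W  ≡⟨ *-assoc a _ W ⟩
        a * (Σₛ (λ f → Σᵥ (λ w → allowed c f w * hit v f* (f , w))) * W) ≡⟨ cong (a *_) (trans (sym (∑-*ʳ (allSubsets n) W _)) (∑-cong (allSubsets n) (λ f → trans (sym (∑-*ʳ (verts n) W _)) (∑-cong (verts n) (λ w → lem₂ (allowed c f w) (hit v f* (f , w)) W))))) ⟩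
        a * Σₛ (λ f → Σᵥ (λ w → allowed c f w * (W * hit v f* (f , w)))) ∎
        where
        W = 1 * 𝟙 (∣ f* ∣ ≡ᵇ k) * weight F v f*
        lem₂ : ∀ x y z → x * y * z ≡ x * (z * y)
        lem₂ = ring
      H : Fin n → Subset n → Subset n → Fin n → ℕ
      H v f* f w = allowed c f w * (tests f* * weight F v f* * hit v f* (f , w))
      exchange : Σᵥ (λ v → Σₛ (λ f* → Σₛ (λ f → Σᵥ (H v f* f)))) ≡ Σₛ (λ f → Σᵥ (λ w → allowed c f w * saving F (f , w)))
      exchange =
        trans (∑-cong (verts n) (λ v → ∑-swap (allSubsets n) (allSubsets n) _))
        (trans (∑-swap (verts n) (allSubsets n) _)
        (∑-cong (allSubsets n) (λ f →
          trans (∑-cong (verts n) (λ v → ∑-swap (allSubsets n) (verts n) _))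
          (trans (∑-swap (verts n) (verts n) _)
          (∑-cong (verts n) (λ w →
            trans (∑-cong (verts n) (λ v → ∑-*ˡ (allSubsets n) (allowed c f w) _)) (∑-*ˡ (verts n) (allowed c f w) _)))))))

    2K≤8KK : 2 * K ≤ 8 * (K * K)
    2K≤8KK = *-mono-≤ {2} {8} (s≤s (s≤s z≤n)) (≤-trans (≤-reflexive (sym (*-identityʳ K))) (*-monoʳ-≤ K 0<K))

    0<allowed : ∀ c → 8 * (K * K) * Σᵥ c ≤ n → (v₀ : Fin n) → 0 < Σₛ (λ f → Σᵥ (allowed c f))
    0<allowed c small v₀ = n≢0⇒n>0 λ ≡0 → contradiction (begin-strict
        0                        <⟨ *-mono-≤ 0<n (m^n>0 n {{>-nonZero 0<n}} k) ⟩
        n * n ^ k                ≤⟨ helpers-dense c v₀ f* r small ⟩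
        a * Σₛ (λ f → Σᵥ (λ w → allowed c f w * helps v₀ f* f w))
          ≤⟨ *-monoʳ-≤ a (∑-mono (allSubsets n) (λ f → ∑-mono (verts n) (λ w → ≤-trans (*-monoʳ-≤ (allowed c f w) (hit≤1 v₀ f* (f , w))) (≤-reflexive (*-identityʳ _))))) ⟩
        a * Σₛ (λ f → Σᵥ (allowed c f)) ≡⟨ trans (cong (a *_) ≡0) (*-zeroʳ a) ⟩
        0                        ∎) (n≮n 0)
      where
      open ≤-Reasoning
      some-rich : ∃ λ f → 0 < lk G v₀ f × rich f ≡ true × 0 < avoid f (λ _ → 0)
      some-rich = find-rich v₀ (λ _ → 0) (subst (_< n) (sym (trans (cong (2 * K *_) (∑-zero (verts n))) (*-zeroʳ (2 * K)))) 0<n)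
      f* : Subset n
      f* = proj₁ some-rich
      r : rich f* ≡ true
      r = proj₁ (proj₂ (proj₂ some-rich))

    choose-token : ∀ c F → 8 * (K * K) * Σᵥ c ≤ n → Fin n → ∃ λ x → valid x ≡ true × 0 < avoid (edgeOf x) c × Ψ F ≤ a * saving F x
    choose-token c F small v₀ = conclude (pick≤ tokens (λ (f , w) → allowed c f w) (λ _ → Ψ F) (λ x → a * saving F x)
        (subst (0 <_) (sym (∑-product (allSubsets n) (verts n) _)) (0<allowed c small v₀)) average-saving)
      where
      tokens : List Token
      tokens = cartesianProduct (allSubsets n) (verts n)
      lem : ∀ x y z → x * (y * z) ≡ y * (x * z)
      lem = ring
      average-saving : ∑ tokens (λ (f , w) → allowed c f w * Ψ F) ≤ ∑ tokens (λ (f , w) → allowed c f w * (a * saving F (f , w)))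
      average-saving = begin
        ∑ tokens (λ (f , w) → allowed c f w * Ψ F)    ≡⟨ ∑-*ʳ tokens (Ψ F) _ ⟩
        ∑ tokens (λ (f , w) → allowed c f w) * Ψ F    ≡⟨ cong (_* Ψ F) (∑-product (allSubsets n) (verts n) _) ⟩
        Σₛ (λ f → Σᵥ (allowed c f)) * Ψ F             ≤⟨ *-monoˡ-≤ (Ψ F) (allowed-count c) ⟩
        n * n ^ k * Ψ F                               ≤⟨ total-saving c F small ⟩
        a * Σₛ (λ f → Σᵥ (λ w → allowed c f w * saving F (f , w))) ≡⟨ cong (a *_) (∑-product (allSubsets n) (verts n) _) ⟨
        a * ∑ tokens (λ (f , w) → allowed c f w * saving F (f , w)) ≡⟨ ∑-*ˡ tokens a _ ⟨
        ∑ tokens (λ (f , w) → a * (allowed c f w * saving F (f , w))) ≡⟨ ∑-cong tokens (λ (f , w) → lem a (allowed c f w) _) ⟩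
        ∑ tokens (λ (f , w) → allowed c f w * (a * saving F (f , w))) ∎
        where open ≤-Reasoning
      conclude : (∃ λ x → 0 < allowed c (proj₁ x) (proj₂ x) × Ψ F ≤ a * saving F x) → _
      conclude ((f , w) , pos , save) = (f , w) , 𝟙-true (proj₁ (*-pos⁻¹ (lk G w f) _ pos)) , proj₂ (*-pos⁻¹ (lk G w f) _ pos) , save

    token-size : ∀ f w → valid (f , w) ≡ true → ∣ f ∪ ⁅ w ⁆ ∣ ≡ q
    token-size f w p = uniform _ (lk-edge G w f (valid⇒lk f w p))

    Σcover-edges : ∀ {F} → All (λ x → valid x ≡ true) F → Σᵥ (cover (edges F)) ≡ length F * q
    Σcover-edges []                            = ∑-zero (verts n)
    Σcover-edges (_∷_ {x = f , w} {xs = F} p ps) = trans (∑-+ (verts n) _ _)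
      (cong₂ _+_ (trans (Σᵥ-ι (f ∪ ⁅ w ⁆)) (token-size f w p)) (Σcover-edges ps))

    -- A well chosen token multiplies `Ψ` by at most 2 - 1 / a, which is `x₀` / a, while the
    -- contribution of a test that is missed doubles.
    x₀ : ℕ
    x₀ = 2 * a ∸ 1

    suc-x₀ : suc x₀ ≡ 2 * a
    suc-x₀ = m+[n∸m]≡n (*-mono-≤ {1} {2} (s≤s z≤n) (*-mono-≤ {1} {4} (s≤s z≤n) (*-mono-≤ 0<K 0<K)))

    HelperFamily : (Fin n → ℕ) → ℕ → Set
    HelperFamily c j = ∃ λ F → All (λ x → valid x ≡ true) F × length F ≡ j × (∀ v → c v + cover (edges F) v ≤ 1) ×
                       a ^ j * Ψ F ≤ x₀ ^ j * (n * n ^ k)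

    helper-family : ∀ c j → (∀ v → c v ≤ 1) → 8 * (K * K) * (Σᵥ c + j * q) ≤ n → Fin n → HelperFamily c j
    helper-family c zero    c≤1 small v₀ = [] , [] , refl , (λ v → subst (_≤ 1) (sym (+-identityʳ (c v))) (c≤1 v)) , *-monoʳ-≤ 1 Ψ[]≤
    helper-family c (suc j) c≤1 small v₀ = extend (helper-family c j c≤1 (≤-trans (*-monoʳ-≤ (8 * (K * K)) (+-monoʳ-≤ (Σᵥ c) (m≤n+m (j * q) q))) small) v₀)
      where
      extend : HelperFamily c j → HelperFamily c (suc j)
      extend (F , vF , len , ≤1 , Ψ≤) = add (choose-token c′ F small′ v₀)
        where
        c′ : Fin n → ℕ
        c′ v = c v + cover (edges F) v
        small′ : 8 * (K * K) * Σᵥ c′ ≤ n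
        small′ = ≤-trans (*-monoʳ-≤ (8 * (K * K)) (≤-trans (≤-reflexive (trans (∑-+ (verts n) _ _) (cong (Σᵥ c +_) (trans (Σcover-edges vF) (cong (_* q) len))))) (+-monoʳ-≤ (Σᵥ c) (m≤n+m (j * q) q)))) small
        add : (∃ λ x → valid x ≡ true × 0 < avoid (edgeOf x) c′ × Ψ F ≤ a * saving F x) → HelperFamily c (suc j)
        add (x , vx , av , save) = x ∷ F , vx ∷ vF , cong suc len ,
          (λ v → subst (_≤ 1) (lem (c v) (cover (edges F) v) (ι (edgeOf x) v)) (⊕≤1 c′ (edgeOf x) av ≤1 v)) , (begin
          a * a ^ j * Ψ (x ∷ F)          ≡⟨ lem₁ a (a ^ j) (Ψ (x ∷ F)) ⟩
          a ^ j * (a * Ψ (x ∷ F))        ≤⟨ *-monoʳ-≤ (a ^ j) Ψ-decrease ⟩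
          a ^ j * (x₀ * Ψ F)             ≡⟨ lem₂ (a ^ j) x₀ (Ψ F) ⟩
          x₀ * (a ^ j * Ψ F)             ≤⟨ *-monoʳ-≤ x₀ Ψ≤ ⟩
          x₀ * (x₀ ^ j * (n * n ^ k))    ≡⟨ *-assoc x₀ (x₀ ^ j) _ ⟨
          x₀ * x₀ ^ j * (n * n ^ k)      ∎)
          where
          open ≤-Reasoning
          lem : ∀ a b c → a + b + c ≡ a + (c + b)
          lem = ring
          lem₁ : ∀ a b c → a * b * c ≡ b * (a * c)
          lem₁ = ring
          lem₂ : ∀ a b c → a * (b * c) ≡ b * (a * c)
          lem₂ = ring
          lem₃ : ∀ a b → a * (2 * b) ≡ 2 * a * b
          lem₃ = ring
          Ψ-decrease : a * Ψ (x ∷ F) ≤ x₀ * Ψ F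
          Ψ-decrease = +-cancelʳ-≤ (Ψ F) _ _ (begin
            a * Ψ (x ∷ F) + Ψ F                ≤⟨ +-monoʳ-≤ (a * Ψ (x ∷ F)) save ⟩
            a * Ψ (x ∷ F) + a * saving F x     ≡⟨ *-distribˡ-+ a _ _ ⟨
            a * (Ψ (x ∷ F) + saving F x)       ≡⟨ cong (a *_) (Ψ-step F x) ⟩
            a * (2 * Ψ F)                      ≡⟨ lem₃ a (Ψ F) ⟩
            2 * a * Ψ F                        ≡⟨ cong (_* Ψ F) suc-x₀ ⟨
            Ψ F + x₀ * Ψ F                     ≡⟨ +-comm (Ψ F) (x₀ * Ψ F) ⟩
            x₀ * Ψ F + Ψ F                     ∎)

    rich-size : ∀ f → rich f ≡ true → ∣ f ∣ ≡ k
    rich-size f r = size (∑-pos⇒∃ (verts n) (λ w → lk G w f) (proj₂ (*-pos⁻¹ (2 * K) _ (≤-trans 0<n (rich⇒ f r)))))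
      where
      size : (∃ λ w → 0 < lk G w f) → ∣ f ∣ ≡ k
      size (w , pos) = lk-size w f pos

    weight≤Ψ : ∀ F v f* → rich f* ≡ true → weight F v f* ≤ Ψ F
    weight≤Ψ F v f* r = ≤-trans (≤-trans (≤-reflexive (sym (trans (cong (_* weight F v f*) tests≡1) (*-identityˡ _))))
        (Σₛ-lookup (λ f* → tests f* * weight F v f*) f*))
      (Σᵥ-lookup (λ v → Σₛ (λ f* → tests f* * weight F v f*)) v)
      where
      tests≡1 : tests f* ≡ 1
      tests≡1 = cong₂ (λ a b → 𝟙 a * 𝟙 b) r (≡⇒≡ᵇ-true ∣ f* ∣ k (rich-size f* r))

    -- After s = `suc x₀ * (ℓ + ℓ)` tokens, `doubling-power` gives that `Ψ` is at most n^q 2^(s -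
    -- 2ℓ), hence at most 2^(s - ℓ), while a single test with h hits contributes 2^(s - h).
    many-hits : ∀ {c} ℓ ((F , _) : HelperFamily c (suc x₀ * (ℓ + ℓ))) → n * n ^ k ≤ 2 ^ ℓ → ∀ v f* → rich f* ≡ true → ℓ ≤ hits F v f*
    many-hits ℓ (F , _ , len , _ , Ψ≤) N≤ v f* r with ℓ ≤? hits F v f*
    ... | yes ok = ok
    ... | no  ¬ok = contradiction (begin-strict
        2 ^ ℓ                ≤⟨ *-cancelʳ-≤ (2 ^ ℓ) (2 ^ h) (2 ^ ℓ) {{m^n≢0 2 ℓ}} doubled ⟩
        2 ^ h                <⟨ ^-monoʳ-< 2 (s≤s (s≤s z≤n)) (≰⇒> ¬ok) ⟩
        2 ^ ℓ                ∎) (n≮n _)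
      where
      open ≤-Reasoning
      h s : ℕ
      h = hits F v f*
      s = suc x₀ * (ℓ + ℓ)
      0<x₀ : 0 < x₀
      0<x₀ = s≤s⁻¹ (≤-trans (*-mono-≤ {2} {2} ≤-refl (*-mono-≤ {1} {4} (s≤s z≤n) (*-mono-≤ 0<K 0<K))) (≤-reflexive (sym suc-x₀)))
      lem₁ : ∀ A w H → A * (w * H) ≡ H * (A * w)
      lem₁ = ring
      lem₂ : ∀ a b c → a * (b * c) ≡ a * c * b
      lem₂ = ring
      doubled : 2 ^ ℓ * 2 ^ ℓ ≤ 2 ^ h * 2 ^ ℓ
      doubled = *-cancelʳ-≤ _ _ (x₀ ^ s) {{m^n≢0 x₀ s {{>-nonZero 0<x₀}}}} (begin
        2 ^ ℓ * 2 ^ ℓ * x₀ ^ s                  ≡⟨ cong (_* x₀ ^ s) (^-distribˡ-+-* 2 ℓ ℓ) ⟨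
        2 ^ (ℓ + ℓ) * x₀ ^ s                    ≤⟨ doubling-power x₀ (ℓ + ℓ) 0<x₀ ⟩
        suc x₀ ^ s                              ≡⟨ cong (_^ s) (trans suc-x₀ (*-comm 2 a)) ⟩
        (a * 2) ^ s                             ≡⟨ *-^ a 2 s ⟩
        a ^ s * 2 ^ s                           ≡⟨ cong (a ^ s *_) (trans (cong (2 ^_) (sym len)) (sym (weight-hits F v f*))) ⟩
        a ^ s * (weight F v f* * 2 ^ h)         ≡⟨ lem₁ (a ^ s) (weight F v f*) (2 ^ h) ⟩
        2 ^ h * (a ^ s * weight F v f*)         ≤⟨ *-monoʳ-≤ (2 ^ h) (≤-trans (*-monoʳ-≤ (a ^ s) (weight≤Ψ F v f* r)) Ψ≤) ⟩
        2 ^ h * (x₀ ^ s * (n * n ^ k))          ≤⟨ *-monoʳ-≤ (2 ^ h) (*-monoʳ-≤ (x₀ ^ s) N≤) ⟩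
        2 ^ h * (x₀ ^ s * 2 ^ ℓ)                ≡⟨ lem₂ (2 ^ h) (x₀ ^ s) (2 ^ ℓ) ⟩
        2 ^ h * 2 ^ ℓ * x₀ ^ s                  ∎)

-- Stars and the absorber.

module Absorbers where
  open FiniteSums
  open Indicators
  open Covers
  open Links
  open Helpers
  open GreedyMatching using (⊕≤1)
  open import Data.Fin.Subset using (∣_∣; ⁅_⁆; _∪_)
  open import Data.List using (_++_; map; length; filterᵇ)
  open import Data.List.Relation.Unary.All using (All; []; _∷_)
  import Data.List.Relation.Unary.All.Properties as All
  open import Data.Nat using (ℕ; zero; suc; _+_; _*_; _^_; _≤_; _<_; z≤n; s≤s; z<s)
  open import Data.Nat.Properties
  open import Data.Nat.Tactic.RingSolver using () renaming (solve-∀ to ring)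
  open import Data.Vec using (lookup)
  open import Relation.Binary.PropositionalEquality

  open import Data.List.Relation.Unary.All.Properties using (++⁺)

  ∑-filter : ∀ {A : Set} (b : A → Bool) (xs : List A) (g : A → ℕ) → ∑ (filterᵇ b xs) g ≡ ∑ xs (λ x → 𝟙 (b x) * g x)
  ∑-filter b []       g = refl
  ∑-filter b (x ∷ xs) g with b x
  ... | true  = cong₂ _+_ (sym (+-identityʳ (g x))) (∑-filter b xs g)
  ... | false = ∑-filter b xs g

  module Starry {n} {k′ : ℕ} {G : Hypergraph n} {K : ℕ} (𝒟 : DenseLinks k′ G K) (0<K : 0 < K) where
    open DenseLinks 𝒟
    open LinkFacts 𝒟
    open Absorbing 𝒟 0<K

    elements : Subset n → List (Fin n)
    elements r = filterᵇ (lookup r) (verts n)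

    ∑-elements : ∀ r g → ∑ (elements r) g ≡ Σᵥ (λ v → ι r v * g v)
    ∑-elements r = ∑-filter (lookup r) (verts n)

    ∑-elements-δ : ∀ r u → ∑ (elements r) (λ w → δ w u) ≡ ι r u
    ∑-elements-δ r u = trans (∑-elements r _) (trans (∑-cong (verts n) (λ v → trans (*-comm (ι r v) (δ v u)) (cong (_* ι r v) (δ-sym v u)))) (Σᵥ-δ u (ι r)))

    length-elements : ∀ r → length (elements r) ≡ ∣ r ∣
    length-elements r = trans (sym (*-identityʳ _)) (trans (sym (∑-const (elements r) 1)) (trans (∑-elements r _) (trans (∑-cong (verts n) (λ v → *-identityʳ (ι r v))) (Σᵥ-ι r))))

    Rich : List Token → Set
    Rich = All (λ x → rich (proj₁ x) ≡ true)

    bases : List Token → Fin n → ℕ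
    bases ts u = ∑ ts (λ x → ι (proj₁ x) u)

    -- Initially the rays cover the star; once every tip has been handed over to a helper token,
    -- the centre can be used as an edge, and the bases of the rays have absorbed q new vertices.
    record Star : Set where
      field
        centre : Subset n
        rays   : List Token
        isEdge : G centre ≡ true
        isTok  : All (λ x → valid x ≡ true) rays
        isRich : Rich rays
        number : length rays ≡ q
        tips   : ∀ u → cover (edges rays) u ≡ bases rays u + ι centre u
    open Star

    starEdges : List Star → List (Subset n)
    starEdges []       = []
    starEdges (s ∷ ss) = edges (rays s) ++ starEdges ss

    -- Bases are chosen one after another; `find-rich` keeps succeeding as long as the vertices in
    -- use are a small proportion of `n`.
    attach : ∀ (ws : List (Fin n)) c → (∀ v → c v ≤ 1) → 2 * K * (Σᵥ c + length ws * k) < n →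
             ∃ λ ts → map proj₂ ts ≡ ws × All (λ x → valid x ≡ true) ts × Rich ts × (∀ v → c v + bases ts v ≤ 1)
    attach []       c c≤1 small = [] , refl , [] , [] , λ v → subst (_≤ 1) (sym (+-identityʳ (c v))) (c≤1 v)
    attach (w ∷ ws) c c≤1 small = extend (find-rich w c (≤-<-trans (*-monoʳ-≤ (2 * K) (m≤m+n (Σᵥ c) _)) small))
      where
      extend : (∃ λ f → 0 < lk G w f × rich f ≡ true × 0 < avoid f c) → _
      extend (f , l , r , av) = add (attach ws (c ⊕ f) (⊕≤1 c f av c≤1) small′)
        where
        small′ : 2 * K * (Σᵥ (c ⊕ f) + length ws * k) < n
        small′ = subst (λ x → 2 * K * x < n) (trans (sym (+-assoc (Σᵥ c) k (length ws * k))) (cong (_+ length ws * k) (sym (trans (∑-+ (verts n) _ _) (cong (Σᵥ c +_) (trans (Σᵥ-ι f) (lk-size w f l))))))) small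
        add : _ → _
        add (ts , tips , vts , rts , ≤1) = (f , w) ∷ ts , cong (w ∷_) tips , 𝟙-true l ∷ vts , r ∷ rts ,
          λ v → subst (_≤ 1) (+-assoc (c v) (ι f v) (bases ts v)) (≤1 v)

    cover-edges : ∀ {ts} → All (λ x → valid x ≡ true) ts → ∀ u → cover (edges ts) u ≡ bases ts u + ∑ (map proj₂ ts) (λ w → δ w u)
    cover-edges []                              u = refl
    cover-edges (_∷_ {x = f , w} {xs = ts} p ps) u = trans (cong₂ _+_ (ι-edge f w u p) (cover-edges ps u)) (lem (ι f u) (δ w u) (bases ts u) _)
      where
      lem : ∀ a b c d → a + b + (c + d) ≡ a + c + (b + d)
      lem = ring

    -- A star occupies the q vertices of its centre and a base of k vertices at each of them, q² in
    -- all.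
    new-star : ∀ c → (∀ v → c v ≤ 1) → 2 * K * (Σᵥ c + q * q) < n → ∃ λ s → ∀ v → c v + cover (edges (rays s)) v ≤ 1
    new-star c c≤1 small = start (∑-pos⇒∃ (verts n) (λ v → iszero (c v)) (Σ<n⇒0<free c Σc<n))
      where
      Σc<n : Σᵥ c < n
      Σc<n = ≤-<-trans (≤-trans (m≤m+n (Σᵥ c) (q * q)) (≤-trans (≤-reflexive (sym (*-identityˡ _))) (*-monoˡ-≤ (Σᵥ c + q * q) (*-mono-≤ {1} {2} (s≤s z≤n) 0<K)))) small
      start : (∃ λ v → 0 < iszero (c v)) → _
      start (v , v-free) = grow (find-rich v c (≤-<-trans (*-monoʳ-≤ (2 * K) (m≤m+n (Σᵥ c) _)) small))
        where
        grow : (∃ λ f → 0 < lk G v f × rich f ≡ true × 0 < avoid f c) → _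
        grow (f , l , _ , av) = finish (attach (elements r) (c ⊕ r) (⊕≤1 c r r-avoids c≤1) small′)
          where
          r : Subset n
          r = f ∪ ⁅ v ⁆
          r-size : ∣ r ∣ ≡ q
          r-size = uniform r (lk-edge G v f l)
          r-avoids : 0 < avoid r c
          r-avoids = subst (λ x → 0 < iszero x) (sym (trans (meet-insert v f c l) (cong₂ _+_ (iszero-pos av) (iszero-pos v-free)))) z<s
          small′ : 2 * K * (Σᵥ (c ⊕ r) + length (elements r) * k) < n
          small′ = subst (λ x → 2 * K * x < n) (trans (sym (trans (+-assoc (Σᵥ c) q (q * k)) (cong (Σᵥ c +_) (sym (*-suc q k)))))
            (cong₂ _+_ (sym (trans (∑-+ (verts n) _ _) (cong (Σᵥ c +_) (trans (Σᵥ-ι r) r-size)))) (cong (_* k) (sym (trans (length-elements r) r-size))))) small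
          finish : (∃ λ ts → map proj₂ ts ≡ elements r × All (λ x → valid x ≡ true) ts × Rich ts × (∀ v → (c ⊕ r) v + bases ts v ≤ 1)) → _
          finish (ts , tip-list , vts , rts , ≤1) = star , λ u → subst (_≤ 1) (trans (lem (c u) (ι r u) (bases ts u)) (cong (c u +_) (sym (tips star u)))) (≤1 u)
            where
            lem : ∀ a b d → a + b + d ≡ a + (d + b)
            lem = ring
            star : Star
            star = record
              { centre = r ; rays = ts ; isEdge = lk-edge G v f l ; isTok = vts ; isRich = rts
              ; number = trans (sym (length-map proj₂ ts)) (trans (cong length tip-list) (trans (length-elements r) r-size))
              ; tips = λ u → trans (cover-edges vts u) (cong (bases ts u +_) (trans (cong (λ ws → ∑ ws (λ w → δ w u)) tip-list) (∑-elements-δ r u)))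
              }
              where open import Data.List.Properties using (length-map)

    star-size : ∀ s → Σᵥ (cover (edges (rays s))) ≡ q * q
    star-size s = trans (Σcover-edges (isTok s)) (cong (_* q) (number s))

    cover-++ : ∀ (M N : List (Subset n)) u → cover (M ++ N) u ≡ cover M u + cover N u
    cover-++ M N u = ∑-++ M N _

    stars-size : ∀ ss → Σᵥ (cover (starEdges ss)) ≡ length ss * (q * q)
    stars-size []       = ∑-zero (verts n)
    stars-size (s ∷ ss) = trans (∑-cong (verts n) (cover-++ (edges (rays s)) (starEdges ss))) (trans (∑-+ (verts n) _ _) (cong₂ _+_ (star-size s) (stars-size ss)))

    many-stars : ∀ j → 2 * K * (j * (q * q)) < n → ∃ λ ss → length ss ≡ j × (∀ v → cover (starEdges ss) v ≤ 1)
    many-stars zero    _     = [] , refl , λ v → z≤n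
    many-stars (suc j) small = extend (many-stars j (≤-<-trans (*-monoʳ-≤ (2 * K) (m≤n+m (j * (q * q)) (q * q))) small))
      where
      extend : (∃ λ ss → length ss ≡ j × (∀ v → cover (starEdges ss) v ≤ 1)) → _
      extend (ss , len , ≤1) = add (new-star (cover (starEdges ss)) ≤1
          (subst (λ x → 2 * K * x < n) (trans (+-comm (q * q) (j * (q * q))) (cong (_+ q * q) (sym (trans (stars-size ss) (cong (_* (q * q)) len))))) small))
        where
        add : (∃ λ s → ∀ v → cover (starEdges ss) v + cover (edges (rays s)) v ≤ 1) → _
        add (s , ≤1′) = s ∷ ss , cong suc len , λ v → subst (_≤ 1) (trans (+-comm (cover (starEdges ss) v) _) (sym (cover-++ (edges (rays s)) (starEdges ss) v))) (≤1′ v)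

    Pairs : List (Fin n × Subset n) → Fin n → ℕ
    Pairs ps u = ∑ ps (λ p → ι (proj₂ p) u + δ (proj₁ p) u)

    points : List (Fin n) → Fin n → ℕ
    points vs u = ∑ vs (λ v → δ v u)

    -- Each ray hands its base, together with one vertex of `vs`, to `swap`. The tips do not occur
    -- in the balance, since the centre is going to cover them.
    zip-rays : ∀ ts vs → Rich ts → length ts ≤ length vs →
               ∃₂ λ ps vs′ → length ps ≡ length ts × length vs ≡ length ts + length vs′ × All (λ p → rich (proj₂ p) ≡ true) ps ×
                             (∀ u → Pairs ps u + points vs′ u ≡ bases ts u + points vs u)
    zip-rays []             vs       _        _          = [] , vs , refl , refl , [] , λ u → refl
    zip-rays ((f , w) ∷ ts) (v ∷ vs) (r ∷ rs) (s≤s len≤) = cons (zip-rays ts vs rs len≤)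
      where
      lem : ∀ a b c d x y → c + d ≡ x + y → a + b + c + d ≡ a + x + (b + y)
      lem a b c d x y eq = trans (+-assoc (a + b) c d) (trans (cong (a + b +_) eq) (ring₁ a b x y))
        where
        ring₁ : ∀ a b x y → a + b + (x + y) ≡ a + x + (b + y)
        ring₁ = ring
      cons : _ → _
      cons (ps , vs′ , l₁ , l₂ , rich-ps , cov) = (v , f) ∷ ps , vs′ , cong suc l₁ , cong suc l₂ , r ∷ rich-ps ,
        λ u → lem (ι f u) (δ v u) (Pairs ps u) (points vs′ u) (bases ts u) (points vs u) (cov u)

    -- `j` stars are opened: their rays give way to the centre and to q requests for `swap`. The
    -- other stars keep their rays, and `R` collects these rays and the used centres.
    allocate : ∀ ss vs j → length vs ≡ j * q → j ≤ length ss →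
               ∃₂ λ ps R → length ps ≡ length vs × All (λ p → rich (proj₂ p) ≡ true) ps × All (λ e → G e ≡ true) R ×
                           (∀ u → Pairs ps u + cover R u ≡ cover (starEdges ss) u + points vs u)
    allocate ss [] zero    _ _ = [] , starEdges ss , refl , [] , all-edges ss , λ u → sym (+-identityʳ _)
      where
      all-edges : ∀ ss → All (λ e → G e ≡ true) (starEdges ss)
      all-edges []       = []
      all-edges (s ∷ ss) = ++⁺ (valid-edges (isTok s)) (all-edges ss)
    allocate (s ∷ ss) vs (suc j) len (s≤s j≤) = spend (zip-rays (rays s) vs (isRich s) (≤-trans (≤-reflexive (number s)) (≤-trans (m≤m+n q (j * q)) (≤-reflexive (sym len)))))
      where
      spend : _ → _
      spend (ps , vs′ , l₁ , l₂ , rich-ps , cov) = combine (allocate ss vs′ j (+-cancelˡ-≡ q _ _ (trans (cong (_+ length vs′) (sym (number s))) (trans (sym l₂) len))) j≤)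
        where
        combine : _ → _
        combine (ps′ , R , l₃ , rich-ps′ , GR , cov′) = ps ++ ps′ , centre s ∷ R ,
          trans (length-++ ps) (trans (cong₂ _+_ l₁ l₃) (sym l₂)) , ++⁺ rich-ps rich-ps′ , isEdge s ∷ GR , λ u → begin
            Pairs (ps ++ ps′) u + (ι (centre s) u + cover R u)
              ≡⟨ cong (_+ (ι (centre s) u + cover R u)) (∑-++ ps ps′ _) ⟩
            Pairs ps u + Pairs ps′ u + (ι (centre s) u + cover R u)
              ≡⟨ lem (Pairs ps u) (Pairs ps′ u) (ι (centre s) u) (cover R u) ⟩
            Pairs ps u + ι (centre s) u + (Pairs ps′ u + cover R u)
              ≡⟨ cong (Pairs ps u + ι (centre s) u +_) (cov′ u) ⟩
            Pairs ps u + ι (centre s) u + (cover (starEdges ss) u + points vs′ u)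
              ≡⟨ lem₂ (Pairs ps u) (ι (centre s) u) (cover (starEdges ss) u) (points vs′ u) ⟩
            (Pairs ps u + points vs′ u) + ι (centre s) u + cover (starEdges ss) u
              ≡⟨ cong (λ x → x + ι (centre s) u + cover (starEdges ss) u) (cov u) ⟩
            bases (rays s) u + points vs u + ι (centre s) u + cover (starEdges ss) u
              ≡⟨ lem₃ (bases (rays s) u) (points vs u) (ι (centre s) u) (cover (starEdges ss) u) ⟩
            bases (rays s) u + ι (centre s) u + cover (starEdges ss) u + points vs u
              ≡⟨ cong (_+ points vs u) (sym (trans (cover-++ (edges (rays s)) (starEdges ss) u) (cong (_+ cover (starEdges ss) u) (tips s u)))) ⟩
            cover (starEdges (s ∷ ss)) u + points vs u ∎
          where
          open ≡-Reasoning
          open import Data.List.Properties using (length-++)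
          lem : ∀ a b c d → a + b + (c + d) ≡ a + c + (b + d)
          lem = ring
          lem₂ : ∀ a b c d → a + b + (c + d) ≡ a + d + b + c
          lem₂ = ring
          lem₃ : ∀ a b c d → a + b + c + d ≡ a + c + d + b
          lem₃ = ring

    -- `ℓ` stars of q² vertices each, and the helper tokens demanded by `many-hits`, with q vertices
    -- each.
    absorberSize : ℕ → ℕ
    absorberSize ℓ = ℓ * (q * q) + suc x₀ * (ℓ + ℓ) * q

    -- `vs` may be any list, because absorption is an identity between counts; that the result is a
    -- matching follows once the counts are 1. One opened star takes q vertices, whence the multiple
    -- of q.
    Absorber : ℕ → Set
    Absorber ℓ = ∃ λ (c : Fin n → ℕ) → (∀ v → c v ≤ 1) × Σᵥ c ≡ absorberSize ℓ ×
      (∀ vs j → length vs ≡ j * q → length vs ≤ ℓ → ∃ λ N → All (λ e → G e ≡ true) N × (∀ u → cover N u ≡ c u + points vs u))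

    -- n^q bounds the number of tests, each a vertex with a (q - 1)-set; the smallness condition is
    -- the one under which `helpers-dense` applies until the last token.
    absorber : ∀ ℓ → 8 * (K * K) * absorberSize ℓ < n → n * n ^ k ≤ 2 ^ ℓ → Absorber ℓ
    absorber ℓ small N≤ = with-stars (many-stars ℓ (≤-<-trans (*-mono-≤ 2K≤8KK (m≤m+n (ℓ * (q * q)) _)) small))
      where
      v₀ : Fin n
      v₀ = someone n 0<n
        where
        someone : ∀ n → 0 < n → Fin n
        someone (suc n) _ = Data.Fin.zero
      with-stars : (∃ λ ss → length ss ≡ ℓ × (∀ v → cover (starEdges ss) v ≤ 1)) → Absorber ℓ
      with-stars (ss , len , ≤1) = with-helpers (helper-family (cover (starEdges ss)) (suc x₀ * (ℓ + ℓ)) ≤1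
          (≤-trans (≤-reflexive (cong (λ x → 8 * (K * K) * (x + suc x₀ * (ℓ + ℓ) * q)) stars-total)) (<⇒≤ small)) v₀)
        where
        stars-total : Σᵥ (cover (starEdges ss)) ≡ ℓ * (q * q)
        stars-total = trans (stars-size ss) (cong (_* (q * q)) len)
        with-helpers : HelperFamily (cover (starEdges ss)) (suc x₀ * (ℓ + ℓ)) → Absorber ℓ
        with-helpers family@(F , vF , lenF , ≤1′ , Ψ≤) = (λ v → cover (starEdges ss) v + cover (edges F) v) , ≤1′ ,
          trans (∑-+ (verts n) _ _) (cong₂ _+_ stars-total (trans (Σcover-edges vF) (cong (_* q) lenF))) , absorb
          where
          absorb : ∀ vs j → length vs ≡ j * q → length vs ≤ ℓ → _
          absorb vs j len-vs vs≤ℓ = go (allocate ss vs j len-vs j≤)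
            where
            j≤ : j ≤ length ss
            j≤ = ≤-trans (≤-trans (m≤m*n j q) (≤-reflexive (sym len-vs))) (≤-trans vs≤ℓ (≤-reflexive (sym len)))
            go : _ → _
            go (ps , R , len-ps , rich-ps , GR , cov) = finish (swap ps F vF rich-ps (λ v f* r → ≤-trans (≤-trans (≤-reflexive len-ps) vs≤ℓ) (many-hits ℓ family N≤ v f* r)))
              where
              finish : _ → _
              finish (N , GN , covN) = N ++ R , ++⁺ GN GR , λ u → begin
                cover (N ++ R) u                                             ≡⟨ cover-++ N R u ⟩
                cover N u + cover R u                                        ≡⟨ cong (_+ cover R u) (covN u) ⟩
                cover (edges F) u + Pairs ps u + cover R u                   ≡⟨ +-assoc (cover (edges F) u) _ _ ⟩
                cover (edges F) u + (Pairs ps u + cover R u)                 ≡⟨ cong (cover (edges F) u +_) (cov u) ⟩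
                cover (edges F) u + (cover (starEdges ss) u + points vs u)   ≡⟨ lem (cover (edges F) u) (cover (starEdges ss) u) (points vs u) ⟩
                cover (starEdges ss) u + cover (edges F) u + points vs u     ∎
                where
                open ≡-Reasoning
                lem : ∀ a b c → a + (b + c) ≡ b + a + c
                lem = ring

-- The graph outside the absorber.

module Leftover where
  open FiniteSums
  open Indicators
  open Covers
  open Cliques
  open Links
  open Regularisation
  open SpreadWeights using (SpreadWeight)
  open GreedyMatching using (module Greedy)
  open NibbleArithmetic using (nibbleThreshold)
  open import Data.Fin using (zero; suc)
  open import Data.Fin.Subset using (∣_∣; ⁅_⁆; _∪_)
  open import Data.List using (map)
  open import Data.List.Relation.Unary.All using (All; []; _∷_)
  import Data.List.Relation.Unary.All as All
  open import Data.Nat using (ℕ; zero; suc; _+_; _*_; _∸_; _^_; _≤_; _<_; _⊓_; _/_; _%_; z≤n; s≤s; z<s; _≡ᵇ_; >-nonZero)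
  open import Data.Nat.Divisibility using (_∣_)
  open import Data.Nat.DivMod using (m≡m%n+[m/n]*n; m%n<n; m/n*n≤m)
  open import Data.Nat.Properties
  open import Data.Nat.Tactic.RingSolver using () renaming (solve-∀ to ring)
  open import Data.Sum using (inj₁; inj₂)
  open import Data.Vec using (lookup; []; _∷_)
  open import Relation.Binary.PropositionalEquality

  argmin : ∀ {n} (g : Fin (suc n) → ℕ) → ∃ λ v → ∀ u → g v ≤ g u
  argmin {zero}  g = zero , λ { zero → ≤-refl }
  argmin {suc n} g with argmin (λ u → g (suc u))
  ... | v , least with ≤-total (g zero) (g (suc v))
  ...   | inj₁ z≤ = zero  , λ { zero → ≤-refl ; (suc u) → ≤-trans z≤ (least u) }
  ...   | inj₂ ≤z = suc v , λ { zero → ≤z     ; (suc u) → least u }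

  argmax : ∀ {n} (g : Fin (suc n) → ℕ) → ∃ λ v → ∀ u → g u ≤ g v
  argmax {zero}  g = zero , λ { zero → ≤-refl }
  argmax {suc n} g with argmax (λ u → g (suc u))
  ... | v , greatest with ≤-total (g zero) (g (suc v))
  ...   | inj₁ z≤ = suc v , λ { zero → z≤     ; (suc u) → greatest u }
  ...   | inj₂ ≤z = zero  , λ { zero → ≤-refl ; (suc u) → ≤-trans (greatest u) ≤z }

  -- Serves to give all free vertices the same number of selected cliques. Sets containing the first
  -- vertex are used up as far as possible before the others.
  subfamily : ∀ {n} (P : Subset n → ℕ) κ → (∀ S → P S ≤ 1) → κ ≤ Σₛ P → ∃ λ Q → (∀ S → Q S ≤ P S) × Σₛ Q ≡ κ
  subfamily {zero}  P κ P≤1 κ≤ = (λ _ → κ) , (λ { [] → ≤-trans κ≤ (≤-reflexive (+-identityʳ _)) }) , +-identityʳ κ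
  subfamily {suc n} P κ P≤1 κ≤ = combine (subfamily Pt κt (λ S → P≤1 (true ∷ S)) (m⊓n≤n κ _)) (subfamily Pf (κ ∸ κt) (λ S → P≤1 (false ∷ S)) κf≤)
    where
    Pt Pf : Subset n → ℕ
    Pt S = P (true ∷ S)
    Pf S = P (false ∷ S)
    κt : ℕ
    κt = κ ⊓ Σₛ Pt
    κf≤ : κ ∸ κt ≤ Σₛ Pf
    κf≤ with ≤-total κ (Σₛ Pt)
    ... | inj₁ κ≤t = ≤-trans (≤-reflexive (trans (cong (κ ∸_) (m≤n⇒m⊓n≡m κ≤t)) (n∸n≡0 κ))) z≤n
    ... | inj₂ t≤κ = ≤-trans (≤-reflexive (cong (κ ∸_) (m≥n⇒m⊓n≡n t≤κ))) (m≤n+o⇒m∸n≤o κ (Σₛ Pt) (≤-trans κ≤ (≤-reflexive (Σₛ-suc P))))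
    combine : _ → _ → _
    combine (Qt , Qt≤ , Σt) (Qf , Qf≤ , Σf) = Q , Q≤ , trans (Σₛ-suc Q) (trans (cong₂ _+_ Σt Σf) (m+[n∸m]≡n (m⊓n≤m κ _)))
      where
      Q : Subset (suc n) → ℕ
      Q (true  ∷ S) = Qt S
      Q (false ∷ S) = Qf S
      Q≤ : ∀ S → Q S ≤ P S
      Q≤ (true  ∷ S) = Qt≤ S
      Q≤ (false ∷ S) = Qf≤ S

  deg≡ : ∀ {n} (G : Hypergraph n) v → deg G v ≡ Σₛ (λ e → ι e v * 𝟙 (G e))
  deg≡ {n} G v = trans (count≡Σₛ (link G v)) (trans (∑-cong (allSubsets n) (λ f → 𝟙-∧ (not (lookup f v)) (G (f ∪ ⁅ v ⁆)))) (Σₛ-insert v (λ e → 𝟙 (G e))))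

  codeg≡ : ∀ {n} (G : Hypergraph n) v w → codeg G v w ≡ Σₛ (λ f → lk G v f * lk G w f)
  codeg≡ {n} G v w = trans (count≡Σₛ (λ f → link G v f ∧ link G w f)) (∑-cong (allSubsets n) (λ f → 𝟙-∧ (link G v f) (link G w f)))

  cliqueDeg≡ : ∀ {n} q (G : Hypergraph n) v → cliqueDeg q G v ≡ Σₛ (λ S → ι S v * 𝟙 (isClique q G S))
  cliqueDeg≡ {n} q G v = trans (count≡Σₛ (λ S → lookup S v ∧ isClique q G S)) (∑-cong (allSubsets n) (λ S → 𝟙-∧ (lookup S v) (isClique q G S)))

  -- A blocked vertex differs from the free vertex `v`, so it lies together with `v` in at most n^j
  -- of the sets.
  unblocked : ∀ {n} j (H : Subset n → Bool) c v → (∀ e → H e ≡ true → ∣ e ∣ ≡ 2 + j) → c v ≡ 0 →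
              Σₛ (λ e → ι e v * 𝟙 (H e)) ≤ Σₛ (λ e → 𝟙 (H e) * avoid e c * ι e v) + Σᵥ c * n ^ j
  unblocked {n} j H c v H-size v-free = begin
    Σₛ (λ e → ι e v * 𝟙 (H e))
      ≤⟨ ∑-mono (allSubsets n) pointwise ⟩
    Σₛ (λ e → 𝟙 (H e) * avoid e c * ι e v + 𝟙 (∣ e ∣ ≡ᵇ 2 + j) * (ι e v * meet e c))
      ≡⟨ ∑-+ (allSubsets n) _ _ ⟩
    Σₛ (λ e → 𝟙 (H e) * avoid e c * ι e v) + Σₛ (λ e → 𝟙 (∣ e ∣ ≡ᵇ 2 + j) * (ι e v * meet e c))
      ≤⟨ +-monoʳ-≤ _ blocked ⟩
    Σₛ (λ e → 𝟙 (H e) * avoid e c * ι e v) + Σᵥ c * n ^ j ∎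
    where
    open ≤-Reasoning
    H≤ : ∀ e → 𝟙 (H e) ≤ 𝟙 (∣ e ∣ ≡ᵇ 2 + j)
    H≤ e with H e in eq
    ... | false = z≤n
    ... | true  = subst (λ b → 1 ≤ 𝟙 b) (sym (≡⇒≡ᵇ-true ∣ e ∣ (2 + j) (H-size e eq))) ≤-refl
    lem : ∀ i h m a → i * h * (m + a) ≡ h * a * i + h * (i * m)
    lem = ring
    pointwise : ∀ e → ι e v * 𝟙 (H e) ≤ 𝟙 (H e) * avoid e c * ι e v + 𝟙 (∣ e ∣ ≡ᵇ 2 + j) * (ι e v * meet e c)
    pointwise e = begin
      ι e v * 𝟙 (H e)                                    ≡⟨ *-identityʳ _ ⟨
      ι e v * 𝟙 (H e) * 1                                ≤⟨ *-monoʳ-≤ (ι e v * 𝟙 (H e)) (1≤a+iszero (meet e c)) ⟩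
      ι e v * 𝟙 (H e) * (meet e c + avoid e c)           ≡⟨ lem (ι e v) (𝟙 (H e)) (meet e c) (avoid e c) ⟩
      𝟙 (H e) * avoid e c * ι e v + 𝟙 (H e) * (ι e v * meet e c) ≤⟨ +-monoʳ-≤ (𝟙 (H e) * avoid e c * ι e v) (*-monoˡ-≤ (ι e v * meet e c) (H≤ e)) ⟩
      𝟙 (H e) * avoid e c * ι e v + 𝟙 (∣ e ∣ ≡ᵇ 2 + j) * (ι e v * meet e c) ∎
    lem₂ : ∀ s i x c → s * (i * (x * c)) ≡ c * (s * (i * x))
    lem₂ = ring
    cell : ∀ u → c u * Σₛ (λ e → 𝟙 (∣ e ∣ ≡ᵇ 2 + j) * (ι e v * ι e u)) ≤ c u * n ^ j
    cell u with c u in eq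
    ... | zero  = z≤n
    ... | suc i = *-monoʳ-≤ (suc i) (sets∋∋≤ j v u v≢u)
      where
      v≢u : 0 < ν v u
      v≢u with δ v u in eq′
      ... | zero  = z<s
      ... | suc _ with δ-≡ v u (subst (0 <_) (sym eq′) z<s)
      ...   | refl = contradiction (trans (sym eq) v-free) λ ()
    blocked : Σₛ (λ e → 𝟙 (∣ e ∣ ≡ᵇ 2 + j) * (ι e v * meet e c)) ≤ Σᵥ c * n ^ j
    blocked = begin
      Σₛ (λ e → 𝟙 (∣ e ∣ ≡ᵇ 2 + j) * (ι e v * meet e c))
        ≡⟨ ∑-cong (allSubsets n) (λ e → trans (cong (𝟙 (∣ e ∣ ≡ᵇ 2 + j) *_) (sym (∑-*ˡ (verts n) (ι e v) _))) (trans (sym (∑-*ˡ (verts n) (𝟙 (∣ e ∣ ≡ᵇ 2 + j)) _)) (∑-cong (verts n) (λ u → lem₂ (𝟙 (∣ e ∣ ≡ᵇ 2 + j)) (ι e v) (ι e u) (c u))))) ⟩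
      Σₛ (λ e → Σᵥ (λ u → c u * (𝟙 (∣ e ∣ ≡ᵇ 2 + j) * (ι e v * ι e u))))
        ≡⟨ trans (∑-swap (allSubsets n) (verts n) _) (∑-cong (verts n) (λ u → ∑-*ˡ (allSubsets n) (c u) _)) ⟩
      Σᵥ (λ u → c u * Σₛ (λ e → 𝟙 (∣ e ∣ ≡ᵇ 2 + j) * (ι e v * ι e u)))
        ≤⟨ ∑-mono (verts n) cell ⟩
      Σᵥ (λ u → c u * n ^ j)     ≡⟨ ∑-*ʳ (verts n) (n ^ j) c ⟩
      Σᵥ c * n ^ j               ∎

  suc≤2^ : ∀ m → suc m ≤ 2 ^ m
  suc≤2^ zero    = ≤-refl
  suc≤2^ (suc m) = ≤-trans (+-mono-≤ (m^n>0 2 m) (suc≤2^ m)) (≤-reflexive (cong (2 ^ m +_) (sym (+-identityʳ (2 ^ m)))))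

  -- With m = ℓ / 2q rounded down, the base is at most `suc m * (Q * Γ)` and both factors are at
  -- most 2^m; the q-th power then has exponent 2mq, which is at most `ℓ`.
  polynomial≤exponential : ∀ q′ Γ ℓ → let q = suc q′ in 2 * q * (2 * q * Γ) ≤ ℓ → (suc ℓ * Γ) ^ q ≤ 2 ^ ℓ
  polynomial≤exponential q′ Γ ℓ large = begin
    (suc ℓ * Γ) ^ q            ≤⟨ ^-monoˡ-≤ q (*-monoˡ-≤ Γ (m<[1+n/o]*o ℓ)) ⟩
    (suc m * Q * Γ) ^ q        ≡⟨ cong (_^ q) (*-assoc (suc m) Q Γ) ⟩
    (suc m * (Q * Γ)) ^ q      ≤⟨ ^-monoˡ-≤ q (*-mono-≤ (suc≤2^ m) (≤-trans QΓ≤m (≤-trans (n≤1+n m) (suc≤2^ m)))) ⟩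
    (2 ^ m * 2 ^ m) ^ q        ≡⟨ cong (_^ q) (^-distribˡ-+-* 2 m m) ⟨
    (2 ^ (m + m)) ^ q          ≡⟨ ^-*-assoc 2 (m + m) q ⟩
    2 ^ ((m + m) * q)          ≤⟨ ^-monoʳ-≤ 2 (≤-trans (≤-reflexive (lem m q)) (m/n*n≤m ℓ Q)) ⟩
    2 ^ ℓ                      ∎
    where
    open ≤-Reasoning
    q Q m : ℕ
    q = suc q′
    Q = 2 * q
    m = ℓ / Q
    lem : ∀ m q → (m + m) * q ≡ m * (2 * q)
    lem = ring
    m<[1+n/o]*o : ∀ ℓ → suc ℓ ≤ suc (ℓ / Q) * Q
    m<[1+n/o]*o ℓ = begin
      suc ℓ                      ≡⟨ cong suc (m≡m%n+[m/n]*n ℓ Q) ⟩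
      suc (ℓ % Q) + ℓ / Q * Q    ≤⟨ +-monoˡ-≤ (ℓ / Q * Q) (m%n<n ℓ Q) ⟩
      Q + ℓ / Q * Q              ∎
    QΓ≤m : Q * Γ ≤ m
    QΓ≤m with Q * Γ ≤? m
    ... | yes ok = ok
    ... | no ¬ok = contradiction (begin-strict
        ℓ                <⟨ m<[1+n/o]*o ℓ ⟩
        suc m * Q        ≤⟨ *-monoˡ-≤ Q (≰⇒> ¬ok) ⟩
        Q * Γ * Q        ≡⟨ *-comm (Q * Γ) Q ⟩
        Q * (Q * Γ)      ≤⟨ large ⟩
        ℓ                ∎) (n≮n ℓ)

  -- a / b stands for ξ; 97 in place of 100 leaves room for the matchings removed so far.
  record Conditions (k′ a b : ℕ) {n} (G : Hypergraph n) : Set where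
    field
      uniform    : IsQGraph (suc (suc k′)) G
      degrees    : ∀ v w → 50 * b * deg G v ≤ 50 * b * deg G w + a * n ^ suc k′
      cliques    : ∀ v → 97 * (a * n ^ suc (suc k′)) ≤ 100 * b * cliqueDeg (suc (suc k′)) G v
      codegrees  : ∀ v w → 97 * (a * n ^ suc k′) ≤ 100 * b * codeg G v w

  module _ {k′ a b n : ℕ} {G : Hypergraph n} (𝒞 : Conditions k′ a b G) (0<a : 0 < a) (0<b : 0 < b) (0<n : 0 < n) where
    open Conditions 𝒞
    private
      k q : ℕ
      k = suc k′
      q = suc k

    -- 97 a / (100 b) exceeds 1 / (2b) because `a` is at least 1; the numerator is given up to have
    -- the inverse of an integer as density.
    denseLinks : DenseLinks k′ G (2 * b)
    denseLinks = record { uniform = uniform ; codense = codense ; 0<n = 0<n }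
      where
      open ≤-Reasoning
      lem : ∀ b x → 100 * b * x ≡ 50 * (2 * b * x)
      lem = ring
      codense : ∀ v w → n ^ k ≤ 2 * b * Σₛ (λ f → lk G v f * lk G w f)
      codense v w = *-cancelˡ-≤ 50 (begin
        50 * n ^ k                    ≤⟨ *-mono-≤ {50} {97} (m≤m+n 50 47) (≤-trans (≤-reflexive (sym (*-identityˡ _))) (*-monoˡ-≤ (n ^ k) 0<a)) ⟩
        97 * (a * n ^ k)              ≤⟨ codegrees v w ⟩
        100 * b * codeg G v w         ≡⟨ cong (100 * b *_) (codeg≡ G v w) ⟩
        100 * b * Σₛ (λ f → lk G v f * lk G w f) ≡⟨ lem b _ ⟩
        50 * (2 * b * Σₛ (λ f → lk G v f * lk G w f)) ∎)

    module Remainder (c : Fin n → ℕ) (small : 4 * b * Σᵥ c ≤ n) (Σc<n : Σᵥ c < n) where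
      -- `Δ` bounds the spread of the degrees of free vertices in units of 1 / (50 b): the spread
      -- allowed by `degrees`, and the edges lost to blocked vertices.
      A Δ : ℕ
      A = Σᵥ c
      Δ = a * n ^ k + 50 * b * (A * n ^ k′)

      dU cU : Fin n → ℕ
      dU v = Σₛ (λ e → 𝟙 (G e) * avoid e c * ι e v)
      cU v = Σₛ (λ S → 𝟙 (isClique q G S) * avoid S c * ι S v)

      deg≤ : ∀ v → c v ≡ 0 → deg G v ≤ dU v + A * n ^ k′
      deg≤ v v-free = ≤-trans (≤-reflexive (deg≡ G v)) (unblocked k′ G c v uniform v-free)

      dU≤deg : ∀ v → dU v ≤ deg G v
      dU≤deg v = ≤-trans (∑-mono (allSubsets n) (λ e → ≤-trans (*-monoˡ-≤ (ι e v) (≤-trans (*-monoʳ-≤ (𝟙 (G e)) (iszero≤1 (meet e c))) (≤-reflexive (*-identityʳ (𝟙 (G e)))))) (≤-reflexive (*-comm (𝟙 (G e)) (ι e v)))))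
        (≤-reflexive (sym (deg≡ G v)))

      cliqueDeg≤ : ∀ v → c v ≡ 0 → cliqueDeg q G v ≤ cU v + A * n ^ k
      cliqueDeg≤ v v-free = ≤-trans (≤-reflexive (cliqueDeg≡ q G v)) (unblocked k (isClique q G) c v (clique-size q G) v-free)

      n^k≤a : ∀ x → x ≤ a * x
      n^k≤a x = ≤-trans (≤-reflexive (sym (*-identityˡ x))) (*-monoˡ-≤ x 0<a)

      -- The correction needs a n^q and the cliques supply 48.5 a n^q; by `small` the blocked
      -- vertices add at most 12.5 a n^q to the first and take at most as much from the second.
      enough-cliques : ∀ v → c v ≡ 0 → n * Δ ≤ cU v * (50 * b)
      enough-cliques v v-free = *-cancelˡ-≤ 2 (+-cancelʳ-≤ (100 * y) _ _ (begin
        2 * (n * Δ) + 100 * y                 ≡⟨ lem₁ n a b A (n ^ k′) ⟩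
        2 * x + 50 * (4 * y)                  ≤⟨ +-monoʳ-≤ (2 * x) (*-monoʳ-≤ 50 4y≤x) ⟩
        2 * x + 50 * x                        ≤⟨ m≤m+n _ (45 * x) ⟩
        2 * x + 50 * x + 45 * x               ≡⟨ lem₂ x ⟩
        97 * x                                ≤⟨ cliques v ⟩
        100 * b * cliqueDeg q G v             ≤⟨ *-monoʳ-≤ (100 * b) (cliqueDeg≤ v v-free) ⟩
        100 * b * (cU v + A * n ^ k)          ≡⟨ lem₃ b (cU v) A (n ^ k) ⟩
        2 * (cU v * (50 * b)) + 100 * y       ∎))
        where
        open ≤-Reasoning
        x y : ℕ
        x = a * n ^ q
        y = b * A * n ^ k
        lem₁ : ∀ n a b A N → 2 * (n * (a * (n * N) + 50 * b * (A * N))) + 100 * (b * A * (n * N)) ≡ 2 * (a * (n * (n * N))) + 50 * (4 * (b * A * (n * N)))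
        lem₁ = ring
        lem₂ : ∀ x → 2 * x + 50 * x + 45 * x ≡ 97 * x
        lem₂ = ring
        lem₃ : ∀ b c A N → 100 * b * (c + A * N) ≡ 2 * (c * (50 * b)) + 100 * (b * A * N)
        lem₃ = ring
        lem₄ : ∀ b A N → 4 * (b * A * N) ≡ 4 * b * A * N
        lem₄ = ring
        4y≤x : 4 * y ≤ x
        4y≤x = ≤-trans (≤-reflexive (lem₄ b A (n ^ k))) (≤-trans (*-monoˡ-≤ (n ^ k) small) (n^k≤a (n ^ q)))

      private
        argmin⁺ : ∀ {m} → 0 < m → (g : Fin m → ℕ) → ∃ λ v → ∀ u → g v ≤ g u
        argmin⁺ {suc m} _ g = argmin g
        argmax⁺ : ∀ {m} → 0 < m → (g : Fin m → ℕ) → ∃ λ v → ∀ u → g u ≤ g v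
        argmax⁺ {suc m} _ g = argmax g
        -- The penalty `c v * (n * Δ)` lets the minimum run over all vertices: it is attained at a
        -- free vertex or is at least `n * Δ` anyway.
        poorest : ∃ λ v → ∀ u → cU v + c v * (n * Δ) ≤ cU u + c u * (n * Δ)
        poorest = argmin⁺ 0<n (λ v → cU v + c v * (n * Δ))
        richest : ∃ λ v → ∀ u → iszero (c u) * dU u ≤ iszero (c v) * dU v
        richest = argmax⁺ 0<n (λ v → iszero (c v) * dU v)

      κ top : ℕ
      κ = cU (proj₁ poorest) + c (proj₁ poorest) * (n * Δ)
      top = iszero (c (proj₁ richest)) * dU (proj₁ richest)

      κ≤cU : ∀ v → c v ≡ 0 → κ ≤ cU v
      κ≤cU v v-free = ≤-trans (proj₂ poorest v) (≤-reflexive (trans (cong (λ x → cU v + x * (n * Δ)) v-free) (+-identityʳ (cU v))))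

      dU≤top : ∀ v → c v ≡ 0 → dU v ≤ top
      dU≤top v v-free = ≤-trans (≤-reflexive (sym (trans (cong (λ x → iszero x * dU v) v-free) (*-identityˡ (dU v))))) (proj₂ richest v)

      κ-large : n * Δ ≤ κ * (50 * b)
      κ-large with c (proj₁ poorest) in eq
      ... | zero  = ≤-trans (enough-cliques _ eq) (≤-reflexive (cong (_* (50 * b)) (sym (+-identityʳ (cU (proj₁ poorest))))))
      ... | suc j = begin
        n * Δ                              ≤⟨ m≤m+n (n * Δ) (j * (n * Δ)) ⟩
        suc j * (n * Δ)                    ≤⟨ m≤n+m _ (cU (proj₁ poorest)) ⟩
        κ′                                 ≡⟨ *-identityʳ κ′ ⟨
        κ′ * 1                             ≤⟨ *-monoʳ-≤ κ′ (*-mono-≤ {1} {50} (s≤s z≤n) 0<b) ⟩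
        κ′ * (50 * b)                      ∎
        where
        open ≤-Reasoning
        κ′ : ℕ
        κ′ = cU (proj₁ poorest) + suc j * (n * Δ)

      P : Fin n → Subset n → ℕ
      P v S = 𝟙 (isClique q G S) * avoid S c * ι S v

      P≤1 : ∀ v S → P v S ≤ 1
      P≤1 v S = *-mono-≤ (*-mono-≤ (𝟙≤1 (isClique q G S)) (iszero≤1 (meet S c))) (ι≤1 S v)

      -- The minimum with `cU v` makes the choice possible at blocked vertices too; at free ones it
      -- equals `κ`.
      chosen : ∀ v → ∃ λ Q → (∀ S → Q S ≤ P v S) × Σₛ Q ≡ κ ⊓ cU v
      chosen v = subfamily (P v) (κ ⊓ cU v) (P≤1 v) (m⊓n≤n κ (cU v))

      top-deficit : ∀ v → c v ≡ 0 → 50 * b * top ≤ 50 * b * dU v + Δ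
      top-deficit v v-free = begin
        50 * b * top                                  ≤⟨ *-monoʳ-≤ (50 * b) (≤-trans (≤-trans (*-monoˡ-≤ (dU u) (iszero≤1 (c u))) (≤-reflexive (*-identityˡ (dU u)))) (dU≤deg u)) ⟩
        50 * b * deg G u                              ≤⟨ degrees u v ⟩
        50 * b * deg G v + a * n ^ k                  ≤⟨ +-monoˡ-≤ (a * n ^ k) (*-monoʳ-≤ (50 * b) (deg≤ v v-free)) ⟩
        50 * b * (dU v + A * n ^ k′) + a * n ^ k      ≡⟨ lem (50 * b) (dU v) (A * n ^ k′) (a * n ^ k) ⟩
        50 * b * dU v + Δ                             ∎
        where
        open ≤-Reasoning
        u : Fin n
        u = proj₁ richest
        lem : ∀ b d A x → b * (d + A) + x ≡ b * d + (x + b * A)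
        lem = ring

      system : CliqueSystem k′ G c κ (50 * b) Δ top
      system = record
        { Q        = λ v → proj₁ (chosen v)
        ; uniform  = uniform
        ; Q≤1      = λ v S → ≤-trans (proj₁ (proj₂ (chosen v)) S) (P≤1 v S)
        ; Q-clique = λ v S pos → let pos₁ , ∈S = *-pos⁻¹ (𝟙 (isClique q G S) * avoid S c) (ι S v) (≤-trans pos (proj₁ (proj₂ (chosen v)) S))
                                     cl , av = *-pos⁻¹ (𝟙 (isClique q G S)) (avoid S c) pos₁
                                 in 𝟙-true cl , av , ∈S
        ; Q-size   = λ v v-free → trans (proj₂ (proj₂ (chosen v))) (m≤n⇒m⊓n≡m (κ≤cU v v-free))
        ; degree≤  = dU≤top
        ; deficit≤ = top-deficit
        ; enough   = κ-large
        ; 0<K      = proj₁ (*-pos⁻¹ κ (50 * b) (≤-trans (*-mono-≤ 0<n (≤-trans (*-mono-≤ 0<a (m^n>0 n {{>-nonZero 0<n}} k)) (m≤m+n (a * n ^ k) _))) κ-large))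
        ; 0<scale  = *-mono-≤ {1} {50} (s≤s z≤n) 0<b
        ; 0<free   = Σ<n⇒0<free c Σc<n
        }

      -- A degree is the codegree of a vertex with itself, so `codense` bounds it below; at most
      -- half of that bound is lost to blocked vertices.
      top-large : 2 * (n * n ^ k′) ≤ 8 * b * top
      top-large with ∑-pos⇒∃ (verts n) (λ v → iszero (c v)) (Σ<n⇒0<free c Σc<n)
      ... | v , pos = ≤-trans (*-monoʳ-≤ 2 half) (≤-reflexive (lem₀ b top))
        where
        open ≤-Reasoning
        v-free : c v ≡ 0
        v-free = iszero-pos pos
        lem₀ : ∀ b t → 2 * (4 * b * t) ≡ 8 * b * t
        lem₀ = ring
        lem₁ : ∀ x → x + x ≡ 2 * x
        lem₁ = ring
        lem₂ : ∀ b t A N → 2 * (2 * b * (t + A * N)) ≡ 4 * b * t + 4 * b * A * N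
        lem₂ = ring
        degree-large : n ^ k ≤ 2 * b * (top + A * n ^ k′)
        degree-large = begin
          n ^ k                                         ≤⟨ DenseLinks.codense denseLinks v v ⟩
          2 * b * Σₛ (λ f → lk G v f * lk G v f)        ≤⟨ *-monoʳ-≤ (2 * b) (∑-mono (allSubsets n) (λ f → ≤-trans (*-monoʳ-≤ (lk G v f) (lk≤1 G v f)) (≤-reflexive (*-identityʳ (lk G v f))))) ⟩
          2 * b * Σₛ (lk G v)                           ≡⟨ cong (2 * b *_) (count≡Σₛ (link G v)) ⟨
          2 * b * deg G v                               ≤⟨ *-monoʳ-≤ (2 * b) (≤-trans (deg≤ v v-free) (+-monoˡ-≤ (A * n ^ k′) (dU≤top v v-free))) ⟩
          2 * b * (top + A * n ^ k′)                    ∎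
        half : n * n ^ k′ ≤ 4 * b * top
        half = +-cancelʳ-≤ (n * n ^ k′) _ _ (begin
          n * n ^ k′ + n * n ^ k′                       ≡⟨ lem₁ (n * n ^ k′) ⟩
          2 * (n * n ^ k′)                              ≤⟨ *-monoʳ-≤ 2 degree-large ⟩
          2 * (2 * b * (top + A * n ^ k′))              ≡⟨ lem₂ b top A (n ^ k′) ⟩
          4 * b * top + 4 * b * A * n ^ k′              ≤⟨ +-monoʳ-≤ (4 * b * top) (*-monoˡ-≤ (n ^ k′) small) ⟩
          4 * b * top + n * n ^ k′                      ∎)

      Almost : ℕ → Set
      Almost E = ∃ λ N → All (λ e → G e ≡ true) N × (∀ v → c v + cover N v ≤ 1) × (free (λ v → c v + cover N v) * E < n)

      weight : SpreadWeight k′ (free c) (2 * Regular.Λ system * n ^ k′) (8 * b) (Regular.Λ system * top) c (Regular.w system)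
      weight = regularised system (8 * b) top-large

      weight⇒G : ∀ {e} → 0 < Regular.w system e → G e ≡ true
      weight⇒G {e} pos = 𝟙-true (proj₁ (*-pos⁻¹ (𝟙 (G e)) (avoid e c) (Regular.w⇒edge system e pos)))

      almost : ∀ E → (∀ v → c v ≤ 1) → nibbleThreshold k′ (8 * b) E ≤ free c → Almost E
      almost E c≤1 large = conclude (Greedy.almost-perfect weight E large c≤1)
        where
        conclude : Greedy.Result weight E c → Almost E
        conclude (N , pos , ≤1 , left) = N , All.map weight⇒G pos , ≤1 , <-≤-trans left (Regular.free≤n system)

-- A single perfect matching.

module PerfectMatching where
  open FiniteSums
  open Indicators
  open Covers
  open Absorbers
  open Leftover
  open NibbleArithmetic using (nibbleThreshold)
  open import Data.Fin using (zero; suc)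
  open import Data.Fin.Subset using (∣_∣)
  open import Data.List using (_++_; length; filterᵇ)
  open import Data.List.Relation.Unary.All using (All; []; _∷_)
  import Data.List.Relation.Unary.All as All
  open import Data.List.Relation.Unary.All.Properties using (++⁺)
  open import Data.Nat using (ℕ; zero; suc; _+_; _*_; _∸_; _^_; _≤_; _<_; _/_; _%_; z≤n; s≤s; s≤s⁻¹; z<s; _≡ᵇ_; NonZero)
  open import Data.Nat.Divisibility using (_∣_; ∣m+n∣m⇒∣n; ∣m∣n⇒∣m+n; n∣m*n; ∣n⇒∣m*n)
  open import Data.Nat.DivMod using (m≡m%n+[m/n]*n; m%n<n; m/n*n≤m)
  open import Data.Nat.Properties
  open import Data.Nat.Tactic.RingSolver using () renaming (solve-∀ to ring)
  open import Data.Vec using ([]; _∷_)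
  open import Relation.Binary.PropositionalEquality

  PerfectCover : ∀ {n} → Hypergraph n → Set
  PerfectCover {n} G = ∃ λ (N : List (Subset n)) → All (λ e → G e ≡ true) N × (∀ u → cover N u ≡ 1)

  Σcover : ∀ {n} q (G : Hypergraph n) → IsQGraph q G → ∀ {N} → All (λ e → G e ≡ true) N → Σᵥ (cover N) ≡ length N * q
  Σcover {n} q G uniform []                   = ∑-zero (verts n)
  Σcover {n} q G uniform (_∷_ {x = e} {xs = N} p ps) = trans (∑-+ (verts n) _ _)
    (cong₂ _+_ (trans (Σᵥ-ι e) (uniform e p)) (Σcover q G uniform ps))

  -- The constants are variables tied by equations, so that they stay opaque. `Z * ℓ` is the size of
  -- the absorber and `Y` collects the factors by which it must be smaller than `n`, which `Γ`
  -- achieves; `E` limits the uncovered rest to `ℓ`, and `L₀` is where 2^ℓ overtakes n^q.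
  record Scales (k′ b Γ E Y Z L₀ : ℕ) : Set where
    field
      Γ≡  : Γ ≡ suc (Y * Z)
      E≡  : E ≡ 2 * Γ
      Y≡  : Y ≡ 8 * (2 * b * (2 * b)) + (4 * b + 2)
      Z≡  : Z ≡ suc (suc k′) * suc (suc k′) + 2 * suc (2 * (4 * (2 * b * (2 * b))) ∸ 1) * suc (suc k′)
      L₀≡ : L₀ ≡ 2 * suc (suc k′) * (2 * suc (suc k′) * Γ)

  module Assembly {k′ a b n Γ E Y Z L₀ : ℕ} {G : Hypergraph n} (𝒮 : Scales k′ b Γ E Y Z L₀) {{Γ≢0 : NonZero Γ}}
                  (𝒞 : Conditions k′ a b G) (0<a : 0 < a) (0<b : 0 < b)
                  (n₀≤n : suc L₀ * Γ + 2 * nibbleThreshold k′ (8 * b) E ≤ n) (q∣n : suc (suc k′) ∣ n) where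
    open Scales 𝒮
    open Conditions 𝒞 using (uniform)

    q x ℓ : ℕ
    q = suc (suc k′)
    x = suc (2 * (4 * (2 * b * (2 * b))) ∸ 1)
    ℓ = n / Γ

    n<sucℓΓ : n < suc ℓ * Γ
    n<sucℓΓ = begin-strict
      n                      ≡⟨ m≡m%n+[m/n]*n n Γ ⟩
      n % Γ + ℓ * Γ          <⟨ +-monoˡ-< (ℓ * Γ) (m%n<n n Γ) ⟩
      Γ + ℓ * Γ              ∎
      where open ≤-Reasoning

    ℓΓ≤n : ℓ * Γ ≤ n
    ℓΓ≤n = m/n*n≤m n Γ

    L₀<ℓ : L₀ < ℓ
    L₀<ℓ = s≤s⁻¹ (*-cancelʳ-< Γ (suc L₀) (suc ℓ) (≤-<-trans (≤-trans (m≤m+n (suc L₀ * Γ) _) n₀≤n) n<sucℓΓ))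

    YZℓ<n : Y * Z * ℓ < n
    YZℓ<n = begin-strict
      Y * Z * ℓ              <⟨ m<n+m (Y * Z * ℓ) (≤-trans z<s L₀<ℓ) ⟩
      suc (Y * Z) * ℓ        ≡⟨ trans (cong (_* ℓ) (sym Γ≡)) (*-comm Γ ℓ) ⟩
      ℓ * Γ                  ≤⟨ ℓΓ≤n ⟩
      n                      ∎
      where open ≤-Reasoning

    0<n : 0 < n
    0<n = ≤-trans z<s YZℓ<n

    open Starry (denseLinks 𝒞 0<a 0<b 0<n) (*-mono-≤ {1} {2} (s≤s z≤n) 0<b)

    size≡ : absorberSize ℓ ≡ Z * ℓ
    size≡ = trans (lem ℓ q x) (cong (_* ℓ) (sym Z≡))
      where
      lem : ∀ ℓ q x → ℓ * (q * q) + x * (ℓ + ℓ) * q ≡ (q * q + 2 * x * q) * ℓ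
      lem = ring

    Y-part : ∀ y → y ≤ Y → y * absorberSize ℓ < n
    Y-part y y≤Y = ≤-<-trans (≤-trans (*-mono-≤ y≤Y (≤-reflexive size≡)) (≤-reflexive (sym (*-assoc Y Z ℓ)))) YZℓ<n

    few-tests : n * n ^ suc k′ ≤ 2 ^ ℓ
    few-tests = ≤-trans (^-monoˡ-≤ q (<⇒≤ n<sucℓΓ)) (polynomial≤exponential (suc k′) Γ ℓ (≤-trans (≤-reflexive (sym L₀≡)) (<⇒≤ L₀<ℓ)))

    the-absorber : Absorber ℓ
    the-absorber = absorber ℓ (Y-part (8 * (2 * b * (2 * b))) (≤-trans (m≤m+n _ (4 * b + 2)) (≤-reflexive (sym Y≡)))) few-tests

    tail≤Y : 4 * b + 2 ≤ Y
    tail≤Y = ≤-trans (m≤n+m (4 * b + 2) (8 * (2 * b * (2 * b)))) (≤-reflexive (sym Y≡))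

    extend : Absorber ℓ → PerfectCover G
    extend (c , c≤1 , Σc≡ , absorb) = finish (almost E c≤1 free-large)
      where
      open ≤-Reasoning
      small : 4 * b * Σᵥ c ≤ n
      small = subst (λ A → 4 * b * A ≤ n) (sym Σc≡) (<⇒≤ (Y-part (4 * b) (≤-trans (m≤m+n (4 * b) 2) tail≤Y)))
      2Σc<n : 2 * Σᵥ c < n
      2Σc<n = subst (λ A → 2 * A < n) (sym Σc≡) (Y-part 2 (≤-trans (m≤n+m 2 (4 * b)) tail≤Y))
      Σc<n : Σᵥ c < n
      Σc<n = ≤-<-trans (m≤m+n (Σᵥ c) _) 2Σc<n
      open Remainder 𝒞 0<a 0<b 0<n c small Σc<n using (Almost; almost)
      free-large : nibbleThreshold k′ (8 * b) E ≤ free c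
      free-large = *-cancelˡ-≤ 2 (≤-trans (≤-trans (m≤n+m _ (suc L₀ * Γ)) n₀≤n) (+-cancelˡ-≤ n _ _ (begin
        n + n                         ≡⟨ cong (n +_) (+-identityʳ n) ⟨
        2 * n                         ≤⟨ *-monoʳ-≤ 2 (n≤Σ+free c) ⟩
        2 * (Σᵥ c + free c)           ≡⟨ *-distribˡ-+ 2 (Σᵥ c) (free c) ⟩
        2 * Σᵥ c + 2 * free c         ≤⟨ +-monoˡ-≤ (2 * free c) (<⇒≤ 2Σc<n) ⟩
        n + 2 * free c                ∎)))
      finish : Almost E → PerfectCover G
      finish (N , GN , ≤1 , left) = conclude (absorb vs j length-vs few)
        where
        c′ : Fin n → ℕ
        c′ v = c v + cover N v
        uncovered : Fin n → Bool
        uncovered v = c′ v ≡ᵇ 0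
        vs : List (Fin n)
        vs = filterᵇ uncovered (verts n)
        𝟙-uncovered : ∀ v → 𝟙 (uncovered v) ≡ iszero (c′ v)
        𝟙-uncovered v with c′ v
        ... | zero  = refl
        ... | suc _ = refl
        length≡ : length vs ≡ free c′
        length≡ = trans (sym (*-identityʳ _)) (trans (sym (∑-const vs 1)) (trans (∑-filter uncovered (verts n) (λ _ → 1))
          (∑-cong (verts n) (λ v → trans (*-identityʳ _) (𝟙-uncovered v)))))
        -- The absorber and the almost perfect matching both occupy multiples of q vertices, so the
        -- divisibility of `n` passes to the rest.
        q∣free : q ∣ free c′
        q∣free = ∣m+n∣m⇒∣n (subst (q ∣_) (sym (Σ+free≡n c′ ≤1)) q∣n)
          (subst (q ∣_) (sym (trans (∑-+ (verts n) c (cover N)) (cong₂ _+_ Σc≡ (Σcover q G uniform GN))))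
            (∣m∣n⇒∣m+n (∣m∣n⇒∣m+n (∣n⇒∣m*n ℓ (n∣m*n q)) (n∣m*n (suc x₀′ * (ℓ + ℓ)))) (n∣m*n (length N))))
          where
          x₀′ : ℕ
          x₀′ = 2 * (4 * (2 * b * (2 * b))) ∸ 1
        j : ℕ
        j = _∣_.quotient q∣free
        length-vs : length vs ≡ j * q
        length-vs = trans length≡ (_∣_.equality q∣free)
        -- Fewer than n / (2Γ) vertices are left, while `n` is less than (ℓ + 1) Γ.
        few : length vs ≤ ℓ
        few with length vs ≤? ℓ
        ... | yes ok = ok
        ... | no ¬ok = contradiction (begin-strict
          suc ℓ * (2 * Γ)             ≤⟨ *-monoˡ-≤ (2 * Γ) (≰⇒> ¬ok) ⟩
          length vs * (2 * Γ)         ≡⟨ cong (_* (2 * Γ)) length≡ ⟩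
          free c′ * (2 * Γ)           ≡⟨ cong (free c′ *_) E≡ ⟨
          free c′ * E                 <⟨ left ⟩
          n                           <⟨ n<sucℓΓ ⟩
          suc ℓ * Γ                   ≤⟨ *-monoʳ-≤ (suc ℓ) (m≤m+n Γ (Γ + 0)) ⟩
          suc ℓ * (2 * Γ)             ∎) (n≮n _)
        points≡ : ∀ u → points vs u ≡ iszero (c′ u)
        points≡ u = trans (∑-filter uncovered (verts n) (λ v → δ v u)) (trans (∑-cong (verts n) (λ v →
          trans (cong (_* δ v u) (𝟙-uncovered v)) (trans (*-comm (iszero (c′ v)) (δ v u)) (cong (_* iszero (c′ v)) (δ-sym v u))))) (Σᵥ-δ u (λ v → iszero (c′ v))))
        conclude : (∃ λ N′ → All (λ e → G e ≡ true) N′ × (∀ u → cover N′ u ≡ c u + points vs u)) → PerfectCover G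
        conclude (N′ , GN′ , cov) = N′ ++ N , ++⁺ GN′ GN , λ u → trans (cover-++ N′ N u) (trans (cong (_+ cover N u) (trans (cov u) (cong (c u +_) (points≡ u))))
            (trans (lem (c u) (iszero (c′ u)) (cover N u)) (+iszero≡1 (≤1 u))))
          where
          lem : ∀ a z b → a + z + b ≡ a + b + z
          lem = ring

    perfect : PerfectCover G
    perfect = extend the-absorber

  perfect-matching : ∀ k′ a b → 0 < a → 0 < b → ∃ λ n₀ → ∀ n → n₀ ≤ n → suc (suc k′) ∣ n →
                     (G : Hypergraph n) → Conditions k′ a b G → PerfectCover G
  perfect-matching k′ a b 0<a 0<b = with-scales _ _ _ _ _ (record { Γ≡ = refl ; E≡ = refl ; Y≡ = refl ; Z≡ = refl ; L₀≡ = refl })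
    where
    with-scales : ∀ Γ E Y Z L₀ → Scales k′ b Γ E Y Z L₀ → ∃ λ n₀ → ∀ n → n₀ ≤ n → suc (suc k′) ∣ n →
                  (G : Hypergraph n) → Conditions k′ a b G → PerfectCover G
    with-scales Γ E Y Z L₀ 𝒮 = suc L₀ * Γ + 2 * nibbleThreshold k′ (8 * b) E ,
      λ n n₀≤n q∣n G 𝒞 → Assembly.perfect 𝒮 {{Γ≢0}} 𝒞 0<a 0<b n₀≤n q∣n
      where
      Γ≢0 : NonZero Γ
      Γ≢0 = subst NonZero (sym (Scales.Γ≡ 𝒮)) _

-- Removing perfect matchings one at a time.

module Packing where
  open FiniteSums
  open Indicators
  open Covers
  open Cliques
  open Links using (lk; lk≤1)
  open Leftover
  open PerfectMatching
  open import Data.Fin using (zero; suc)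
  open import Data.Empty using (⊥)
  open import Data.Fin.Subset using (∣_∣; ⁅_⁆; _∪_; _∩_; Empty) renaming (_∈_ to _∈ₛ_)
  open import Data.Fin.Subset.Properties using (x∈p∩q⁻)
  open import Data.List.Relation.Unary.All using (All; _∷_)
  open import Data.Nat using (ℕ; zero; suc; _+_; _*_; _^_; _≤_; _<_; _/_; _%_; z≤n; s≤s; z<s; _≡ᵇ_; NonZero; >-nonZero)
  open import Data.Nat.Divisibility using (_∣_)
  open import Data.Nat.DivMod using (m≡m%n+[m/n]*n; m%n<n; m/n*n≤m)
  open import Data.Nat.Properties
  open import Data.Nat.Tactic.RingSolver using () renaming (solve-∀ to ring)
  open import Data.Vec using (lookup; _∷_)
  open import Data.Vec.Properties using ([]=⇒lookup; lookup⇒[]=)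
  open import Function using (_∘_)
  open import Relation.Binary.PropositionalEquality

  not-∧-split : ∀ g m → (m ≡ true → g ≡ true) → 𝟙 g ≡ 𝟙 (g ∧ not m) + 𝟙 m
  not-∧-split true  true  _ = refl
  not-∧-split true  false _ = refl
  not-∧-split false true  f = contradiction (f refl) λ ()
  not-∧-split false false _ = refl

  module Removal {n} {k′ : ℕ} {G : Hypergraph n} (uniform : IsQGraph (suc (suc k′)) G) (𝒩 : PerfectCover G) where
    N : List (Subset n)
    N = proj₁ 𝒩

    q : ℕ
    q = suc (suc k′)

    mult : Subset n → ℕ
    mult e = ∑ N (λ s → same s e)

    M : Subset n → Bool
    M e = not (mult e ≡ᵇ 0)

    G′ : Hypergraph n
    G′ e = G e ∧ not (M e)

    M⇒mult : ∀ {e} → M e ≡ true → 0 < mult e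
    M⇒mult {e} p with mult e
    ... | suc _ = z<s

    mult⇒G : ∀ {e} → 0 < mult e → G e ≡ true
    mult⇒G {e} = go (proj₁ (proj₂ 𝒩))
      where
      go : ∀ {N} → All (λ e → G e ≡ true) N → 0 < ∑ N (λ s → same s e) → G e ≡ true
      go (_∷_ {x = s} p ps) pos with same s e in eq
      ... | zero  = go ps pos
      ... | suc _ = subst (λ e → G e ≡ true) (same⇒≡ s e (subst (0 <_) (sym eq) z<s)) p

    M⇒G : ∀ {e} → M e ≡ true → G e ≡ true
    M⇒G = mult⇒G ∘ M⇒mult

    Σmult : ∀ v → Σₛ (λ e → mult e * ι e v) ≡ 1
    Σmult v = begin
      Σₛ (λ e → mult e * ι e v)                  ≡⟨ ∑-cong (allSubsets n) (λ e → sym (∑-*ʳ N (ι e v) _)) ⟩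
      Σₛ (λ e → ∑ N (λ s → same s e * ι e v))    ≡⟨ ∑-swap (allSubsets n) N _ ⟩
      ∑ N (λ s → Σₛ (λ e → same s e * ι e v))    ≡⟨ ∑-cong N (λ s → Σₛ-same s (λ e → ι e v)) ⟩
      cover N v                                  ≡⟨ proj₂ (proj₂ 𝒩) v ⟩
      1                                          ∎
      where open ≡-Reasoning

    -- A repeated edge would be counted twice at each of its vertices, where the total is one; so
    -- multiplicities in the list agree with the characteristic function.
    M-ι : ∀ e v → ι e v * 𝟙 (M e) ≡ mult e * ι e v
    M-ι e v = ≤1-cases (ι e v) (ι≤1 e v)
      (λ ∉ → trans (cong (_* 𝟙 (M e)) ∉) (sym (trans (cong (mult e *_) ∉) (*-zeroʳ (mult e)))))
      (λ ∈ → trans (cong (_* 𝟙 (M e)) ∈) (trans (*-identityˡ _) (trans (small ∈) (sym (trans (cong (mult e *_) ∈) (*-identityʳ (mult e)))))))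
      where
      small : ι e v ≡ 1 → 𝟙 (M e) ≡ mult e
      small ∈ with mult e | subst (_≤ 1) (trans (cong (mult e *_) ∈) (*-identityʳ (mult e))) (≤-trans (Σₛ-lookup (λ e → mult e * ι e v) e) (≤-reflexive (Σmult v)))
      ... | zero        | _ = refl
      ... | suc zero    | _ = refl
      ... | suc (suc _) | s≤s ()

    ΣM : ∀ v → Σₛ (λ e → ι e v * 𝟙 (M e)) ≡ 1
    ΣM v = trans (∑-cong (allSubsets n) (λ e → M-ι e v)) (Σmult v)

    ι-∈ : ∀ {v : Fin n} {e} → v ∈ₛ e → ι e v ≡ 1
    ι-∈ v∈e = cong 𝟙 ([]=⇒lookup v∈e)

    perfect : IsPerfectMatching G M
    perfect = (λ e → M⇒G) , disjoint , covered
      where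
      disjoint : ∀ e e′ → M e ≡ true → M e′ ≡ true → e ≢ e′ → Empty (e ∩ e′)
      disjoint e e′ Me Me′ e≢e′ (v , v∈) = contradiction (begin
        2                                        ≡⟨ cong₂ _+_ (term Me (ι-∈ (proj₁ both))) (term Me′ (ι-∈ (proj₂ both))) ⟨
        ι e v * 𝟙 (M e) + ι e′ v * 𝟙 (M e′)      ≤⟨ Σₛ-lookup₂ (λ e → ι e v * 𝟙 (M e)) e e′ e≢e′ ⟩
        Σₛ (λ e → ι e v * 𝟙 (M e))               ≡⟨ ΣM v ⟩
        1                                        ∎) λ { (s≤s ()) }
        where
        open ≤-Reasoning
        both = x∈p∩q⁻ e e′ v∈
        term : ∀ {e} → M e ≡ true → ι e v ≡ 1 → ι e v * 𝟙 (M e) ≡ 1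
        term Me ∈e = cong₂ (λ a b → a * 𝟙 b) ∈e Me
      covered : ∀ v → ∃ λ e → M e ≡ true × v ∈ₛ e
      covered v with ∑-pos⇒∃ (allSubsets n) (λ e → ι e v * 𝟙 (M e)) (subst (0 <_) (sym (ΣM v)) z<s)
      ... | e , pos with *-pos⁻¹ (ι e v) (𝟙 (M e)) pos
      ...   | ∈e , Me = e , 𝟙-true Me , lookup⇒[]= v e (𝟙-true ∈e)

    uniform′ : IsQGraph q G′
    uniform′ e p = uniform e (proj₁ (∧-true p))

    split : ∀ e → 𝟙 (G e) ≡ 𝟙 (G′ e) + 𝟙 (M e)
    split e = not-∧-split (G e) (M e) M⇒G

    deg-drop : ∀ v → deg G v ≡ deg G′ v + 1
    deg-drop v = begin
      deg G v                                                          ≡⟨ deg≡ G v ⟩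
      Σₛ (λ e → ι e v * 𝟙 (G e))                                       ≡⟨ ∑-cong (allSubsets n) (λ e → trans (cong (ι e v *_) (split e)) (*-distribˡ-+ (ι e v) _ _)) ⟩
      Σₛ (λ e → ι e v * 𝟙 (G′ e) + ι e v * 𝟙 (M e))                    ≡⟨ ∑-+ (allSubsets n) _ _ ⟩
      Σₛ (λ e → ι e v * 𝟙 (G′ e)) + Σₛ (λ e → ι e v * 𝟙 (M e))         ≡⟨ cong₂ _+_ (sym (deg≡ G′ v)) (ΣM v) ⟩
      deg G′ v + 1                                                     ∎
      where open ≡-Reasoning

    lkM : Fin n → Subset n → ℕ
    lkM v f = co f v * 𝟙 (M (f ∪ ⁅ v ⁆))

    lk-split : ∀ v f → lk G v f ≡ lk G′ v f + lkM v f
    lk-split v f = trans (𝟙-∧ (not (lookup f v)) _) (trans (cong (co f v *_) (split (f ∪ ⁅ v ⁆)))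
      (trans (*-distribˡ-+ (co f v) _ _) (cong (_+ lkM v f) (sym (𝟙-∧ (not (lookup f v)) _)))))

    -- Each of the two vertices loses exactly one set from its link, and a common set disappears
    -- only together with one of these.
    codeg-drop : ∀ v w → codeg G v w ≤ codeg G′ v w + 2
    codeg-drop v w = begin
      codeg G v w                                                      ≡⟨ codeg≡ G v w ⟩
      Σₛ (λ f → lk G v f * lk G w f)                                   ≤⟨ ∑-mono (allSubsets n) pointwise ⟩
      Σₛ (λ f → lk G′ v f * lk G′ w f + (lkM v f + lkM w f))           ≡⟨ trans (∑-+ (allSubsets n) _ _) (cong (Σₛ (λ f → lk G′ v f * lk G′ w f) +_) (∑-+ (allSubsets n) _ _)) ⟩
      Σₛ (λ f → lk G′ v f * lk G′ w f) + (Σₛ (lkM v) + Σₛ (lkM w))     ≡⟨ cong₂ _+_ (sym (codeg≡ G′ v w)) (cong₂ _+_ (ΣlkM v) (ΣlkM w)) ⟩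
      codeg G′ v w + 2                                                 ∎
      where
      open ≤-Reasoning
      ΣlkM : ∀ v → Σₛ (lkM v) ≡ 1
      ΣlkM v = trans (Σₛ-insert v (λ e → 𝟙 (M e))) (ΣM v)
      lem : ∀ a b c d → a * (b + c) + d * (b + c) ≡ a * b + (d * (b + c) + a * c)
      lem = ring
      pointwise : ∀ f → lk G v f * lk G w f ≤ lk G′ v f * lk G′ w f + (lkM v f + lkM w f)
      pointwise f = begin
        lk G v f * lk G w f                                            ≡⟨ cong₂ _*_ (lk-split v f) (lk-split w f) ⟩
        (lk G′ v f + lkM v f) * (lk G′ w f + lkM w f)                  ≡⟨ *-distribʳ-+ (lk G′ w f + lkM w f) (lk G′ v f) (lkM v f) ⟩
        lk G′ v f * (lk G′ w f + lkM w f) + lkM v f * (lk G′ w f + lkM w f) ≡⟨ lem (lk G′ v f) (lk G′ w f) (lkM w f) (lkM v f) ⟩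
        lk G′ v f * lk G′ w f + (lkM v f * (lk G′ w f + lkM w f) + lk G′ v f * lkM w f)
          ≤⟨ +-monoʳ-≤ (lk G′ v f * lk G′ w f) (+-mono-≤
               (≤-trans (*-monoʳ-≤ (lkM v f) (≤-trans (≤-reflexive (sym (lk-split w f))) (lk≤1 G w f))) (≤-reflexive (*-identityʳ (lkM v f))))
               (≤-trans (*-monoˡ-≤ (lkM w f) (lk≤1 G′ v f)) (≤-reflexive (*-identityˡ (lkM w f))))) ⟩
        lk G′ v f * lk G′ w f + (lkM v f + lkM w f)                    ∎

    hitBy : Subset n → ℕ
    hitBy S = Σₛ (λ T → 𝟙 (M T) * 𝟙 (T ⊆ᵇ S))

    -- A clique that is destroyed contains an edge of the matching; counting all such edges is crude
    -- but can be summed edge by edge.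
    clique-split : ∀ S → 𝟙 (isClique q G S) ≤ 𝟙 (isClique q G′ S) + 𝟙 (∣ S ∣ ≡ᵇ suc q) * hitBy S
    clique-split S with isClique q G S in cl
    ... | false = z≤n
    ... | true  with hitBy S in hit
    ...   | suc j = ≤-trans (*-mono-≤ {1} {𝟙 (∣ S ∣ ≡ᵇ suc q)} {1} {suc j} (subst (λ b → 1 ≤ 𝟙 b) (sym (proj₁ (∧-true cl))) ≤-refl) (s≤s z≤n)) (m≤n+m _ (𝟙 (isClique q G′ S)))
    ...   | zero  = subst (λ b → 1 ≤ 𝟙 b + 𝟙 (∣ S ∣ ≡ᵇ suc q) * 0) (sym still) (s≤s z≤n)
      where
      still : isClique q G′ S ≡ true
      still = cong₂ _∧_ (proj₁ (∧-true cl)) (and-map _ (allSubsets n) survives)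
        where
        survives : ∀ T → not ((T ⊆ᵇ S) ∧ (∣ T ∣ ≡ᵇ q)) ∨ G′ T ≡ true
        survives T with T ⊆ᵇ S in sub | ∣ T ∣ ≡ᵇ q in size
        ... | false | _     = refl
        ... | true  | false = refl
        ... | true  | true  = cong₂ _∧_ (clique-edge q G S T cl sub (≡ᵇ-true⇒≡ ∣ T ∣ q size)) (cong not unmatched)
          where
          unmatched : M T ≡ false
          unmatched with M T in MT
          ... | false = refl
          ... | true  = contradiction (≤-trans (≤-reflexive (sym (cong₂ (λ a b → 𝟙 a * 𝟙 b) MT sub))) (≤-trans (Σₛ-lookup (λ T → 𝟙 (M T) * 𝟙 (T ⊆ᵇ S)) T) (≤-reflexive hit))) λ ()

    -- If `v` is outside `T`, the only extension is `T` with `v` added; if `v` is in `T`, any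
    -- further vertex will do.
    extensions : ∀ v T → ∣ T ∣ ≡ q → Σₛ (λ S → 𝟙 (∣ S ∣ ≡ᵇ suc q) * (𝟙 (T ⊆ᵇ S) * ι S v)) ≤ ι T v * n + 1
    extensions v T ∣T∣≡q = ≤1-cases (ι T v) (ι≤1 T v) outside inside
      where
      open ≤-Reasoning
      lem : ∀ a b c → a * (b * c) ≡ b * c * a
      lem = ring
      outside : ι T v ≡ 0 → Σₛ (λ S → 𝟙 (∣ S ∣ ≡ᵇ suc q) * (𝟙 (T ⊆ᵇ S) * ι S v)) ≤ ι T v * n + 1
      outside v∉T = begin
        Σₛ (λ S → 𝟙 (∣ S ∣ ≡ᵇ suc q) * (𝟙 (T ⊆ᵇ S) * ι S v))
          ≡⟨ ∑-cong (allSubsets n) (λ S → trans (*-comm (𝟙 (∣ S ∣ ≡ᵇ suc q)) _) (cong₂ (λ a b → a * 𝟙 (∣ S ∣ ≡ᵇ b)) (sym (⊆ᵇ-insert T S v)) size)) ⟩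
        Σₛ (λ S → 𝟙 ((T ∪ ⁅ v ⁆) ⊆ᵇ S) * 𝟙 (∣ S ∣ ≡ᵇ ∣ T ∪ ⁅ v ⁆ ∣ + 0))   ≤⟨ supersets≤ (T ∪ ⁅ v ⁆) 0 ⟩
        1                  ≤⟨ m≤n+m 1 (ι T v * n) ⟩
        ι T v * n + 1      ∎
        where
        size : suc q ≡ ∣ T ∪ ⁅ v ⁆ ∣ + 0
        size = sym (trans (+-identityʳ _) (trans (∣insert∣ T v v∉T) (cong suc ∣T∣≡q)))
      inside : ι T v ≡ 1 → Σₛ (λ S → 𝟙 (∣ S ∣ ≡ᵇ suc q) * (𝟙 (T ⊆ᵇ S) * ι S v)) ≤ ι T v * n + 1
      inside v∈T = begin
        Σₛ (λ S → 𝟙 (∣ S ∣ ≡ᵇ suc q) * (𝟙 (T ⊆ᵇ S) * ι S v))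
          ≤⟨ ∑-mono (allSubsets n) (λ S → ≤-trans (*-monoʳ-≤ (𝟙 (∣ S ∣ ≡ᵇ suc q)) (≤-trans (*-monoʳ-≤ (𝟙 (T ⊆ᵇ S)) (ι≤1 S v)) (≤-reflexive (*-identityʳ (𝟙 (T ⊆ᵇ S)))))) (≤-reflexive (trans (*-comm (𝟙 (∣ S ∣ ≡ᵇ suc q)) _) (cong (λ b → 𝟙 (T ⊆ᵇ S) * 𝟙 (∣ S ∣ ≡ᵇ b)) size)))) ⟩
        Σₛ (λ S → 𝟙 (T ⊆ᵇ S) * 𝟙 (∣ S ∣ ≡ᵇ ∣ T ∣ + 1))   ≤⟨ supersets≤ T 1 ⟩
        n * 1              ≡⟨ trans (*-identityʳ n) (sym (trans (cong (_* n) v∈T) (*-identityˡ n))) ⟩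
        ι T v * n          ≤⟨ m≤m+n _ 1 ⟩
        ι T v * n + 1      ∎
        where
        size : suc q ≡ ∣ T ∣ + 1
        size = sym (trans (+-comm ∣ T ∣ 1) (cong suc ∣T∣≡q))

    ∣M∣≤n : Σₛ (λ T → 𝟙 (M T)) ≤ n
    ∣M∣≤n = begin
      Σₛ (λ T → 𝟙 (M T))                           ≤⟨ ∑-mono (allSubsets n) nonempty ⟩
      Σₛ (λ T → Σᵥ (λ v → ι T v * 𝟙 (M T)))        ≡⟨ ∑-swap (allSubsets n) (verts n) _ ⟩
      Σᵥ (λ v → Σₛ (λ T → ι T v * 𝟙 (M T)))        ≡⟨ ∑-cong (verts n) ΣM ⟩
      Σᵥ {n} (λ v → 1)                             ≡⟨ trans (Σᵥ-const {n} 1) (*-identityʳ n) ⟩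
      n                                            ∎
      where
      open ≤-Reasoning
      nonempty : ∀ T → 𝟙 (M T) ≤ Σᵥ (λ v → ι T v * 𝟙 (M T))
      nonempty T with M T in MT
      ... | false = z≤n
      ... | true  = ≤-trans (s≤s z≤n) (≤-reflexive (sym (trans (∑-cong (verts n) (λ v → *-identityʳ (ι T v))) (trans (Σᵥ-ι T) (uniform T (M⇒G MT))))))

    -- By `extensions`, the matching edge through `v` is charged n more than the others, each edge
    -- is charged one besides, and there are at most n edges.
    cliqueDeg-drop : ∀ v → cliqueDeg q G v ≤ cliqueDeg q G′ v + 2 * n
    cliqueDeg-drop v = begin
      cliqueDeg q G v                                                  ≡⟨ cliqueDeg≡ q G v ⟩
      Σₛ (λ S → ι S v * 𝟙 (isClique q G S))                            ≤⟨ ∑-mono (allSubsets n) (λ S → *-monoʳ-≤ (ι S v) (clique-split S)) ⟩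
      Σₛ (λ S → ι S v * (𝟙 (isClique q G′ S) + 𝟙 (∣ S ∣ ≡ᵇ suc q) * hitBy S)) ≡⟨ trans (∑-cong (allSubsets n) (λ S → *-distribˡ-+ (ι S v) _ _)) (∑-+ (allSubsets n) _ _) ⟩
      Σₛ (λ S → ι S v * 𝟙 (isClique q G′ S)) + Σₛ (λ S → ι S v * (𝟙 (∣ S ∣ ≡ᵇ suc q) * hitBy S)) ≤⟨ +-mono-≤ (≤-reflexive (sym (cliqueDeg≡ q G′ v))) lost ⟩
      cliqueDeg q G′ v + 2 * n                                         ∎
      where
      open ≤-Reasoning
      lem : ∀ i s m t → i * s * (m * t) ≡ m * (s * (t * i))
      lem = ring
      lem₂ : ∀ m i n → m * (i * n + 1) ≡ i * m * n + m
      lem₂ = ring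
      each : ∀ T → 𝟙 (M T) * Σₛ (λ S → 𝟙 (∣ S ∣ ≡ᵇ suc q) * (𝟙 (T ⊆ᵇ S) * ι S v)) ≤ 𝟙 (M T) * (ι T v * n + 1)
      each T with M T in MT
      ... | false = z≤n
      ... | true  = *-monoʳ-≤ 1 (extensions v T (uniform T (M⇒G MT)))
      lost : Σₛ (λ S → ι S v * (𝟙 (∣ S ∣ ≡ᵇ suc q) * hitBy S)) ≤ 2 * n
      lost = begin
        Σₛ (λ S → ι S v * (𝟙 (∣ S ∣ ≡ᵇ suc q) * hitBy S))
          ≡⟨ ∑-cong (allSubsets n) (λ S → trans (sym (*-assoc (ι S v) (𝟙 (∣ S ∣ ≡ᵇ suc q)) (hitBy S))) (trans (sym (∑-*ˡ (allSubsets n) (ι S v * 𝟙 (∣ S ∣ ≡ᵇ suc q)) _)) (∑-cong (allSubsets n) (λ T → lem (ι S v) (𝟙 (∣ S ∣ ≡ᵇ suc q)) (𝟙 (M T)) (𝟙 (T ⊆ᵇ S)))))) ⟩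
        Σₛ (λ S → Σₛ (λ T → 𝟙 (M T) * (𝟙 (∣ S ∣ ≡ᵇ suc q) * (𝟙 (T ⊆ᵇ S) * ι S v))))
          ≡⟨ trans (∑-swap (allSubsets n) (allSubsets n) _) (∑-cong (allSubsets n) (λ T → ∑-*ˡ (allSubsets n) (𝟙 (M T)) _)) ⟩
        Σₛ (λ T → 𝟙 (M T) * Σₛ (λ S → 𝟙 (∣ S ∣ ≡ᵇ suc q) * (𝟙 (T ⊆ᵇ S) * ι S v)))
          ≤⟨ ∑-mono (allSubsets n) each ⟩
        Σₛ (λ T → 𝟙 (M T) * (ι T v * n + 1))
          ≡⟨ trans (∑-cong (allSubsets n) (λ T → lem₂ (𝟙 (M T)) (ι T v) n)) (trans (∑-+ (allSubsets n) _ _) (cong (_+ Σₛ (λ T → 𝟙 (M T))) (∑-*ʳ (allSubsets n) n _))) ⟩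
        Σₛ (λ T → ι T v * 𝟙 (M T)) * n + Σₛ (λ T → 𝟙 (M T))
          ≤⟨ +-mono-≤ (≤-reflexive (trans (cong (_* n) (ΣM v)) (*-identityˡ n))) ∣M∣≤n ⟩
        n + n       ≡⟨ cong (n +_) (sym (+-identityʳ n)) ⟩
        2 * n       ∎

  -- `Conditions` with a reserve for `j` removals, each costing at most 2 common link sets and 2n
  -- cliques, scaled by 100 b. Degrees need no reserve, since a removal lowers all of them equally.
  record Budget (k′ a b j : ℕ) {n} (G : Hypergraph n) : Set where
    field
      uniform    : IsQGraph (suc (suc k′)) G
      degrees    : ∀ v w → 50 * b * deg G v ≤ 50 * b * deg G w + a * n ^ suc k′
      cliques    : ∀ v → 97 * (a * n ^ suc (suc k′)) + 200 * b * j * n ≤ 100 * b * cliqueDeg (suc (suc k′)) G v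
      codegrees  : ∀ v w → 97 * (a * n ^ suc k′) + 200 * b * j ≤ 100 * b * codeg G v w

  budget⇒conditions : ∀ {k′ a b j n} {G : Hypergraph n} → Budget k′ a b j G → Conditions k′ a b G
  budget⇒conditions B = record
    { uniform = uniform ; degrees = degrees
    ; cliques = λ v → ≤-trans (m≤m+n _ _) (cliques v)
    ; codegrees = λ v w → ≤-trans (m≤m+n _ _) (codegrees v w) }
    where open Budget B

  spend : ∀ {k′ a b j n} {G : Hypergraph n} (B : Budget k′ a b (suc j) G) (𝒩 : PerfectCover G) →
          Budget k′ a b j (Removal.G′ (Budget.uniform B) 𝒩)
  spend {k′} {a} {b} {j} {n} {G} B 𝒩 = record
    { uniform   = uniform′
    ; degrees   = λ v w → +-cancelʳ-≤ (50 * b) _ _ (begin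
        50 * b * deg G′ v + 50 * b                     ≡⟨ lem₁ (50 * b) (deg G′ v) ⟩
        50 * b * (deg G′ v + 1)                        ≡⟨ cong (50 * b *_) (deg-drop v) ⟨
        50 * b * deg G v                               ≤⟨ degrees v w ⟩
        50 * b * deg G w + a * n ^ suc k′              ≡⟨ cong (λ d → 50 * b * d + a * n ^ suc k′) (deg-drop w) ⟩
        50 * b * (deg G′ w + 1) + a * n ^ suc k′       ≡⟨ lem₂ (50 * b) (deg G′ w) (a * n ^ suc k′) ⟩
        50 * b * deg G′ w + a * n ^ suc k′ + 50 * b    ∎)
    ; cliques   = λ v → +-cancelʳ-≤ (200 * b * n) _ _ (begin
        97 * (a * n ^ suc (suc k′)) + 200 * b * j * n + 200 * b * n ≡⟨ lem₃ (97 * (a * n ^ suc (suc k′))) b j n ⟩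
        97 * (a * n ^ suc (suc k′)) + 200 * b * suc j * n           ≤⟨ cliques v ⟩
        100 * b * cliqueDeg (suc (suc k′)) G v                      ≤⟨ *-monoʳ-≤ (100 * b) (cliqueDeg-drop v) ⟩
        100 * b * (cliqueDeg (suc (suc k′)) G′ v + 2 * n)           ≡⟨ lem₄ b (cliqueDeg (suc (suc k′)) G′ v) n ⟩
        100 * b * cliqueDeg (suc (suc k′)) G′ v + 200 * b * n       ∎)
    ; codegrees = λ v w → +-cancelʳ-≤ (200 * b) _ _ (begin
        97 * (a * n ^ suc k′) + 200 * b * j + 200 * b  ≡⟨ lem₅ (97 * (a * n ^ suc k′)) b j ⟩
        97 * (a * n ^ suc k′) + 200 * b * suc j        ≤⟨ codegrees v w ⟩
        100 * b * codeg G v w                          ≤⟨ *-monoʳ-≤ (100 * b) (codeg-drop v w) ⟩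
        100 * b * (codeg G′ v w + 2)                   ≡⟨ lem₆ b (codeg G′ v w) ⟩
        100 * b * codeg G′ v w + 200 * b               ∎)
    }
    where
    open Budget B
    open Removal uniform 𝒩
    open ≤-Reasoning
    lem₁ : ∀ b d → b * d + b ≡ b * (d + 1)
    lem₁ = ring
    lem₂ : ∀ b d x → b * (d + 1) + x ≡ b * d + x + b
    lem₂ = ring
    lem₃ : ∀ x b j n → x + 200 * b * j * n + 200 * b * n ≡ x + 200 * b * (1 + j) * n
    lem₃ = ring
    lem₄ : ∀ b c n → 100 * b * (c + 2 * n) ≡ 100 * b * c + 200 * b * n
    lem₄ = ring
    lem₅ : ∀ x b j → x + 200 * b * j + 200 * b ≡ x + 200 * b * (1 + j)
    lem₅ = ring
    lem₆ : ∀ b c → 100 * b * (c + 2) ≡ 100 * b * c + 200 * b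
    lem₆ = ring

  Matchings : ∀ {n} → Hypergraph n → ℕ → Set
  Matchings {n} G j = Σ (Fin j → Subset n → Bool) (λ M → (∀ i → IsPerfectMatching G (M i)) × EdgeDisjoint M)

  matchings : ∀ {k′ a b n} → ((G : Hypergraph n) → Conditions k′ a b G → PerfectCover G) →
              ∀ j (G : Hypergraph n) → Budget k′ a b j G → Matchings G j
  matchings find zero    G B = (λ ()) , (λ ()) , λ ()
  matchings {k′} {a} {b} {n} find (suc j) G B = cons (matchings find j G′ (spend B 𝒩))
    where
    𝒩 : PerfectCover G
    𝒩 = find G (budget⇒conditions B)
    open Removal (Budget.uniform B) 𝒩
    cons : Matchings G′ j → Matchings G (suc j)
    cons (Ms , perfects , disjoint) = Ms′ , perfects′ , disjoint′
      where
      Ms′ : Fin (suc j) → Subset n → Bool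
      Ms′ zero    = M
      Ms′ (suc i) = Ms i
      perfects′ : ∀ i → IsPerfectMatching G (Ms′ i)
      perfects′ zero    = perfect
      perfects′ (suc i) = (λ e Me → proj₁ (∧-true (proj₁ (perfects i) e Me))) , proj₂ (perfects i)
      clash : ∀ i e → M e ≡ true → Ms i e ≡ true → ⊥
      clash i e Me Mie = contradiction (trans (sym (cong not Me)) (proj₂ (∧-true {G e} (proj₁ (perfects i) e Mie)))) λ ()
      disjoint′ : EdgeDisjoint Ms′
      disjoint′ zero    zero    i≢j e _  _   = i≢j refl
      disjoint′ zero    (suc i) _   e Me Mie = clash i e Me Mie
      disjoint′ (suc i) zero    _   e Mie Me = clash i e Me Mie
      disjoint′ (suc i) (suc i′) i≢j e x y   = disjoint i i′ (λ eq → i≢j (cong suc eq)) e x y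

  disjoint-perfect-matchings : ∀ k′ a b → 0 < a → 0 < b → ∃ λ n₀ → ∀ n → n₀ ≤ n → suc (suc k′) ∣ n → (G : Hypergraph n) → IsQGraph (suc (suc k′)) G →
    (∀ v w → 50 * b * deg G v ≤ 50 * b * deg G w + a * n ^ suc k′) →
    (∀ v → a * n ^ suc (suc k′) ≤ b * cliqueDeg (suc (suc k′)) G v) →
    (∀ v w → a * n ^ suc k′ ≤ b * codeg G v w) →
    ∃ λ j → a * n ^ suc k′ ≤ 100 * b * j × Matchings G j
  disjoint-perfect-matchings k′ a b 0<a 0<b = proj₁ single + 200 * b , conclude
    where
    open ≤-Reasoning
    single = perfect-matching k′ a b 0<a 0<b
    conclude : ∀ n → proj₁ single + 200 * b ≤ n → _ → ∀ G → _ → _ → _ → _ → _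
    conclude n n₀≤n q∣n G uniform degrees cliques codegrees = j , x≤100bj ,
      matchings (proj₂ single n (≤-trans (m≤m+n _ (200 * b)) n₀≤n) q∣n) j G (record
        { uniform = uniform ; degrees = degrees
        ; cliques = λ v → ≤-trans (≤-trans (≤-reflexive (lem₁ a n (n ^ suc k′) (200 * b * j))) (≤-trans (*-monoʳ-≤ n budget) (≤-reflexive (lem₂ n a (n ^ suc k′))))) (≤-trans (*-monoʳ-≤ 100 (cliques v)) (≤-reflexive (sym (*-assoc 100 b _))))
        ; codegrees = λ v w → ≤-trans budget (≤-trans (*-monoʳ-≤ 100 (codegrees v w)) (≤-reflexive (sym (*-assoc 100 b _)))) })
      where
      instance
        100b≢0 : NonZero (100 * b)
        100b≢0 = >-nonZero (*-mono-≤ {1} {100} (s≤s z≤n) 0<b)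
      x j : ℕ
      x = a * n ^ suc k′
      -- With ξ = a / b this is just above 0.01 ξ n^(q - 1).
      j = suc (x / (100 * b))
      lem₁ : ∀ a n N y → 97 * (a * (n * N)) + y * n ≡ n * (97 * (a * N) + y)
      lem₁ = ring
      lem₂ : ∀ n a N → n * (100 * (a * N)) ≡ 100 * (a * (n * N))
      lem₂ = ring
      lem₃ : ∀ b y → 200 * b * (1 + y) ≡ 2 * (y * (100 * b)) + 200 * b
      lem₃ = ring
      lem₄ : ∀ x → 97 * x + (2 * x + x) ≡ 100 * x
      lem₄ = ring
      x≤100bj : x ≤ 100 * b * j
      x≤100bj = begin
        x                                          ≡⟨ m≡m%n+[m/n]*n x (100 * b) ⟩
        x % (100 * b) + x / (100 * b) * (100 * b)  ≤⟨ +-monoˡ-≤ _ (<⇒≤ (m%n<n x (100 * b))) ⟩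
        j * (100 * b)                              ≡⟨ *-comm j (100 * b) ⟩
        100 * b * j                                ∎
      200b≤n : 200 * b ≤ n
      200b≤n = ≤-trans (m≤n+m (200 * b) (proj₁ single)) n₀≤n
      200b≤x : 200 * b ≤ x
      200b≤x = begin
        200 * b                  ≤⟨ 200b≤n ⟩
        n                        ≡⟨ *-identityʳ n ⟨
        n * 1                    ≤⟨ *-monoʳ-≤ n (m^n>0 n {{>-nonZero (≤-trans (*-mono-≤ {1} {200} (s≤s z≤n) 0<b) 200b≤n)}} k′) ⟩
        n ^ suc k′               ≡⟨ *-identityˡ _ ⟨
        1 * n ^ suc k′           ≤⟨ *-monoˡ-≤ (n ^ suc k′) 0<a ⟩
        x                        ∎
      -- Of the three percent given up, two pay for the removals themselves and one for rounding `j`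
      -- up, which is affordable once `n` is at least `200 * b`.
      budget : 97 * x + 200 * b * j ≤ 100 * x
      budget = begin
        97 * x + 200 * b * j                                     ≡⟨ cong (97 * x +_) (lem₃ b (x / (100 * b))) ⟩
        97 * x + (2 * (x / (100 * b) * (100 * b)) + 200 * b)     ≤⟨ +-monoʳ-≤ (97 * x) (+-mono-≤ (*-monoʳ-≤ 2 (m/n*n≤m x (100 * b))) 200b≤x) ⟩
        97 * x + (2 * x + x)                                     ≡⟨ lem₄ x ⟩
        100 * x                                                  ∎

-- From rational to integer inequalities.

module Fractions where
  open import Data.Integer using (+_; +≤+)
  import Data.Integer as ℤ
  import Data.Integer.Properties as ℤ
  open import Data.Nat using (ℕ; suc; zero; z≤n; s≤s)
  import Data.Nat as ℕ
  import Data.Nat.Properties as ℕ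
  open import Data.Rational
  open import Data.Rational.Properties
  import Data.Rational.Unnormalised as ᵘ
  import Data.Rational.Unnormalised.Properties as ᵘ
  open import Data.Rational.Solver using (module +-*-Solver)
  open import Relation.Binary.PropositionalEquality

  toℚᵘ-toℚ : ∀ x → toℚᵘ (toℚ x) ᵘ.≃ ᵘ.mkℚᵘ (+ x) 0
  toℚᵘ-toℚ x = toℚᵘ-fromℚᵘ (ᵘ.mkℚᵘ (+ x) 0)

  toℚ-* : ∀ x y → toℚ (x ℕ.* y) ≡ toℚ x * toℚ y
  toℚ-* x y = toℚᵘ-injective (ᵘ.≃-trans (toℚᵘ-toℚ (x ℕ.* y)) (ᵘ.≃-trans (ᵘ.*≡* (cong (ℤ._* + 1) (ℤ.pos-* x y)))
    (ᵘ.≃-sym (ᵘ.≃-trans (toℚᵘ-homo-* (toℚ x) (toℚ y)) (ᵘ.*-cong (toℚᵘ-toℚ x) (toℚᵘ-toℚ y))))))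

  toℚ-+ : ∀ x y → toℚ (x ℕ.+ y) ≡ toℚ x + toℚ y
  toℚ-+ x y = toℚᵘ-injective (ᵘ.≃-trans (toℚᵘ-toℚ (x ℕ.+ y)) (ᵘ.≃-trans (ᵘ.*≡* (cong (ℤ._* + 1) (cong₂ ℤ._+_ (sym (ℤ.*-identityʳ (+ x))) (sym (ℤ.*-identityʳ (+ y))))))
    (ᵘ.≃-sym (ᵘ.≃-trans (toℚᵘ-homo-+ (toℚ x) (toℚ y)) (ᵘ.+-cong (toℚᵘ-toℚ x) (toℚᵘ-toℚ y))))))

  toℚ-mono-≤ : ∀ {x y} → x ℕ.≤ y → toℚ x ≤ toℚ y
  toℚ-mono-≤ {x} {y} x≤y = toℚᵘ-cancel-≤ (ᵘ.≤-respˡ-≃ (ᵘ.≃-sym (toℚᵘ-toℚ x)) (ᵘ.≤-respʳ-≃ (ᵘ.≃-sym (toℚᵘ-toℚ y))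
    (ᵘ.*≤* (ℤ.*-monoʳ-≤-nonNeg (+ 1) (+≤+ x≤y)))))

  toℚ-cancel-≤ : ∀ {x y} → toℚ x ≤ toℚ y → x ℕ.≤ y
  toℚ-cancel-≤ {x} {y} le with ᵘ.≤-respˡ-≃ (toℚᵘ-toℚ x) (ᵘ.≤-respʳ-≃ (toℚᵘ-toℚ y) (toℚᵘ-mono-≤ le))
  ... | ᵘ.*≤* x1≤y1 = ℤ.drop‿+≤+ (subst₂ ℤ._≤_ (ℤ.*-identityʳ (+ x)) (ℤ.*-identityʳ (+ y)) x1≤y1)

  record Fraction (ξ : ℚ) : Set where
    field
      a b : ℕ
      0<a : 0 ℕ.< a
      0<b : 0 ℕ.< b
      bξ≡a : toℚ b * ξ ≡ toℚ a

  fraction : ∀ ξ → 0ℚ < ξ → Fraction ξ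
  fraction ξ@(mkℚ (+ suc a) d c) _ = record { a = suc a ; b = suc d ; 0<a = s≤s z≤n ; 0<b = s≤s z≤n
    ; bξ≡a = toℚᵘ-injective (ᵘ.≃-trans (toℚᵘ-homo-* (toℚ (suc d)) ξ) (ᵘ.≃-trans (ᵘ.*-congʳ {toℚᵘ ξ} (toℚᵘ-toℚ (suc d)))
        (ᵘ.≃-trans (ᵘ.*≡* (trans (ℤ.*-identityʳ _) (trans (ℤ.*-comm (+ suc d) (+ suc a)) (cong (λ x → + suc a ℤ.* + x) (sym (ℕ.*-identityˡ (suc d))))))) (ᵘ.≃-sym (toℚᵘ-toℚ (suc a)))))) }
  fraction (mkℚ (+ zero) d c) (*<* (ℤ.+<+ ()))
  fraction (mkℚ (ℤ.-[1+ a ]) d c) (*<* ())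

  nonNeg-toℚ : ∀ x → NonNegative (toℚ x)
  nonNeg-toℚ x = nonNegative (toℚ-mono-≤ {0} {x} z≤n)

  pos-toℚ : ∀ x → 0 ℕ.< x → Positive (toℚ x)
  pos-toℚ x 0<x = positive (<-≤-trans (toℚ-pos-one) (toℚ-mono-≤ 0<x))
    where
    toℚ-pos-one : 0ℚ < toℚ 1
    toℚ-pos-one = *<* (ℤ.+<+ (s≤s z≤n))

  module _ {ξ : ℚ} (F : Fraction ξ) where
    open Fraction F
    open +-*-Solver
    open ≤-Reasoning

    multiple≤ : ∀ x y → ξ * toℚ x ≤ toℚ y → a ℕ.* x ℕ.≤ b ℕ.* y
    multiple≤ x y le = toℚ-cancel-≤ (begin
      toℚ (a ℕ.* x)           ≡⟨ trans (toℚ-* a x) (cong (_* toℚ x) (sym bξ≡a)) ⟩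
      toℚ b * ξ * toℚ x       ≡⟨ *-assoc (toℚ b) ξ (toℚ x) ⟩
      toℚ b * (ξ * toℚ x)     ≤⟨ *-monoˡ-≤-nonNeg (toℚ b) {{nonNeg-toℚ b}} le ⟩
      toℚ b * toℚ y           ≡⟨ toℚ-* b y ⟨
      toℚ (b ℕ.* y)           ∎)

    percent : ∀ x → toℚ (100 ℕ.* b) * (c₀ * ξ * toℚ x) ≡ toℚ (a ℕ.* x)
    percent x = trans (cong (_* (c₀ * ξ * toℚ x)) (toℚ-* 100 b))
      (trans (solve 5 (λ h b c ξ x → h :* b :* (c :* ξ :* x) := h :* c :* (b :* ξ :* x)) refl (toℚ 100) (toℚ b) c₀ ξ (toℚ x))
      (trans (*-identityˡ _) (trans (cong (_* toℚ x) bξ≡a) (sym (toℚ-* a x)))))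

    ≤percent : ∀ x y → a ℕ.* x ℕ.≤ 100 ℕ.* b ℕ.* y → c₀ * ξ * toℚ x ≤ toℚ y
    ≤percent x y le = *-cancelˡ-≤-pos (toℚ (100 ℕ.* b)) {{pos-toℚ (100 ℕ.* b) (ℕ.*-mono-≤ {1} {100} (s≤s z≤n) 0<b)}} (begin
      toℚ (100 ℕ.* b) * (c₀ * ξ * toℚ x)    ≡⟨ percent x ⟩
      toℚ (a ℕ.* x)                         ≤⟨ toℚ-mono-≤ le ⟩
      toℚ (100 ℕ.* b ℕ.* y)                 ≡⟨ toℚ-* (100 ℕ.* b) y ⟩
      toℚ (100 ℕ.* b) * toℚ y               ∎)

    -- The two bounds differ by 0.02 ξ x whatever `d` is, and 50 b times that is a x, so `d`
    -- disappears.
    spread : ∀ d x y y′ → toℚ y ≤ (d + c₀ * ξ) * toℚ x → (d - c₀ * ξ) * toℚ x ≤ toℚ y′ →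
             50 ℕ.* b ℕ.* y ℕ.≤ 50 ℕ.* b ℕ.* y′ ℕ.+ a ℕ.* x
    spread d x y y′ upper lower = toℚ-cancel-≤ (begin
      toℚ (50 ℕ.* b ℕ.* y)                                ≡⟨ toℚ-* (50 ℕ.* b) y ⟩
      B * toℚ y                                           ≤⟨ *-monoˡ-≤-nonNeg B {{nonNeg-toℚ (50 ℕ.* b)}} upper ⟩
      B * ((d + c₀ * ξ) * toℚ x)
        ≡⟨ solve 4 (λ B d r x → B :* ((d :+ r) :* x) := B :* ((d :- r) :* x) :+ (B :+ B) :* (r :* x)) refl B d (c₀ * ξ) (toℚ x) ⟩
      B * ((d - c₀ * ξ) * toℚ x) + (B + B) * (c₀ * ξ * toℚ x)
        ≤⟨ +-monoˡ-≤ _ (*-monoˡ-≤-nonNeg B {{nonNeg-toℚ (50 ℕ.* b)}} lower) ⟩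
      B * toℚ y′ + (B + B) * (c₀ * ξ * toℚ x)
        ≡⟨ cong₂ _+_ (sym (toℚ-* (50 ℕ.* b) y′)) (trans (cong (_* (c₀ * ξ * toℚ x)) (trans (sym (toℚ-+ (50 ℕ.* b) (50 ℕ.* b))) (cong toℚ (sym (ℕ.*-distribʳ-+ b 50 50))))) (percent x)) ⟩
      toℚ (50 ℕ.* b ℕ.* y′) + toℚ (a ℕ.* x)               ≡⟨ toℚ-+ (50 ℕ.* b ℕ.* y′) (a ℕ.* x) ⟨
      toℚ (50 ℕ.* b ℕ.* y′ ℕ.+ a ℕ.* x)                   ∎)
      where
      B : ℚ
      B = toℚ (50 ℕ.* b)

open Packing
open Fractions
open import Data.Nat using (ℕ; zero; suc; s≤s; _≤_; _^_; _∸_)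
open import Data.Nat.Divisibility using (_∣_)
open import Data.Fin using (Fin)
open import Data.Fin.Subset using (Subset)
open import Data.Bool using (Bool)
open import Data.Rational using (ℚ; 0ℚ; _<_; _*_; _+_; _-_) renaming (_≤_ to _≤ℚ_)
open import Data.Product using (Σ; ∃; _×_)

theorem1p5 : (q : ℕ) → 2 ≤ q → (ξ : ℚ) → 0ℚ < ξ →
    ∃ λ (n₀ : ℕ) → ∀ (n : ℕ) → n₀ ≤ n → q ∣ n →
      (G : Hypergraph n) → IsQGraph q G →
      (∃ λ (d : ℚ) → ξ ≤ℚ d × (∀ (v : Fin n) →
          ((d - c₀ * ξ) * toℚ (n ^ (q ∸ 1)) ≤ℚ toℚ (deg G v)) ×
          (toℚ (deg G v) ≤ℚ (d + c₀ * ξ) * toℚ (n ^ (q ∸ 1))))) →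
      (∀ (v : Fin n) → ξ * toℚ (n ^ q) ≤ℚ toℚ (cliqueDeg q G v)) →
      (∀ (v w : Fin n) → ξ * toℚ (n ^ (q ∸ 1)) ≤ℚ toℚ (codeg G v w)) →
      ∃ λ (k : ℕ) → (c₀ * ξ * toℚ (n ^ (q ∸ 1)) ≤ℚ toℚ k) ×
        Σ (Fin k → Subset n → Bool) (λ M →
          (∀ (i : Fin k) → IsPerfectMatching G (M i)) × EdgeDisjoint M)
theorem1p5 (suc (suc k′)) _ ξ 0<ξ = proj₁ packing , λ n n₀≤n q∣n G uniform (d , _ , degrees) cliques codegrees →
  let N = n ^ suc k′
      j , enough , matchings = proj₂ packing n n₀≤n q∣n G uniform
        (λ v w → spread F d N (deg G v) (deg G w) (proj₂ (degrees v)) (proj₁ (degrees w)))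
        (λ v → multiple≤ F (n ^ suc (suc k′)) (cliqueDeg (suc (suc k′)) G v) (cliques v))
        (λ v w → multiple≤ F N (codeg G v w) (codegrees v w))
  in j , ≤percent F N j enough , matchings
  where
  F : Fraction ξ
  F = fraction ξ 0<ξ
  packing = disjoint-perfect-matchings k′ (Fraction.a F) (Fraction.b F) (Fraction.0<a F) (Fraction.0<b F)
theorem1p5 (suc zero) (s≤s ())
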